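{- Up to isomorphism and duality there are exactly nine symmetric $2$-$(70,24,8)$ designs admitting an automorphism group isomorphic to $Frob_{21} \times Z_2$ acting with orbit lengths distribution $(7,7,14,42)$. Two of these designs are self-dual. The full automorphism groups of these designs are isomorphic to $Frob_{21} \times Z_2$.
   Context: A symmetric $2$-$(70,24,8)$ design consists of $70$ points and $70$ blocks, each block containing $24$ points, with every pair of distinct points in exactly $8$ blocks. An automorphism group acts on points and on blocks; orbit lengths distribution $(7,7,14,42)$ means the group has four orbits on points (and on blocks) of sizes $7,7,14,42$. "Up to isomorphism and duality" means a design and its dual (points and blocks interchanged) are counted once; a design is self-dual if it is isomorphic to its dual. $Frob_{21}$ denotes the Frobenius group of order $21$ ($Z_7 \rtimes Z_3$). -}

module Defs where

open import Data.Nat using (ℕ; zero; suc; _+_; _*_; _^_; _≡ᵇ_; _≤ᵇ_)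
open import Data.Nat.DivMod using (_mod_)
open import Data.Fin using (Fin; toℕ; _≟_)
open import Data.Fin.Permutation using (Permutation′; _⟨$⟩ʳ_)
open import Data.Bool using (Bool; true; false; if_then_else_; _∧_; _∨_; not)
open import Data.List using (List; []; _∷_; map; foldr; allFin; concatMap)
open import Data.Bool.ListAction using (any; all)
open import Data.Nat.ListAction using (sum)
open import Data.List.Relation.Binary.Permutation.Propositional using (_↭_)
open import Data.Product using (Σ; ∃; ∃₂; _×_; _,_)
open import Data.Sum using (_⊎_)
open import Relation.Binary.PropositionalEquality using (_≡_; _≢_)
open import Relation.Nullary.Decidable using (⌊_⌋)

count : ∀ {n} → (Fin n → Bool) → ℕ
count {n} f = sum (map (λ x → if f x then 1 else 0) (allFin n))

-- Incidence structures with 70 points and 70 blocks.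
-- D p b = true  iff point p lies on block b.

Design : Set
Design = Fin 70 → Fin 70 → Bool

IsSymmetric-70-24-8 : Design → Set
IsSymmetric-70-24-8 D =
  (∀ b → count (λ p → D p b) ≡ 24) ×
  (∀ p q → p ≢ q → count (λ b → D p b ∧ D q b) ≡ 8)

dual : Design → Design
dual D p b = D b p

_≅_ : Design → Design → Set
D ≅ D′ = Σ (Permutation′ 70) λ σ → Σ (Permutation′ 70) λ τ →
  ∀ p b → D′ (σ ⟨$⟩ʳ p) (τ ⟨$⟩ʳ b) ≡ D p b

SelfDual : Design → Set
SelfDual D = D ≅ dual D

IsAutomorphism : Design → Permutation′ 70 → Permutation′ 70 → Set
IsAutomorphism D σ τ = ∀ p b → D (σ ⟨$⟩ʳ p) (τ ⟨$⟩ʳ b) ≡ D p b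

-- The group Frob₂₁ × Z₂ = (Z₇ ⋊ Z₃) × Z₂, where the generator of Z₃
-- acts on Z₇ by x ↦ 2x (2 has order 3 mod 7).
-- Element (a , e , c) ; product
-- (a , e , c) · (a′ , e′ , c′) = (a + 2^e a′ , e + e′ , c + c′).

G : Set
G = Fin 7 × Fin 3 × Fin 2

_·_ : G → G → G
(a , e , c) · (a′ , e′ , c′) =
  ((toℕ a + 2 ^ toℕ e * toℕ a′) mod 7) ,
  ((toℕ e + toℕ e′) mod 3) ,
  ((toℕ c + toℕ c′) mod 2)

elemsG : List G
elemsG = concatMap (λ a → concatMap (λ e → map (λ c → (a , e , c)) (allFin 2)) (allFin 3)) (allFin 7)

inOrbit : (G → Permutation′ 70) → Fin 70 → Fin 70 → Bool
inOrbit ρ x y = any (λ g → ⌊ ρ g ⟨$⟩ʳ x ≟ y ⌋) elemsG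

orbitSize : (G → Permutation′ 70) → Fin 70 → ℕ
orbitSize ρ x = count (λ y → inOrbit ρ x y)

isRep : (G → Permutation′ 70) → Fin 70 → Bool
isRep ρ x = all (λ y → not (inOrbit ρ x y) ∨ (toℕ x ≤ᵇ toℕ y)) (allFin 70)

orbitLengths : (G → Permutation′ 70) → List ℕ
orbitLengths ρ =
  foldr (λ x acc → if isRep ρ x then orbitSize ρ x ∷ acc else acc) [] (allFin 70)

record IsFaithfulAutAction (D : Design) (ρ β : G → Permutation′ 70) : Set where
  field
    homP      : ∀ g h x → ρ (g · h) ⟨$⟩ʳ x ≡ ρ g ⟨$⟩ʳ (ρ h ⟨$⟩ʳ x)
    homB      : ∀ g h b → β (g · h) ⟨$⟩ʳ b ≡ β g ⟨$⟩ʳ (β h ⟨$⟩ʳ b)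
    faithful  : ∀ g h → (∀ x → ρ g ⟨$⟩ʳ x ≡ ρ h ⟨$⟩ʳ x) →
                (∀ b → β g ⟨$⟩ʳ b ≡ β h ⟨$⟩ʳ b) → g ≡ h
    byAutos   : ∀ g → IsAutomorphism D (ρ g) (β g)

Admits : Design → Set
Admits D = IsSymmetric-70-24-8 D ×
  Σ (G → Permutation′ 70) λ ρ → Σ (G → Permutation′ 70) λ β →
    IsFaithfulAutAction D ρ β ×
    (orbitLengths ρ ↭ (7 ∷ 7 ∷ 14 ∷ 42 ∷ [])) ×
    (orbitLengths β ↭ (7 ∷ 7 ∷ 14 ∷ 42 ∷ []))

FullAutIsG : Design → Set
FullAutIsG D = Σ (G → Permutation′ 70) λ ρ → Σ (G → Permutation′ 70) λ β →
  IsFaithfulAutAction D ρ β ×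
  (∀ σ τ → IsAutomorphism D σ τ →
    ∃ λ g → (∀ x → σ ⟨$⟩ʳ x ≡ ρ g ⟨$⟩ʳ x) × (∀ b → τ ⟨$⟩ʳ b ≡ β g ⟨$⟩ʳ b))

{-# OPTIONS --safe #-}
-- The action of Frob₂₁ × ℤ₂ on points and blocks is forced by the orbit lengths, so an incidence matrix
-- consists of 10 × 10 circulant blocks of size 7, that is, of a 10 × 10 matrix over the group ring ℤ[ℤ/7].
-- The quotient by the central involution is classified first, by evaluating the group ring at B = 14 modulo
-- B⁷ − 1 and modulo the prime 1 + B + … + B⁶; its solutions are then lifted through the signs of the regular
-- orbit.  A variance argument shows that duals are designs again.  Triple intersection numbers yield a point
-- invariant that separates the nine designs from each other and from the duals, and that is injective on points
-- from a base point in the regular orbit, so an automorphism is determined by the image of one point.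
module Submission where

open import Defs as _
open import Data.Nat using (NonZero; _%_; _*_; _+_; _/_; _<_; _<ᵇ_; _^_; _∸_; _≡ᵇ_; _≤_; _≤ᵇ_; suc; s≤s; zero; z≤n; ℕ; ∣_-_∣)
open import Data.Nat.Properties as _ using (+-identityʳ; *-assoc; *-cancelˡ-≡; *-comm; *-distribʳ-+; *-distribˡ-+; *-mono-≤; *-monoʳ-≤; *-zeroʳ; +-assoc; +-cancelʳ-≡; +-cancelˡ-≡; +-comm; +-mono-≤; +-suc; <ᵇ⇒<; <⇒<ᵇ; <⇒≱; m+1+n≢m; m+[n∸m]≡n; m+n∸m≡n; m+n∸n≡m; m+n≡0⇒m≡0; m+n≡0⇒n≡0; m≤m+n; m≤n+m; m≤n⇒m<n∨m≡n; m≤n⇒∣m-n∣≡n∸m; m≤n⇒∣n-m∣≡n∸m; ∣m-n∣≡0⇒m≡n; ≡ᵇ⇒≡; ≡⇒≡ᵇ; ≤-antisym; ≤-reflexive; ≤-total; ≤-trans; ≤⇒≤ᵇ; ≰⇒>)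
open import Data.Nat.DivMod as _ using (+-distrib-/-∣ʳ; /-monoˡ-≤; [m+kn]%n≡m%n; _mod_; m%n<n; m*n/n≡m; m<n⇒m%n≡m; m<n⇒m/n≡0; m≡m%n+[m/n]*n; n%n≡0)
open import Data.Nat.Solver as _ using (module +-*-Solver)
open import Data.Product as _ using (_,_; _×_; proj₁; proj₂; uncurry; Σ; ∃; ∃₂)
open import Relation.Binary.PropositionalEquality as _ using (_≡_; _≢_; refl; cong; cong₂; subst; subst₂; sym; trans; module ≡-Reasoning)
open import Data.Bool as _ using (Bool; T; _∧_; _∨_; false; if_then_else_; not; true)
open import Data.Bool.ListAction as _ using (all; any)
open import Data.List as _ using (List; []; _++_; _∷_; allFin; concatMap; filterᵇ; foldr; length; map; zipWith)
open import Data.Fin as _ using (Fin; _≟_; combine; fromℕ<; suc; toℕ; zero)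
open import Data.Fin.Patterns as _
open import Data.Bool.Properties as _ using (T-∧; T-≡)
open import Data.List.Membership.Propositional as _ using (_∈_; _∉_; find; lose)
open import Data.List.Membership.Propositional.Properties as _ using (∈-++⁻; ∈-allFin; ∈-concatMap⁺; ∈-filter⁺; ∈-filter⁻; ∈-map⁺; ∈-map⁻; ∈-∃++)
open import Data.List.Relation.Unary.Any as _ using (here; there)
open import Data.List.Relation.Unary.All.Properties as _ using (all⁺)
open import Data.Unit as _ using (tt)
open import Function as _ using (Equivalence; _∘_)
open import Relation.Nullary.Decidable as _ using (T?; fromWitness; toWitness; ⌊_⌋)
open import Data.Nat.Divisibility as _ using (n∣m*n)
open import Data.Sum as _ using (_⊎_; inj₁; inj₂)
open import Data.List.Relation.Unary.Any.Properties as _ using (any⁺; any⁻)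
open import Data.Fin.Properties as _ using (toℕ-fromℕ<; toℕ-injective; toℕ<n)
open import Data.Fin.Permutation as _ using (Permutation′; _∘ₚ_; _⟨$⟩ʳ_; _⟨$⟩ˡ_; flip; inverseʳ; inverseˡ; permutation)
open import Relation.Nullary as _ using (Dec; no; yes; ¬_)
open import Data.Nat.ListAction as _ using (sum)
open import Data.Nat.ListAction.Properties as _ using (sum-++; sum-↭)
open import Data.List.Properties as _ using (length-++; length-map; length-tabulate; map-++; map-cong; map-∘)
open import Data.List.Relation.Unary.All as _ using (All; []; _∷_)
open import Data.List.Relation.Unary.AllPairs as _ using ([]; _∷_)
open import Data.List.Relation.Unary.Unique.Propositional as _ using (Unique)
open import Data.List.Relation.Unary.Unique.Propositional.Properties as _ using (++⁺; allFin⁺; filter⁺; map⁺)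
open import Data.List.Relation.Binary.Permutation.Propositional as _ using (_↭_; prep; ↭-refl; ↭-reflexive; ↭-trans)
open import Data.List.Relation.Binary.Permutation.Propositional.Properties as _ using (↭-length; ↭-map-inv; ∈-resp-↭) renaming (map⁺ to ↭-map⁺; shift to ↭-shift)
open import Data.Empty as _ using (⊥; ⊥-elim)
open import Data.Nat.Induction as _ using (<-wellFounded)
open import Induction.WellFounded as _ using (Acc; acc)
import Data.List.Relation.Unary.All as All

-- The type checker itself evaluates the search, and this shapes the proof. By invariance under the
-- generators of order 3 and 2 a matrix is determined by its rows in the classes 0, 1, 2 and 4. The
-- rows 0, 1, 2 are stable under the element of order 3, so there are few of them; the same list of
-- triples serves for the columns, because the dual is a design too. A row triple and a column
-- triple that agree on their common 3 × 3 corner leave three unknown entries of row 4 in the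
-- quotient, that is 3²¹ possibilities. Since J is the value of the all-one vector, all inner
-- products of row 4 with the rows 0, 1, 2 vanish modulo J, and a linear system over a field
-- replaces the enumeration. The same device finds the last unknown entry during the lift. Every
-- congruence serves as a necessary condition only: evaluation at B need not be faithful on
-- products, because each surviving matrix is compared entry by entry with an explicit isomorphism
-- onto a listed design or its dual.

-- Functions on ℤ/7 and the evaluation of the group ring.

data V3 : Set where
  v3 : ℕ → ℕ → ℕ → V3

-- v7 f₀ … f₆ is a function on ℤ/7, and at the same time the element Σ fₓ gˣ of the group ring.
data V7 : Set where
  v7 : ℕ → ℕ → ℕ → ℕ → ℕ → ℕ → ℕ → V7

-- These are the functions fixed by `θ`: the classes are 0, the squares 1, 2, 4 and the non-squares
-- 3, 5, 6.
cell : V3 → V7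
cell (v3 a b c) = v7 a b b c b c c

rev : V7 → V7
rev (v7 a b c d e f g) = v7 a g f e d c b

-- (θ f)(2x) = f(x)
θ : V7 → V7
θ (v7 a b c d e f g) = v7 a e b f c g d

shift : V7 → V7
shift (v7 a b c d e f g) = v7 g a b c d e f

tot : V7 → ℕ
tot (v7 a b c d e f g) = a + (b + (c + (d + (e + (f + g)))))

infixl 6 _⊕_ _⊖_
infixl 7 _⊛_

_⊕_ _⊖_ : V7 → V7 → V7
v7 a b c d e f g ⊕ v7 a′ b′ c′ d′ e′ f′ g′ = v7 (a + a′) (b + b′) (c + c′) (d + d′) (e + e′) (f + f′) (g + g′)
v7 a b c d e f g ⊖ v7 a′ b′ c′ d′ e′ f′ g′ = v7 (a ∸ a′) (b ∸ b′) (c ∸ c′) (d ∸ d′) (e ∸ e′) (f ∸ f′) (g ∸ g′)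

_⊛_ : ℕ → V7 → V7
k ⊛ v7 a b c d e f g = v7 (k * a) (k * b) (k * c) (k * d) (k * e) (k * f) (k * g)

-- corr u v = (d ↦ Σ_b v_b u_{b+d}), the group ring product of u and rev v.
corr : V7 → V7 → V7
corr u (v7 a b c d e f g) =
  a ⊛ u ⊕ (g ⊛ shift u ⊕ (f ⊛ s² ⊕ (e ⊛ s³ ⊕ (d ⊛ s⁴ ⊕ (c ⊛ s⁵ ⊕ b ⊛ s⁶)))))
  where
  s² = shift (shift u)
  s³ = shift s²
  s⁴ = shift s³
  s⁵ = shift s⁴
  s⁶ = shift s⁵

-- Evaluating the group ring at B turns products into products of integers modulo M = B⁷ − 1,
-- and modulo the cofactor J = 1 + B + … + B⁶ the all-one vector vanishes.  J is prime for B = 14.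
opaque
  B J M ν : ℕ
  B = 14
  J = 8108731
  M = 105413503
  ν = 8108730

num : V7 → ℕ
num (v7 a b c d e f g) = a + B * (b + B * (c + B * (d + B * (e + B * (f + B * g)))))

opaque
  unfolding B J M ν

  instance
    J≢0 : NonZero J
    J≢0 = _
    M≢0 : NonZero M
    M≢0 = _

  J≡num : J ≡ num (v7 1 1 1 1 1 1 1)
  J≡num = refl

  M≡ : M ≡ 13 * J
  M≡ = refl

  B≡ : B ≡ 14
  B≡ = refl

  B⁷≡ : B * (B * (B * (B * (B * (B * B))))) ≡ 1 + M
  B⁷≡ = refl

  1+ν≡J : 1 + ν ≡ J
  1+ν≡J = refl

modJ modM : ℕ → ℕ
modJ n = n % J
modM n = n % M

module Congruence (n : ℕ) where
  open +-*-Solver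

  infix 4 _≈_

  -- Multiples are added on both sides because ℕ has no subtraction; a congruence then amounts to an
  -- equation that the ring solver can treat.
  record _≈_ (a b : ℕ) : Set where
    constructor congruent
    field
      k l : ℕ
      eq  : a + k * n ≡ b + l * n

  ≡⇒≈ : ∀ {a b} → a ≡ b → a ≈ b
  ≡⇒≈ p = congruent 0 0 (cong (_+ 0) p)

  ≈-refl : ∀ {a} → a ≈ a
  ≈-refl = ≡⇒≈ refl

  ≈-sym : ∀ {a b} → a ≈ b → b ≈ a
  ≈-sym (congruent k l p) = congruent l k (sym p)

  ≈-trans : ∀ {a b c} → a ≈ b → b ≈ c → a ≈ c
  ≈-trans {a} {b} {c} (congruent k l p) (congruent k′ l′ q) = congruent (k + k′) (l′ + l) (begin
    a + (k + k′) * n      ≡⟨ split a k k′ ⟩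
    a + k * n + k′ * n    ≡⟨ cong (_+ k′ * n) p ⟩
    b + l * n + k′ * n    ≡⟨ swap b l k′ ⟩
    b + k′ * n + l * n    ≡⟨ cong (_+ l * n) q ⟩
    c + l′ * n + l * n    ≡⟨ split c l′ l ⟨
    c + (l′ + l) * n      ∎)
    where
    open ≡-Reasoning
    split : ∀ x y z → x + (y + z) * n ≡ x + y * n + z * n
    split x y z = trans (cong (x +_) (*-distribʳ-+ n y z)) (sym (+-assoc x (y * n) (z * n)))
    swap : ∀ x y z → x + y * n + z * n ≡ x + z * n + y * n
    swap x y z = trans (+-assoc x _ _) (trans (cong (x +_) (+-comm (y * n) _)) (sym (+-assoc x _ _)))

  +-cong : ∀ {a b c d} → a ≈ b → c ≈ d → a + c ≈ b + d
  +-cong {a} {b} {c} {d} (congruent k l p) (congruent k′ l′ q) =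
    congruent (k + k′) (l + l′) (trans (shuffle a c k k′) (trans (cong₂ _+_ p q) (sym (shuffle b d l l′))))
    where
    shuffle : ∀ x y k l → x + y + (k + l) * n ≡ (x + k * n) + (y + l * n)
    shuffle = solve 5 (λ n x y k l → x :+ y :+ (k :+ l) :* n := (x :+ k :* n) :+ (y :+ l :* n)) refl n

  *-cong : ∀ {a b c d} → a ≈ b → c ≈ d → a * c ≈ b * d
  *-cong {a} {b} {c} {d} (congruent k l p) (congruent k′ l′ q) =
    congruent (a * k′ + k * c + k * n * k′) (b * l′ + l * d + l * n * l′)
      (trans (shuffle a c k k′) (trans (cong₂ _*_ p q) (sym (shuffle b d l l′))))
    where
    shuffle : ∀ x y k l → x * y + (x * l + k * y + k * n * l) * n ≡ (x + k * n) * (y + l * n)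
    shuffle = solve 5 (λ n x y k l → x :* y :+ (x :* l :+ k :* y :+ k :* n :* l) :* n := (x :+ k :* n) :* (y :+ l :* n)) refl n

  +-congˡ : ∀ a {b c} → b ≈ c → a + b ≈ a + c
  +-congˡ a = +-cong (≈-refl {a})

  *-congˡ : ∀ a {b c} → b ≈ c → a * b ≈ a * c
  *-congˡ a = *-cong (≈-refl {a})

  multiple≈0 : ∀ k → k * n ≈ 0
  multiple≈0 k = congruent 0 k (+-identityʳ (k * n))

  infix  3 _∎≈
  infixr 2 step-≈ step-≡

  step-≈ : ∀ a {b c} → b ≈ c → a ≈ b → a ≈ c
  step-≈ a q p = ≈-trans p q

  step-≡ : ∀ a {b c} → b ≈ c → a ≡ b → a ≈ c
  step-≡ a q p = ≈-trans (≡⇒≈ p) q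

  syntax step-≈ a q p = a ≈⟨ p ⟩ q
  syntax step-≡ a q p = a ≡⟨ p ⟩≈ q

  _∎≈ : ∀ a → a ≈ a
  a ∎≈ = ≈-refl

  module _ .{{_ : NonZero n}} where

    ≈⇒% : ∀ {a b} → a ≈ b → a % n ≡ b % n
    ≈⇒% {a} {b} (congruent k l p) = trans (sym ([m+kn]%n≡m%n a k n)) (trans (cong (_% n) p) ([m+kn]%n≡m%n b l n))

    %≈ : ∀ a → a % n ≈ a
    %≈ a = congruent (a / n) 0 (trans (sym (m≡m%n+[m/n]*n a n)) (sym (+-identityʳ a)))

    %⇒≈ : ∀ {a b} → a % n ≡ b → a ≈ b
    %⇒≈ {a} refl = ≈-sym (%≈ a)

module ModM = Congruence M
module ModJ = Congruence J

M⇒J : ∀ {a b} → a ModM.≈ b → a ModJ.≈ b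
M⇒J {a} {b} (ModM.congruent k l p) = ModJ.congruent (k * 13) (l * 13) (trans (lemma a k) (trans p (sym (lemma b l))))
  where
  lemma : ∀ x k → x + k * 13 * J ≡ x + k * M
  lemma x k = cong (x +_) (trans (*-assoc k 13 J) (cong (k *_) (sym M≡)))

-- `ν` is J - 1, so multiplication by it plays the role of negation.
ν-negates : ∀ x → x + ν * x ModJ.≈ 0
ν-negates x = ModJ.≈-trans (ModJ.≡⇒≈ (trans (cong (_* x) 1+ν≡J) (*-comm J x))) (ModJ.multiple≈0 x)

negate : ∀ x {y} → x + y ModJ.≈ 0 → x ModJ.≈ ν * y
negate x {y} p =
  x                 ≡⟨ sym (+-identityʳ x) ⟩≈
  x + 0             ≈⟨ +-congˡ x (≈-sym (ν-negates y)) ⟩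
  x + (y + ν * y)   ≡⟨ sym (+-assoc x y _) ⟩≈
  x + y + ν * y     ≈⟨ +-cong p ≈-refl ⟩
  ν * y             ∎≈
  where open ModJ

module _ where
  open +-*-Solver

  horner : ∀ {n} → (B a b c d e f g : Polynomial n) → Polynomial n
  horner B a b c d e f g = a :+ B :* (b :+ B :* (c :+ B :* (d :+ B :* (e :+ B :* (f :+ B :* g)))))

  num-⊕ : ∀ u v → num (u ⊕ v) ≡ num u + num v
  num-⊕ (v7 a b c d e f g) (v7 a′ b′ c′ d′ e′ f′ g′) =
    solve 15 (λ B a b c d e f g a′ b′ c′ d′ e′ f′ g′ →
      horner B (a :+ a′) (b :+ b′) (c :+ c′) (d :+ d′) (e :+ e′) (f :+ f′) (g :+ g′) :=
      horner B a b c d e f g :+ horner B a′ b′ c′ d′ e′ f′ g′) refl B a b c d e f g a′ b′ c′ d′ e′ f′ g′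

  num-⊛ : ∀ k u → num (k ⊛ u) ≡ k * num u
  num-⊛ k (v7 a b c d e f g) =
    solve 9 (λ B k a b c d e f g →
      horner B (k :* a) (k :* b) (k :* c) (k :* d) (k :* e) (k :* f) (k :* g) := k :* horner B a b c d e f g)
      refl B k a b c d e f g

  -- B⁷ = 1 + M, so the top digit, pushed to position 7 by the factor B, re-enters at position 0.
  num-shift : ∀ u → B * num u ModM.≈ num (shift u)
  num-shift u@(v7 a b c d e f g) = ModM.congruent 0 g (begin
    B * num u + 0      ≡⟨ solve 8 (λ B a b c d e f g →
        B :* horner B a b c d e f g :+ con 0 := con 0 :+ B :* horner B a b c d e f (con 0) :+ g :* (B :* (B :* (B :* (B :* (B :* (B :* B)))))))
        refl B a b c d e f g ⟩
    0 + B * num (v7 a b c d e f 0) + g * (B * (B * (B * (B * (B * (B * B))))))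
                       ≡⟨ cong (λ x → 0 + B * num (v7 a b c d e f 0) + g * x) B⁷≡ ⟩
    0 + B * num (v7 a b c d e f 0) + g * (1 + M)
                       ≡⟨ solve 9 (λ B M a b c d e f g →
        con 0 :+ B :* horner B a b c d e f (con 0) :+ g :* (con 1 :+ M) := horner B g a b c d e f :+ g :* M)
        refl B M a b c d e f g ⟩
    num (shift u) + g * M ∎)
    where open ≡-Reasoning

-- Expand `num (rev v)` in powers of B: each factor B becomes one shift of u, and the digits of
-- `rev v` appear in the order in which `corr` lists its summands.
num-corr : ∀ u v → num u * num (rev v) ModM.≈ num (corr u v)
num-corr u (v7 a b c d e f g) =
  num u * num (rev (v7 a b c d e f g))
    ≡⟨ expand B (num u) a g f e d c b ⟩≈
  a * n₀ + (g * (B * n₀) + (f * (B * (B * n₀)) + (e * (B * (B * (B * n₀))) + (d * (B * (B * (B * (B * n₀)))) + (c * (B * (B * (B * (B * (B * n₀))))) + b * (B * (B * (B * (B * (B * (B * n₀)))))))))))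
    ≈⟨ +-congˡ (a * num u) (+-cong (*-congˡ g e₁) (+-cong (*-congˡ f e₂) (+-cong (*-congˡ e e₃) (+-cong (*-congˡ d e₄) (+-cong (*-congˡ c e₅) (*-congˡ b e₆)))))) ⟩
  a * num u + (g * num s₁ + (f * num s₂ + (e * num s₃ + (d * num s₄ + (c * num s₅ + b * num s₆)))))
    ≡⟨ sym (lin a u (lin g s₁ (lin f s₂ (lin e s₃ (lin d s₄ (lin c s₅ (num-⊛ b s₆))))))) ⟩≈
  num (corr u (v7 a b c d e f g)) ∎≈
  where
  open ModM
  n₀ = num u
  s₁ = shift u
  s₂ = shift s₁
  s₃ = shift s₂
  s₄ = shift s₃
  s₅ = shift s₄
  s₆ = shift s₅
  next : ∀ {x} v → x ≈ num v → B * x ≈ num (shift v)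
  next v p = ≈-trans (*-congˡ B p) (num-shift v)
  e₁ = next u ≈-refl
  e₂ = next s₁ e₁
  e₃ = next s₂ e₂
  e₄ = next s₃ e₃
  e₅ = next s₄ e₄
  e₆ = next s₅ e₅
  lin : ∀ k v {w n} → num w ≡ n → num (k ⊛ v ⊕ w) ≡ k * num v + n
  lin k v {w} p = trans (num-⊕ (k ⊛ v) w) (cong₂ _+_ (num-⊛ k v) p)
  expand : ∀ B n a g f e d c b → n * (a + B * (g + B * (f + B * (e + B * (d + B * (c + B * b)))))) ≡
    a * n + (g * (B * n) + (f * (B * (B * n)) + (e * (B * (B * (B * n))) + (d * (B * (B * (B * (B * n)))) + (c * (B * (B * (B * (B * (B * n))))) + b * (B * (B * (B * (B * (B * (B * n)))))))))))
  expand = solve 9 (λ B n a g f e d c b → n :* horner B a g f e d c b :=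
    a :* n :+ (g :* (B :* n) :+ (f :* (B :* (B :* n)) :+ (e :* (B :* (B :* (B :* n))) :+ (d :* (B :* (B :* (B :* (B :* n)))) :+ (c :* (B :* (B :* (B :* (B :* (B :* n))))) :+ b :* (B :* (B :* (B :* (B :* (B :* (B :* n)))))))))))) refl
    where open +-*-Solver

-- Enumeration of the rows 0, 1, 2 of the quotient.

infixr 5 _⟹_

_⟹_ : Bool → Bool → Bool
false ⟹ q = true
true ⟹ q = q

all3 : List ℕ → List V3
all3 d = concatMap (λ a → concatMap (λ b → map (v3 a b) d) d) d

choices : (d₀ d₁ d₂ d₃ d₄ d₅ d₆ : List ℕ) → List V7
choices d₀ d₁ d₂ d₃ d₄ d₅ d₆ =
  concatMap (λ a → concatMap (λ b → concatMap (λ c → concatMap (λ d → concatMap (λ e → concatMap (λ f →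
    map (v7 a b c d e f) d₆) d₅) d₄) d₃) d₂) d₁) d₀

all7 : List ℕ → List V7
all7 d = choices d d d d d d d

-- The columns 0, 1, 2 of a merged row, with its weight and the values of its entries and of their
-- reversals computed once. Merging doubles the entries in the columns 0 and 1, which `ζ` fixes,
-- while column 2 also stands for column 3; all weights and products are therefore twice the sums
-- over merged columns, and the total weight is 48.
data AInfo : Set where
  mkA : (a₀ a₁ a₂ : V3) (s n₀ n₁ n₂ r₀ r₁ r₂ : ℕ) → AInfo

-- The columns 4 to 9: in a row stable under `σ`, the columns 6 and 8 carry `θ b` and `θ (θ b)`, and
-- merging identifies each of the three with its partner under `ζ`.
data BInfo : Set where
  mkB : (b : V7) (s n₄ n₆ n₈ r₄ r₆ r₈ : ℕ) → BInfo

data Row : Set where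
  mkR : AInfo → BInfo → Row

data Tri : Set where
  mkT : (r₀ r₁ r₂ : Row) → Tri

aInfo : V3 → V3 → V3 → AInfo
aInfo a₀ a₁ a₂ = mkA a₀ a₁ a₂ (tot (cell a₀) + tot (cell a₁) + 2 * tot (cell a₂))
  (num (cell a₀)) (num (cell a₁)) (num (cell a₂))
  (num (rev (cell a₀))) (num (rev (cell a₁))) (num (rev (cell a₂)))

bInfo : V7 → BInfo
bInfo b = mkB b (tot b) (num b) (num (θ b)) (num (θ (θ b)))
  (num (rev b)) (num (rev (θ b))) (num (rev (θ (θ b))))

-- The inner product of two merged rows over all ten columns; columns exchanged by `ζ` have equal
-- merged entries, hence the factor 2.
ip : Row → Row → ℕ
ip (mkR (mkA _ _ _ _ n₀ n₁ n₂ _ _ _) (mkB _ _ n₄ n₆ n₈ _ _ _))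
   (mkR (mkA _ _ _ _ _ _ _ r₀ r₁ r₂) (mkB _ _ _ _ _ r₄ r₆ r₈)) =
  modM (n₀ * r₀ + n₁ * r₁ + 2 * (n₂ * r₂ + n₄ * r₄ + n₆ * r₆ + n₈ * r₈))

-- The names give the coefficient at 0, the other six coefficients being 32. They are 2 (8 + 8), 2
-- (24 + 8) and 2 (24 + 24): the product of rows i and k unites those of i and `ζ i` with k, so a
-- row has norm 96 when `ζ` fixes it and 64 when `ζ` moves it.
T32 T64 T96 : ℕ
T32 = modM (32 * J)
T64 = modM (32 * J + 32)
T96 = modM (32 * J + 64)

-- The columns 4 to 9 contribute a multiple of 6 to the weight 48; this prunes before they are
-- chosen.
feasible : AInfo → Bool
feasible (mkA _ _ _ s _ _ _ _ _ _) = s % 6 ≡ᵇ 0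

weight48 : AInfo → BInfo → Bool
weight48 (mkA _ _ _ s _ _ _ _ _ _) (mkB _ s′ _ _ _ _ _ _) = s + 6 * s′ ≡ᵇ 48

selfOK : ℕ → Row → Bool
selfOK t r = ip r r ≡ᵇ t

D₀ D₁ : List ℕ
D₀ = 0 ∷ 2 ∷ []
D₁ = 0 ∷ 1 ∷ 2 ∷ []

aInfos : List ℕ → List AInfo
aInfos d = concatMap (λ a₀ → concatMap (λ a₁ → map (aInfo a₀ a₁) (all3 d)) (all3 D₀)) (all3 D₀)

rowsFrom : ℕ → List BInfo → AInfo → List Row
rowsFrom t bs a = filterᵇ (selfOK t) (map (mkR a) (filterᵇ (weight48 a) bs))

rows : ℕ → List ℕ → List BInfo → List Row
rows t d bs = concatMap (rowsFrom t bs) (filterᵇ feasible (aInfos d))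

-- Representatives of the subsets of ℤ/7 (entries doubled) under x ↦ 2ᵉ x + a.
canonical : List V7
canonical =
  v7 0 0 0 0 0 0 0 ∷ v7 0 0 0 0 0 0 2 ∷ v7 0 0 0 0 0 2 2 ∷ v7 0 0 0 0 2 2 2 ∷
  v7 0 0 0 2 0 2 2 ∷ v7 0 0 0 2 2 0 2 ∷ v7 0 0 0 2 2 2 2 ∷ v7 0 0 2 0 2 2 2 ∷
  v7 0 0 2 2 2 0 2 ∷ v7 0 0 2 2 2 2 2 ∷ v7 0 2 2 2 2 2 2 ∷ v7 2 2 2 2 2 2 2 ∷ []

-- The rows 0 and 1 are fixed by `ζ`, so their merged entries are 0 or 2; in row 2 this holds only
-- in the columns 0 and 1. The restriction to `canonical` in row 0 is paid for by the choice of the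
-- base block in the regular orbit.
rows₀ rows₁ rows₂ : List Row
rows₀ = rows T96 D₀ (map bInfo canonical)
rows₁ = rows T96 D₀ (map bInfo (all7 D₀))
rows₂ = rows T64 D₁ (map bInfo (all7 D₁))

orthogonal : Row → Row → Bool
orthogonal r r′ = ip r r′ ≡ᵇ T32

orthogonal₂ : (r₀ r₁ r₂ : Row) → Bool
orthogonal₂ r₀ r₁ r₂ = orthogonal r₀ r₂ ∧ orthogonal r₁ r₂

triplesFrom : List Row → Row → Row → List Tri
triplesFrom l₂ r₀ r₁ = map (mkT r₀ r₁) (filterᵇ (orthogonal₂ r₀ r₁) l₂)

triples : List Row → List Row → List Row → List Tri
triples l₀ l₁ l₂ = concatMap (λ r₀ → concatMap (triplesFrom l₂ r₀) (filterᵇ (orthogonal r₀) l₁)) l₀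

-- Linear systems modulo J for row 4 of the quotient.

-- Repeated squaring; the first argument bounds the number of binary digits of the exponent, and 23
-- digits suffice below J < 2²³.
powJ : ℕ → ℕ → ℕ → ℕ
powJ zero b e = 1
powJ (suc k) b e = modJ ((if e % 2 ≡ᵇ 1 then b else 1) * powJ k (modJ (b * b)) (e / 2))

opaque
  -- Fermat's little theorem; the exponent is J − 2.  Inverses are checked wherever they are used.
  invJ : ℕ → ℕ
  invJ a = powJ 23 a 8108729

neg : ℕ → ℕ
neg x = ν * x

data M3 : Set where
  m3 : (a b c d e f g h i : ℕ) → M3

data M2 : Set where
  m2 : (a b c d : ℕ) → M2

-- The unknowns are the merged entries of row 4 in the columns 4, 6, 8, and each row of the triple
-- gives one equation, its inner product with row 4 being 0 modulo J.
coeffs : Tri → M3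
coeffs (mkT (mkR _ (mkB _ _ _ _ _ a b c)) (mkR _ (mkB _ _ _ _ _ d e f)) (mkR _ (mkB _ _ _ _ _ g h i))) =
  m3 (2 * a) (2 * b) (2 * c) (2 * d) (2 * e) (2 * f) (2 * g) (2 * h) (2 * i)

scale3 : ℕ → M3 → M3
scale3 k (m3 a b c d e f g h i) =
  m3 (modJ (k * a)) (modJ (k * b)) (modJ (k * c)) (modJ (k * d)) (modJ (k * e)) (modJ (k * f)) (modJ (k * g)) (modJ (k * h)) (modJ (k * i))

inv3 : M3 → M3
inv3 (m3 a b c d e f g h i) = scale3 (invJ (modJ (a * c₁ + b * c₄ + c * c₇))) (m3 c₁ c₂ c₃ c₄ c₅ c₆ c₇ c₈ c₉)
  where
  c₁ c₂ c₃ c₄ c₅ c₆ c₇ c₈ c₉ : ℕ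
  c₁ = modJ (e * i + neg (f * h))
  c₄ = modJ (f * g + neg (d * i))
  c₇ = modJ (d * h + neg (e * g))
  c₂ = modJ (c * h + neg (b * i))
  c₅ = modJ (a * i + neg (c * g))
  c₈ = modJ (b * g + neg (a * h))
  c₃ = modJ (b * f + neg (c * e))
  c₆ = modJ (c * d + neg (a * f))
  c₉ = modJ (a * e + neg (b * d))

-- Meant for a 3 × 3 matrix that is singular modulo J: once the unknown in column 4 is guessed, the
-- first two equations are solved for the columns 6 and 8.
inv2 : M3 → M2
inv2 (m3 _ b c _ e f _ _ _) = m2 (modJ (k * f)) (modJ (k * neg c)) (modJ (k * neg e)) (modJ (k * b))
  where k = invJ (modJ (b * f + neg (c * e)))

isInv3 : M3 → M3 → Bool
isInv3 (m3 a b c d e f g h i) (m3 a′ b′ c′ d′ e′ f′ g′ h′ i′) =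
  (modJ (a * a′ + b * d′ + c * g′) ≡ᵇ 1) ∧ (modJ (a * b′ + b * e′ + c * h′) ≡ᵇ 0) ∧ (modJ (a * c′ + b * f′ + c * i′) ≡ᵇ 0) ∧
  (modJ (d * a′ + e * d′ + f * g′) ≡ᵇ 0) ∧ (modJ (d * b′ + e * e′ + f * h′) ≡ᵇ 1) ∧ (modJ (d * c′ + e * f′ + f * i′) ≡ᵇ 0) ∧
  (modJ (g * a′ + h * d′ + i * g′) ≡ᵇ 0) ∧ (modJ (g * b′ + h * e′ + i * h′) ≡ᵇ 0) ∧ (modJ (g * c′ + h * f′ + i * i′) ≡ᵇ 1)

isInv2 : M2 → M3 → Bool
isInv2 (m2 a b c d) (m3 _ a′ b′ _ c′ d′ _ _ _) =
  (modJ (a * a′ + b * c′) ≡ᵇ 1) ∧ (modJ (a * b′ + b * d′) ≡ᵇ 0) ∧ (modJ (c * a′ + d * c′) ≡ᵇ 0) ∧ (modJ (c * b′ + d * d′) ≡ᵇ 1)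

digits : ℕ → V7
digits n = v7 (n % 14) (n₁ % 14) (n₂ % 14) (n₃ % 14) (n₄ % 14) (n₅ % 14) (n₆ % 14)
  where
  n₁ = n / 14
  n₂ = n₁ / 14
  n₃ = n₂ / 14
  n₄ = n₃ / 14
  n₅ = n₄ / 14
  n₆ = n₅ / 14

isTrits : V7 → Bool
isTrits (v7 a b c d e f g) = (a <ᵇ 3) ∧ (b <ᵇ 3) ∧ (c <ᵇ 3) ∧ (d <ᵇ 3) ∧ (e <ᵇ 3) ∧ (f <ᵇ 3) ∧ (g <ᵇ 3)

-- A vector with entries at most 2 has num at most 2 J, so three candidates remain for its residue.
decode : ℕ → List V7
decode r = filterᵇ isTrits (digits r ∷ digits (r + J) ∷ digits (r + 2 * J) ∷ [])

data U3 : Set where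
  u3 : (u₄ u₆ u₈ : V7) → U3

combos : List V7 → List V7 → List V7 → List U3
combos l₄ l₆ l₈ = concatMap (λ x → concatMap (λ y → map (u3 x y) l₈) l₆) l₄

-- In the columns 0, 1, 2, row 4 consists of the reversals of the entries at position 4 of the
-- column triple, hence is known; `ν` moves its contribution to the other side.
rhs : Row → Tri → ℕ
rhs (mkR (mkA _ _ _ _ _ _ _ r₀ r₁ r₂) _)
    (mkT (mkR _ (mkB _ _ _ _ _ c₀ _ _)) (mkR _ (mkB _ _ _ _ _ c₁ _ _)) (mkR _ (mkB _ _ _ _ _ c₂ _ _))) =
  modJ (ν * (r₀ * c₀ + r₁ * c₁ + 2 * (r₂ * c₂)))

solve3 : M3 → ℕ → ℕ → ℕ → List U3
solve3 (m3 a b c d e f g h i) x y z =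
  combos (decode (modJ (a * x + b * y + c * z))) (decode (modJ (d * x + e * y + f * z))) (decode (modJ (g * x + h * y + i * z)))

solve2-from : M2 → V7 → ℕ → ℕ → List U3
solve2-from (m2 p q r s) u x y =
  combos (u ∷ []) (decode (modJ (p * x + q * y))) (decode (modJ (r * x + s * y)))

solve2 : M2 → M3 → ℕ → ℕ → List U3
solve2 w (m3 a _ _ d _ _ _ _ _) x y =
  concatMap (λ u → solve2-from w u (x + neg (a * num u)) (y + neg (d * num u))) (all7 D₁)

ip4 : Row → Tri → U3 → ℕ
ip4 (mkR (mkA _ _ _ _ _ _ _ r₀ r₁ r₂) (mkB _ _ _ _ _ r₄ r₆ r₈))
    (mkT (mkR _ (mkB _ _ _ _ _ c₀ _ _)) (mkR _ (mkB _ _ _ _ _ c₁ _ _)) (mkR _ (mkB _ _ _ _ _ c₂ _ _))) (u3 x y z) =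
  modM (c₀ * r₀ + c₁ * r₁ + 2 * (c₂ * r₂ + num x * r₄ + num y * r₆ + num z * r₈))

_∙_ : V7 → V7 → ℕ
v ∙ w = num v * num (rev w)

-- The second test pairs row 4 with row 6, its image under `σ`: the entries are twisted by `θ` and
-- the columns 4, 6, 8 rotate.
self4 : V7 → V7 → V7 → U3 → Bool
self4 p q r (u3 x y z) =
  (modM (p ∙ p + q ∙ q + 2 * (r ∙ r + x ∙ x + y ∙ y + z ∙ z)) ≡ᵇ T64) ∧
  (modM (p ∙ θ p + q ∙ θ q + 2 * (r ∙ θ r + x ∙ θ z + y ∙ θ x + z ∙ θ y)) ≡ᵇ T32)

row4OK : Tri → Tri → U3 → Bool
row4OK (mkT r₀ r₁ r₂) C@(mkT (mkR _ (mkB b₀ _ _ _ _ _ _ _)) (mkR _ (mkB b₁ _ _ _ _ _ _ _)) (mkR _ (mkB b₂ _ _ _ _ _ _ _))) u =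
  (ip4 r₀ C u ≡ᵇ T32) ∧ (ip4 r₁ C u ≡ᵇ T32) ∧ (ip4 r₂ C u ≡ᵇ T32) ∧ self4 (rev b₀) (rev b₁) (rev b₂) u

enc3 : V3 → ℕ → ℕ
enc3 (v3 a b c) n = a + 4 * (b + 4 * (c + 4 * n))

-- This is `rev` on functions fixed by `θ`: -1 is a non-square modulo 7, so squares and non-squares
-- change places.
neg3 : V3 → V3
neg3 (v3 a b c) = v3 a c b

encode : (a b c d e f g h i : V3) → ℕ
encode a b c d e f g h i = enc3 a (enc3 b (enc3 c (enc3 d (enc3 e (enc3 f (enc3 g (enc3 h (enc3 i 0))))))))

-- A row triple and a column triple belong to one matrix only if they agree on the 3 × 3 corner they
-- share. Packing the corner into one number reduces this to a single comparison.
keyR keyC : Tri → ℕ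
keyR (mkT (mkR (mkA a b c _ _ _ _ _ _ _) _) (mkR (mkA d e f _ _ _ _ _ _ _) _) (mkR (mkA g h i _ _ _ _ _ _ _) _)) =
  encode a b c d e f g h i
keyC (mkT (mkR (mkA a b c _ _ _ _ _ _ _) _) (mkR (mkA d e f _ _ _ _ _ _ _) _) (mkR (mkA g h i _ _ _ _ _ _ _) _)) =
  encode (neg3 a) (neg3 d) (neg3 g) (neg3 b) (neg3 e) (neg3 h) (neg3 c) (neg3 f) (neg3 i)

data Keyed : Set where
  keyed : ℕ → Tri → Keyed

withKey : Tri → Keyed
withKey t = keyed (keyC t) t

solutions : Bool → M3 → M3 → M2 → ℕ → ℕ → ℕ → List U3
solutions true  A V W x y z = solve3 V x y z
solutions false A V W x y z = solve2 W A x y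

Continuation : Set
Continuation = Tri → Tri → U3 → Bool

match : Continuation → Tri → ℕ → (Tri → List U3) → Keyed → Bool
match k R key sol (keyed key′ C) = (key′ ≡ᵇ key) ⟹ all (λ u → row4OK R C u ⟹ k R C u) (sol C)

candidates : Bool → M3 → M3 → M2 → Tri → Tri → List U3
candidates b A V W (mkT r₀ r₁ r₂) C = solutions b A V W (rhs r₀ C) (rhs r₁ C) (rhs r₂ C)

-- When neither inverse is confirmed the check is false, so an incorrect inverse could make the
-- evaluation fail but could not hide a solution.
matchAll : Continuation → List Keyed → Tri → M3 → M3 → M2 → ℕ → Bool → Bool
matchAll k Cs R A V W key b = (b ∨ isInv2 W A) ∧ all (match k R key (candidates b A V W R)) Cs

matchAll′ : Continuation → List Keyed → Tri → M3 → M3 → ℕ → Bool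
matchAll′ k Cs R A V key = matchAll k Cs R A V (inv2 A) key (isInv3 V A)

pairs : Continuation → List Keyed → Tri → Bool
pairs k Cs R = matchAll′ k Cs R (coeffs R) (inv3 (coeffs R)) (keyR R)

-- The two block orbits of length 7 may be interchanged; their weights in row 0 decide the order.
ordered : Tri → Bool
ordered (mkT (mkR (mkA a b _ _ _ _ _ _ _ _) _) _ _) = tot (cell a) ≤ᵇ tot (cell b)

allPairs : Continuation → List Tri → Bool
allPairs k l = all (pairs k (map withKey l)) (filterᵇ ordered l)

-- Lifting the quotient to a matrix of zeros and ones.

-- The possible first summands of a merged entry; only the entry 1 leaves a choice.
bit : ℕ → List ℕ
bit 0 = 0 ∷ []
bit 1 = 0 ∷ 1 ∷ []
bit _ = 1 ∷ []

bits : V7 → List V7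
bits (v7 a b c d e f g) = choices (bit a) (bit b) (bit c) (bit d) (bit e) (bit f) (bit g)

bits3 : V3 → List V3
bits3 (v3 a b c) = concatMap (λ a → concatMap (λ b → map (v3 a b) (bit c)) (bit b)) (bit a)

-- Replacing a base point by its image under the involution exchanges the two summands of the merged
-- entries. Requiring the first summand to be 1 at the first merged entry equal to 1 selects one of
-- the two.
lead : ℕ → ℕ → Bool → Bool
lead m c rest = if m ≡ᵇ 1 then c ≡ᵇ 1 else rest

lead7 : V7 → V7 → Bool
lead7 (v7 a b c d e f g) (v7 a′ b′ c′ d′ e′ f′ g′) =
  lead a a′ (lead b b′ (lead c c′ (lead d d′ (lead e e′ (lead f f′ (lead g g′ true))))))

lead3 : V3 → V3 → Bool
lead3 (v3 a b c) (v3 a′ b′ c′) = lead a a′ (lead b b′ (lead c c′ true))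

-- Four times the norm is tested, so that the doubled entries in the columns 0 and 1 enter without
-- being halved.
row2OK : Row → V7 → V7 → Bool
row2OK (mkR (mkA _ _ a₂ _ n₀ n₁ _ r₀ r₁ _) (mkB b _ _ _ _ _ _ _)) c₂ c₄ =
  modM (n₀ * r₀ + n₁ * r₁ + 4 * (c₂ ∙ c₂ + c₃ ∙ c₃ + (c₄ ∙ c₄ + θ c₄ ∙ θ c₄ + θ (θ c₄) ∙ θ (θ c₄)) + (c₅ ∙ c₅ + θ c₅ ∙ θ c₅ + θ (θ c₅) ∙ θ (θ c₅)))) ≡ᵇ T96
  where
  c₃ = cell a₂ ⊖ c₂
  c₅ = b ⊖ c₄

-- Reversed values of row 2. In the equation between rows 4 and 2 the entry in column 8 has the
-- coefficient 4 (r₈ - r₉), whose inverse modulo J is κ.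
data Coeffs : Set where
  mkC : (r₂ r₃ r₄ r₅ r₆ r₇ r₈ r₉ κ : ℕ) → Coeffs

row2Coeffs : Row → V7 → V7 → Coeffs
row2Coeffs (mkR (mkA _ _ a₂ _ _ _ _ _ _ _) (mkB b _ _ _ _ _ _ _)) c₂ c₄ =
  mkC (num (rev c₂)) (num (rev (cell a₂ ⊖ c₂))) (num (rev c₄)) (num (rev c₅)) (num (rev (θ c₄))) (num (rev (θ c₅)))
      r₈ r₉ (invJ (modJ (4 * (r₈ + ν * r₉))))
  where
  c₅ = b ⊖ c₄
  r₈ = num (rev (θ (θ c₄)))
  r₉ = num (rev (θ (θ c₅)))

data Tagged : Set where
  _▹_ : V7 → ℕ → Tagged

-- The share of a pair of `ζ`-partner columns in four times the product with row 2, kept beside the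
-- candidate: combining candidates of two such pairs then costs one addition.
term : ℕ → ℕ → V7 → V7 → Tagged
term r r′ m c = c ▹ modJ (4 * (num c * r + num (m ⊖ c) * r′))

residue : V7 → Tagged
residue z = z ▹ modJ (num z)

row4Lift : Tri → V7 → U3 → V7 → V7 → V7 → Bool
row4Lift (mkT (mkR _ (mkB b₀ _ _ _ _ _ _ _)) (mkR _ (mkB b₁ _ _ _ _ _ _ _)) (mkR _ (mkB b₂ _ _ _ _ _ _ _))) e (u3 ux uy uz) x y z =
  (modM (rev b₀ ∙ rev b₀ + rev b₁ ∙ rev b₁ + 4 * (c₂ ∙ c₂ + c₃ ∙ c₃ + (x ∙ x + y ∙ y + z ∙ z) + (x′ ∙ x′ + y′ ∙ y′ + z′ ∙ z′))) ≡ᵇ T96) ∧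
  (modM (rev b₀ ∙ θ (rev b₀) + rev b₁ ∙ θ (rev b₁) + 4 * (c₂ ∙ θ c₂ + c₃ ∙ θ c₃ + (x ∙ θ z + y ∙ θ x + z ∙ θ y) + (x′ ∙ θ z′ + y′ ∙ θ x′ + z′ ∙ θ y′))) ≡ᵇ T32)
  where
  c₂ = rev e
  c₃ = rev (b₂ ⊖ e)
  x′ = ux ⊖ x
  y′ = uy ⊖ y
  z′ = uz ⊖ z

Leaf : Set
Leaf = Tri → Tri → U3 → (c₂₂ c₂₄ e x y z : V7) → Bool

pick : (V7 → Bool) → ℕ → Tagged → Bool
pick leaf r (z ▹ n) = (n ≡ᵇ r) ⟹ leaf z

-- The wanted entry consists of zeros and ones, so the lowest digit of its residue in base 14 is 0
-- or 1; this cheap test precedes the comparison with all candidates.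
pickAll : (V7 → Bool) → List Tagged → ℕ → Bool
pickAll leaf zs r = (r % 14 <ᵇ 2) ⟹ all (pick leaf r) zs

combineTerms : (V7 → V7 → V7 → Bool) → ℕ → ℕ → List Tagged → Tagged → Tagged → Bool
combineTerms leaf κ base zs (x ▹ m) (y ▹ n) = pickAll (leaf x y) zs (modJ (κ * (base + (m + n))))

constant : Row → Tri → V7 → Coeffs → U3 → ℕ
constant (mkR (mkA _ _ _ _ _ _ _ r₀ r₁ _) _)
         (mkT (mkR _ (mkB _ _ _ _ _ c₀ _ _)) (mkR _ (mkB _ _ _ _ _ c₁ _ _)) (mkR _ (mkB b₂ _ _ _ _ _ _ _))) e (mkC r₂ r₃ _ _ _ _ _ r₉ _) (u3 _ _ uz) =
  modJ (c₀ * r₀ + c₁ * r₁ + 4 * (num (rev e) * r₂ + num (rev (b₂ ⊖ e)) * r₃ + num uz * r₉))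

liftRow4 : (V7 → V7 → V7 → V7 → Bool) → Row → Tri → U3 → ℕ → Coeffs → (xs ys zs : List Tagged) → V7 → Bool
liftRow4 leaf R₂ C u κ k xs ys zs e = go (constant R₂ C e k u)
  where
  go : ℕ → Bool
  go base = all (λ x → all (combineTerms (λ x y z → row4Lift C e u x y z ⟹ leaf e x y z) κ base zs x) ys) xs

liftRow2 : (V7 → V7 → V7 → V7 → Bool) → Row → Tri → U3 → List V7 → List Tagged → Coeffs → Bool
liftRow2 leaf R₂ C u@(u3 ux uy _) es zs k@(mkC _ _ r₄ r₅ r₆ r₇ r₈ r₉ κ) =
  (modJ (κ * (4 * (r₈ + ν * r₉))) ≡ᵇ 1) ∧
  all (liftRow4 leaf R₂ C u (modJ (ν * κ)) k (map (term r₄ r₅ ux) (bits ux)) (map (term r₆ r₇ uy) (bits uy)) zs) es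

row2Lifts : Row → V7 → List V7
row2Lifts R@(mkR _ (mkB b _ _ _ _ _ _ _)) c = filterᵇ (row2OK R c) (filterᵇ (lead7 b) (bits b))

lift22 : Leaf → Tri → Tri → U3 → List Tagged → V7 → Bool
lift22 leaf R@(mkT _ _ R₂) C@(mkT _ _ C₂) u zs c = go (row2Lifts C₂ (rev c))
  where
  go : List V7 → Bool
  go es = all (λ c₄ → liftRow2 (leaf R C u c c₄) R₂ C u es zs (row2Coeffs R₂ c c₄)) (row2Lifts R₂ c)

lift : Leaf → Continuation
lift leaf R@(mkT _ _ (mkR (mkA _ _ a₂ _ _ _ _ _ _ _) _)) C u@(u3 _ _ uz) =
  all (λ a → lift22 leaf R C u (map residue (bits uz)) (cell a)) (filterᵇ (lead3 a₂) (bits3 a₂))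

-- Explicit matrices and certificates.

infixl 9 _!_

data X10 (A : Set) : Set where
  x10 : (a b c d e f g h i j : A) → X10 A

_!_ : ∀ {A} → X10 A → Fin 10 → A
x10 a b c d e f g h i j ! 0F = a
x10 a b c d e f g h i j ! 1F = b
x10 a b c d e f g h i j ! 2F = c
x10 a b c d e f g h i j ! 3F = d
x10 a b c d e f g h i j ! 4F = e
x10 a b c d e f g h i j ! 5F = f
x10 a b c d e f g h i j ! 6F = g
x10 a b c d e f g h i j ! 7F = h
x10 a b c d e f g h i j ! 8F = i
x10 a b c d e f g h i j ! 9F = j

map10 : ∀ {A A′ : Set} → (A → A′) → X10 A → X10 A′
map10 k (x10 a b c d e f g h i j) = x10 (k a) (k b) (k c) (k d) (k e) (k f) (k g) (k h) (k i) (k j)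

Mat : Set
Mat = X10 (X10 V7)

digit : V7 → ℕ → ℕ
digit (v7 a b c d e f g) 0 = a
digit (v7 a b c d e f g) 1 = b
digit (v7 a b c d e f g) 2 = c
digit (v7 a b c d e f g) 3 = d
digit (v7 a b c d e f g) 4 = e
digit (v7 a b c d e f g) 5 = f
digit (v7 a b c d e f g) _ = g

at : V7 → ℕ → ℕ
at v n = digit v (n % 7)

ζrow σrow : X10 V7 → X10 V7
ζrow (x10 a b c d e f g h i j) = x10 a b d c f e h g j i
σrow (x10 a b c d e f g h i j) = map10 θ (x10 a b c d i j e f g h)

halve : V7 → V7
halve (v7 a b c d e f g) = v7 (a / 2) (b / 2) (c / 2) (d / 2) (e / 2) (f / 2) (g / 2)

row01 : Row → X10 V7
row01 (mkR (mkA a₀ a₁ a₂ _ _ _ _ _ _ _) (mkB b _ _ _ _ _ _ _)) = go (halve (cell a₂)) (halve b)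
  where
  go : V7 → V7 → X10 V7
  go c d = x10 (halve (cell a₀)) (halve (cell a₁)) c c d d (θ d) (θ d) (θ (θ d)) (θ (θ d))

-- The classes 0, 1, 2, 4 represent the orbits of `σ` and `ζ` on the ten classes, so the remaining
-- rows are images of these four.
fill : (r₀ r₁ r₂ r₄ : X10 V7) → Mat
fill r₀ r₁ r₂ r₄ = x10 r₀ r₁ r₂ (ζrow r₂) r₄ (ζrow r₄) (σrow r₄) (ζrow (σrow r₄)) (σrow (σrow r₄)) (ζrow (σrow (σrow r₄)))

build : Tri → Tri → U3 → (c₂₂ c₂₄ e x y z : V7) → Mat
build (mkT R₀ R₁ (mkR (mkA a₀ a₁ a₂ _ _ _ _ _ _ _) (mkB b _ _ _ _ _ _ _)))
      (mkT (mkR _ (mkB b₀ _ _ _ _ _ _ _)) (mkR _ (mkB b₁ _ _ _ _ _ _ _)) (mkR _ (mkB b₂ _ _ _ _ _ _ _))) (u3 ux uy uz) c₂₂ c₂₄ e x y z =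
  fill (row01 R₀) (row01 R₁)
     (x10 (halve (cell a₀)) (halve (cell a₁)) c₂₂ (cell a₂ ⊖ c₂₂) c₂₄ d (θ c₂₄) (θ d) (θ (θ c₂₄)) (θ (θ d)))
     (x10 (halve (rev b₀)) (halve (rev b₁)) (rev e) (rev (b₂ ⊖ e)) x (ux ⊖ x) y (uy ⊖ y) z (uz ⊖ z))
  where
  d = b ⊖ c₂₄

-- An isomorphism onto table k, or onto its transpose, given by (i, x) ↦ (π i, u x + o i) on points
-- and by π′, o′ with the same multiplier on blocks.
data Cert : Set where
  cert : (k : ℕ) (dual : Bool) (u : ℕ) (π o π′ o′ : X10 ℕ) → Cert

transp : (Fin 10 → Fin 10 → V7) → Fin 10 → Fin 10 → V7
transp c i j = rev (c j i)

unmask : ℕ → V7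
unmask n = v7 (n % 2) ((n / 2) % 2) ((n / 4) % 2) ((n / 8) % 2) ((n / 16) % 2) ((n / 32) % 2) ((n / 64) % 2)

-- Each number is a subset of ℤ/7 written in binary, the lowest bit standing for 0. The first two
-- tables are the self-dual designs.
matrices : List (X10 (X10 ℕ))
matrices =
  x10 (x10 0 105 23 23 96 96 40 40 72 72)
      (x10 105 0 23 23 10 10 68 68 48 48)
      (x10 23 23 105 0 34 72 12 96 80 40)
      (x10 23 23 0 105 72 34 96 12 40 80)
      (x10 6 80 68 18 68 126 33 66 48 6)
      (x10 6 80 18 68 126 68 66 33 6 48)
      (x10 20 34 48 6 10 20 48 126 9 36)
      (x10 20 34 6 48 20 10 126 48 36 9)
      (x10 18 12 10 20 65 24 68 18 10 126)
      (x10 18 12 20 10 24 65 18 68 126 10) ∷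
  x10 (x10 0 105 23 23 96 96 40 40 72 72)
      (x10 105 0 23 23 10 10 68 68 48 48)
      (x10 23 23 1 104 74 32 100 8 56 64)
      (x10 23 23 104 1 32 74 8 100 64 56)
      (x10 6 80 84 2 100 94 97 2 50 4)
      (x10 6 80 2 84 94 100 2 97 4 50)
      (x10 20 34 50 4 14 16 56 118 41 4)
      (x10 20 34 4 50 16 14 118 56 4 41)
      (x10 18 12 14 16 73 16 84 2 74 62)
      (x10 18 12 16 14 16 73 2 84 62 74) ∷
  x10 (x10 0 105 1 1 112 112 42 42 76 76)
      (x10 23 0 1 1 38 38 28 28 82 82)
      (x10 105 105 105 0 6 72 20 96 18 40)
      (x10 105 105 0 105 72 6 96 20 40 18)
      (x10 6 80 41 100 2 64 109 64 104 7)
      (x10 6 80 100 41 64 2 64 109 7 104)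
      (x10 20 34 73 56 104 21 4 32 121 32)
      (x10 20 34 56 73 21 104 32 4 32 121)
      (x10 18 12 97 74 107 8 104 19 16 8)
      (x10 18 12 74 97 8 107 19 104 8 16) ∷
  x10 (x10 0 105 1 1 112 112 42 42 76 76)
      (x10 23 0 1 1 38 38 28 28 82 82)
      (x10 105 105 105 0 10 68 68 48 48 10)
      (x10 105 105 0 105 68 10 48 68 10 48)
      (x10 6 80 41 100 64 2 104 69 32 79)
      (x10 6 80 100 41 2 64 69 104 79 32)
      (x10 20 34 73 56 8 117 32 4 104 49)
      (x10 20 34 56 73 117 8 4 32 49 104)
      (x10 18 12 97 74 104 11 64 59 8 16)
      (x10 18 12 74 97 11 104 59 64 16 8) ∷
  x10 (x10 0 105 1 1 112 112 42 42 76 76)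
      (x10 23 0 1 1 38 38 28 28 82 82)
      (x10 105 105 1 104 14 64 84 32 50 8)
      (x10 105 105 104 1 64 14 32 84 8 50)
      (x10 6 80 105 36 0 66 77 96 78 33)
      (x10 6 80 36 105 66 0 96 77 33 78)
      (x10 20 34 105 24 116 9 0 36 113 40)
      (x10 20 34 24 105 9 116 36 0 40 113)
      (x10 18 12 105 66 43 72 58 65 0 24)
      (x10 18 12 66 105 72 43 65 58 24 0) ∷
  x10 (x10 0 105 1 1 112 112 42 42 76 76)
      (x10 23 0 1 1 38 38 28 28 82 82)
      (x10 105 105 1 104 70 8 52 64 26 32)
      (x10 105 105 104 1 8 70 64 52 32 26)
      (x10 6 80 45 96 66 0 65 108 39 72)
      (x10 6 80 96 45 0 66 108 65 72 39)
      (x10 20 34 89 40 29 96 36 0 33 120)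
      (x10 20 34 40 89 96 29 0 36 120 33)
      (x10 18 12 99 72 9 106 83 40 24 0)
      (x10 18 12 72 99 106 9 40 83 0 24) ∷
  x10 (x10 0 105 1 1 112 112 42 42 76 76)
      (x10 23 0 1 1 38 38 28 28 82 82)
      (x10 105 105 1 104 2 76 4 112 16 42)
      (x10 105 105 104 1 76 2 112 4 42 16)
      (x10 6 80 105 36 66 0 72 101 6 105)
      (x10 6 80 36 105 0 66 101 72 105 6)
      (x10 20 34 105 24 20 105 36 0 96 57)
      (x10 20 34 24 105 105 20 0 36 57 96)
      (x10 18 12 105 66 40 75 18 105 24 0)
      (x10 18 12 66 105 75 40 105 18 0 24) ∷
  x10 (x10 0 105 1 1 112 112 42 42 76 76)
      (x10 23 0 1 1 38 38 28 28 82 82)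
      (x10 23 23 1 22 49 8 11 64 69 32)
      (x10 23 23 22 1 8 49 64 11 32 69)
      (x10 6 80 45 96 66 0 65 108 39 72)
      (x10 6 80 96 45 0 66 108 65 72 39)
      (x10 20 34 89 40 29 96 36 0 33 120)
      (x10 20 34 40 89 96 29 0 36 120 33)
      (x10 18 12 99 72 9 106 83 40 24 0)
      (x10 18 12 72 99 106 9 40 83 0 24) ∷
  x10 (x10 0 105 105 105 96 96 40 40 72 72)
      (x10 105 0 23 23 80 80 34 34 12 12)
      (x10 23 105 23 0 9 48 65 10 33 68)
      (x10 23 105 0 23 48 9 10 65 68 33)
      (x10 6 10 66 48 108 85 0 101 34 12)
      (x10 6 10 48 66 85 108 101 0 12 34)
      (x10 20 68 36 10 12 80 120 51 0 57)
      (x10 20 68 10 36 80 12 51 120 57 0)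
      (x10 18 48 24 68 0 75 80 34 106 15)
      (x10 18 48 68 24 75 0 34 80 15 106) ∷
  []

certs : List Cert
certs =
  cert 2 false 1 (x10 0 1 2 3 4 5 6 7 8 9) (x10 0 0 0 0 0 0 0 0 0 0) (x10 0 1 2 3 4 5 6 7 8 9) (x10 0 0 0 0 0 0 0 0 0 0) ∷
  cert 3 false 1 (x10 0 1 2 3 4 5 6 7 8 9) (x10 0 0 0 0 0 0 0 0 0 0) (x10 0 1 2 3 4 5 6 7 8 9) (x10 0 0 0 0 0 0 0 0 0 0) ∷
  cert 4 false 1 (x10 0 1 2 3 4 5 6 7 8 9) (x10 0 0 0 0 0 0 0 0 0 0) (x10 0 1 2 3 4 5 6 7 8 9) (x10 0 0 0 0 0 0 0 0 0 0) ∷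
  cert 5 false 1 (x10 0 1 2 3 4 5 6 7 8 9) (x10 0 0 0 0 0 0 0 0 0 0) (x10 0 1 2 3 4 5 6 7 8 9) (x10 0 0 0 0 0 0 0 0 0 0) ∷
  cert 6 false 1 (x10 0 1 2 3 4 5 6 7 8 9) (x10 0 0 0 0 0 0 0 0 0 0) (x10 0 1 2 3 4 5 6 7 8 9) (x10 0 0 0 0 0 0 0 0 0 0) ∷
  cert 7 false 1 (x10 0 1 2 3 4 5 6 7 8 9) (x10 0 0 0 0 0 0 0 0 0 0) (x10 0 1 2 3 4 5 6 7 8 9) (x10 0 0 0 0 0 0 0 0 0 0) ∷
  cert 7 false 5 (x10 1 0 2 3 4 5 6 7 8 9) (x10 1 1 1 1 0 0 6 6 4 4) (x10 1 0 2 3 8 9 4 5 6 7) (x10 1 1 1 1 3 3 5 5 2 2) ∷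
  cert 2 false 5 (x10 1 0 2 3 4 5 6 7 8 9) (x10 1 1 1 1 0 0 6 6 4 4) (x10 1 0 2 3 9 8 5 4 7 6) (x10 1 1 1 1 3 3 5 5 2 2) ∷
  cert 3 false 5 (x10 1 0 2 3 4 5 6 7 8 9) (x10 1 1 1 1 0 0 6 6 4 4) (x10 1 0 2 3 8 9 4 5 6 7) (x10 1 1 1 1 3 3 5 5 2 2) ∷
  cert 6 false 5 (x10 1 0 2 3 4 5 6 7 8 9) (x10 1 1 1 1 0 0 6 6 4 4) (x10 1 0 2 3 9 8 5 4 7 6) (x10 1 1 1 1 3 3 5 5 2 2) ∷
  cert 4 false 5 (x10 1 0 2 3 4 5 6 7 8 9) (x10 1 1 1 1 0 0 6 6 4 4) (x10 1 0 2 3 8 9 4 5 6 7) (x10 1 1 1 1 3 3 5 5 2 2) ∷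
  cert 5 false 5 (x10 1 0 2 3 4 5 6 7 8 9) (x10 1 1 1 1 0 0 6 6 4 4) (x10 1 0 2 3 9 8 5 4 7 6) (x10 1 1 1 1 3 3 5 5 2 2) ∷
  cert 8 false 1 (x10 0 1 2 3 4 5 6 7 8 9) (x10 0 0 0 0 0 0 0 0 0 0) (x10 0 1 2 3 4 5 6 7 8 9) (x10 0 0 0 0 0 0 0 0 0 0) ∷
  cert 8 true 5 (x10 1 0 2 3 4 5 6 7 8 9) (x10 5 5 5 5 0 0 2 2 6 6) (x10 1 0 2 3 5 4 7 6 9 8) (x10 5 5 5 5 0 0 2 2 6 6) ∷
  cert 7 true 1 (x10 0 1 2 3 4 5 6 7 8 9) (x10 0 0 0 0 0 0 0 0 0 0) (x10 0 1 2 3 4 5 6 7 8 9) (x10 0 0 0 0 0 0 0 0 0 0) ∷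
  cert 2 true 3 (x10 1 0 3 2 4 5 6 7 8 9) (x10 3 3 3 3 0 0 4 4 5 5) (x10 1 0 3 2 7 6 9 8 5 4) (x10 3 3 3 3 1 1 6 6 2 2) ∷
  cert 3 true 3 (x10 1 0 2 3 4 5 6 7 8 9) (x10 3 3 3 3 0 0 4 4 5 5) (x10 1 0 2 3 6 7 8 9 4 5) (x10 3 3 3 3 1 1 6 6 2 2) ∷
  cert 5 true 3 (x10 1 0 3 2 4 5 6 7 8 9) (x10 3 3 3 3 0 0 4 4 5 5) (x10 1 0 3 2 7 6 9 8 5 4) (x10 3 3 3 3 1 1 6 6 2 2) ∷
  cert 6 true 3 (x10 1 0 3 2 4 5 6 7 8 9) (x10 3 3 3 3 0 0 4 4 5 5) (x10 1 0 3 2 7 6 9 8 5 4) (x10 3 3 3 3 1 1 6 6 2 2) ∷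
  cert 4 true 3 (x10 1 0 2 3 4 5 6 7 8 9) (x10 3 3 3 3 0 0 4 4 5 5) (x10 1 0 2 3 6 7 8 9 4 5) (x10 3 3 3 3 1 1 6 6 2 2) ∷
  cert 8 false 2 (x10 1 0 2 3 4 5 6 7 8 9) (x10 6 6 6 6 0 0 1 1 3 3) (x10 1 0 2 3 4 5 6 7 8 9) (x10 6 6 6 6 0 0 1 1 3 3) ∷
  cert 8 true 6 (x10 0 1 3 2 4 5 6 7 8 9) (x10 3 3 3 3 0 0 4 4 5 5) (x10 0 1 3 2 4 5 6 7 8 9) (x10 3 3 3 3 0 0 4 4 5 5) ∷
  cert 0 false 1 (x10 0 1 2 3 4 5 6 7 8 9) (x10 0 0 0 0 0 0 0 0 0 0) (x10 0 1 2 3 4 5 6 7 8 9) (x10 0 0 0 0 0 0 0 0 0 0) ∷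
  cert 1 false 1 (x10 0 1 2 3 4 5 6 7 8 9) (x10 0 0 0 0 0 0 0 0 0 0) (x10 0 1 2 3 4 5 6 7 8 9) (x10 0 0 0 0 0 0 0 0 0 0) ∷
  cert 0 false 2 (x10 1 0 2 3 4 5 6 7 8 9) (x10 2 2 2 2 0 0 5 5 1 1) (x10 1 0 2 3 4 5 6 7 8 9) (x10 2 2 2 2 0 0 5 5 1 1) ∷
  cert 1 false 2 (x10 1 0 2 3 4 5 6 7 8 9) (x10 2 2 2 2 0 0 5 5 1 1) (x10 1 0 2 3 5 4 7 6 9 8) (x10 2 2 2 2 0 0 5 5 1 1) ∷
  cert 2 true 1 (x10 0 1 2 3 4 5 6 7 8 9) (x10 0 0 0 0 0 0 0 0 0 0) (x10 0 1 2 3 4 5 6 7 8 9) (x10 0 0 0 0 0 0 0 0 0 0) ∷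
  cert 3 true 1 (x10 0 1 2 3 4 5 6 7 8 9) (x10 0 0 0 0 0 0 0 0 0 0) (x10 0 1 2 3 4 5 6 7 8 9) (x10 0 0 0 0 0 0 0 0 0 0) ∷
  cert 4 true 1 (x10 0 1 2 3 4 5 6 7 8 9) (x10 0 0 0 0 0 0 0 0 0 0) (x10 0 1 2 3 4 5 6 7 8 9) (x10 0 0 0 0 0 0 0 0 0 0) ∷
  cert 6 true 1 (x10 0 1 2 3 4 5 6 7 8 9) (x10 0 0 0 0 0 0 0 0 0 0) (x10 0 1 2 3 4 5 6 7 8 9) (x10 0 0 0 0 0 0 0 0 0 0) ∷
  cert 5 true 1 (x10 0 1 2 3 4 5 6 7 8 9) (x10 0 0 0 0 0 0 0 0 0 0) (x10 0 1 2 3 4 5 6 7 8 9) (x10 0 0 0 0 0 0 0 0 0 0) ∷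
  cert 7 true 3 (x10 1 0 2 3 4 5 6 7 8 9) (x10 3 3 3 3 0 0 4 4 5 5) (x10 1 0 2 3 6 7 8 9 4 5) (x10 3 3 3 3 1 1 6 6 2 2) ∷
  cert 7 false 6 (x10 0 1 2 3 4 5 6 7 8 9) (x10 3 3 3 3 0 0 4 4 5 5) (x10 0 1 2 3 5 4 7 6 9 8) (x10 3 3 3 3 6 6 2 2 1 1) ∷
  cert 3 false 6 (x10 0 1 2 3 4 5 6 7 8 9) (x10 3 3 3 3 0 0 4 4 5 5) (x10 0 1 2 3 4 5 6 7 8 9) (x10 3 3 3 3 6 6 2 2 1 1) ∷
  cert 2 false 6 (x10 0 1 2 3 4 5 6 7 8 9) (x10 3 3 3 3 0 0 4 4 5 5) (x10 0 1 2 3 5 4 7 6 9 8) (x10 3 3 3 3 6 6 2 2 1 1) ∷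
  cert 4 false 6 (x10 0 1 2 3 4 5 6 7 8 9) (x10 3 3 3 3 0 0 4 4 5 5) (x10 0 1 2 3 4 5 6 7 8 9) (x10 3 3 3 3 6 6 2 2 1 1) ∷
  cert 6 false 6 (x10 0 1 2 3 4 5 6 7 8 9) (x10 3 3 3 3 0 0 4 4 5 5) (x10 0 1 2 3 5 4 7 6 9 8) (x10 3 3 3 3 6 6 2 2 1 1) ∷
  cert 5 false 6 (x10 0 1 2 3 4 5 6 7 8 9) (x10 3 3 3 3 0 0 4 4 5 5) (x10 0 1 2 3 5 4 7 6 9 8) (x10 3 3 3 3 6 6 2 2 1 1) ∷
  cert 2 false 2 (x10 1 0 3 2 4 5 6 7 8 9) (x10 2 2 2 2 0 0 5 5 1 1) (x10 1 0 3 2 8 9 4 5 6 7) (x10 2 2 2 2 5 5 1 1 0 0) ∷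
  cert 3 false 2 (x10 1 0 3 2 4 5 6 7 8 9) (x10 2 2 2 2 0 0 5 5 1 1) (x10 1 0 3 2 8 9 4 5 6 7) (x10 2 2 2 2 5 5 1 1 0 0) ∷
  cert 6 false 2 (x10 1 0 3 2 4 5 6 7 8 9) (x10 2 2 2 2 0 0 5 5 1 1) (x10 1 0 3 2 8 9 4 5 6 7) (x10 2 2 2 2 5 5 1 1 0 0) ∷
  cert 5 false 2 (x10 1 0 2 3 4 5 6 7 8 9) (x10 2 2 2 2 0 0 5 5 1 1) (x10 1 0 2 3 8 9 4 5 6 7) (x10 2 2 2 2 5 5 1 1 0 0) ∷
  cert 4 false 2 (x10 1 0 3 2 4 5 6 7 8 9) (x10 2 2 2 2 0 0 5 5 1 1) (x10 1 0 3 2 8 9 4 5 6 7) (x10 2 2 2 2 5 5 1 1 0 0) ∷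
  cert 7 false 2 (x10 1 0 2 3 4 5 6 7 8 9) (x10 2 2 2 2 0 0 5 5 1 1) (x10 1 0 2 3 9 8 5 4 7 6) (x10 2 2 2 2 5 5 1 1 0 0) ∷
  cert 3 true 6 (x10 0 1 2 3 4 5 6 7 8 9) (x10 4 4 4 4 0 0 3 3 2 2) (x10 0 1 2 3 4 5 6 7 8 9) (x10 4 4 4 4 1 1 5 5 6 6) ∷
  cert 2 true 6 (x10 0 1 3 2 4 5 6 7 8 9) (x10 4 4 4 4 0 0 3 3 2 2) (x10 0 1 3 2 5 4 7 6 9 8) (x10 4 4 4 4 1 1 5 5 6 6) ∷
  cert 4 true 6 (x10 0 1 2 3 4 5 6 7 8 9) (x10 4 4 4 4 0 0 3 3 2 2) (x10 0 1 2 3 4 5 6 7 8 9) (x10 4 4 4 4 1 1 5 5 6 6) ∷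
  cert 6 true 6 (x10 0 1 3 2 4 5 6 7 8 9) (x10 4 4 4 4 0 0 3 3 2 2) (x10 0 1 3 2 5 4 7 6 9 8) (x10 4 4 4 4 1 1 5 5 6 6) ∷
  cert 5 true 6 (x10 0 1 3 2 4 5 6 7 8 9) (x10 4 4 4 4 0 0 3 3 2 2) (x10 0 1 3 2 5 4 7 6 9 8) (x10 4 4 4 4 1 1 5 5 6 6) ∷
  cert 7 true 4 (x10 1 0 3 2 4 5 6 7 8 9) (x10 1 1 1 1 0 0 6 6 4 4) (x10 1 0 3 2 7 6 9 8 5 4) (x10 1 1 1 1 4 4 0 0 6 6) ∷
  cert 0 false 6 (x10 0 1 3 2 4 5 6 7 8 9) (x10 3 3 3 3 0 0 4 4 5 5) (x10 0 1 3 2 4 5 6 7 8 9) (x10 3 3 3 3 0 0 4 4 5 5) ∷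
  cert 1 false 6 (x10 0 1 2 3 4 5 6 7 8 9) (x10 3 3 3 3 0 0 4 4 5 5) (x10 0 1 2 3 4 5 6 7 8 9) (x10 3 3 3 3 0 0 4 4 5 5) ∷
  cert 0 false 5 (x10 1 0 3 2 4 5 6 7 8 9) (x10 1 1 1 1 0 0 6 6 4 4) (x10 1 0 3 2 4 5 6 7 8 9) (x10 1 1 1 1 0 0 6 6 4 4) ∷
  cert 1 false 5 (x10 1 0 3 2 4 5 6 7 8 9) (x10 1 1 1 1 0 0 6 6 4 4) (x10 1 0 3 2 5 4 7 6 9 8) (x10 1 1 1 1 0 0 6 6 4 4) ∷
  cert 8 true 1 (x10 0 1 2 3 4 5 6 7 8 9) (x10 0 0 0 0 0 0 0 0 0 0) (x10 0 1 2 3 4 5 6 7 8 9) (x10 0 0 0 0 0 0 0 0 0 0) ∷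
  cert 8 false 5 (x10 1 0 3 2 4 5 6 7 8 9) (x10 5 5 5 5 0 0 2 2 6 6) (x10 1 0 3 2 5 4 7 6 9 8) (x10 5 5 5 5 0 0 2 2 6 6) ∷
  cert 7 true 6 (x10 0 1 3 2 4 5 6 7 8 9) (x10 4 4 4 4 0 0 3 3 2 2) (x10 0 1 3 2 5 4 7 6 9 8) (x10 4 4 4 4 1 1 5 5 6 6) ∷
  cert 2 true 4 (x10 1 0 3 2 4 5 6 7 8 9) (x10 1 1 1 1 0 0 6 6 4 4) (x10 1 0 3 2 6 7 8 9 4 5) (x10 1 1 1 1 4 4 0 0 6 6) ∷
  cert 3 true 4 (x10 1 0 3 2 4 5 6 7 8 9) (x10 1 1 1 1 0 0 6 6 4 4) (x10 1 0 3 2 6 7 8 9 4 5) (x10 1 1 1 1 4 4 0 0 6 6) ∷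
  cert 5 true 4 (x10 1 0 2 3 4 5 6 7 8 9) (x10 1 1 1 1 0 0 6 6 4 4) (x10 1 0 2 3 6 7 8 9 4 5) (x10 1 1 1 1 4 4 0 0 6 6) ∷
  cert 6 true 4 (x10 1 0 3 2 4 5 6 7 8 9) (x10 1 1 1 1 0 0 6 6 4 4) (x10 1 0 3 2 6 7 8 9 4 5) (x10 1 1 1 1 4 4 0 0 6 6) ∷
  cert 4 true 4 (x10 1 0 3 2 4 5 6 7 8 9) (x10 1 1 1 1 0 0 6 6 4 4) (x10 1 0 3 2 6 7 8 9 4 5) (x10 1 1 1 1 4 4 0 0 6 6) ∷
  cert 8 true 2 (x10 1 0 2 3 4 5 6 7 8 9) (x10 6 6 6 6 0 0 1 1 3 3) (x10 1 0 2 3 4 5 6 7 8 9) (x10 6 6 6 6 0 0 1 1 3 3) ∷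
  cert 8 false 6 (x10 0 1 3 2 4 5 6 7 8 9) (x10 3 3 3 3 0 0 4 4 5 5) (x10 0 1 3 2 4 5 6 7 8 9) (x10 3 3 3 3 0 0 4 4 5 5) ∷
  []

nth : ∀ {A : Set} → A → List A → ℕ → A
nth d []       _       = d
nth d (x ∷ xs) zero    = x
nth d (x ∷ xs) (suc n) = nth d xs n

replicate10 : ∀ {A : Set} → A → X10 A
replicate10 a = x10 a a a a a a a a a a

table : ℕ → Fin 10 → Fin 10 → V7
table k i j = unmask (nth (replicate10 (replicate10 0)) matrices k ! i ! j)

variant : Bool → ℕ → Fin 10 → Fin 10 → V7
variant false k = table k
variant true  k = transp (table k)

affine-at : ℕ → V7 → V7 → ℕ → Bool
affine-at u v w o = all (λ x → at v (u * x + o) ≡ᵇ at w x) (0 ∷ 1 ∷ 2 ∷ 3 ∷ 4 ∷ 5 ∷ 6 ∷ [])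

index : ℕ → Fin 10
index n = n mod 10

affine : Cert → (Fin 10 → Fin 10 → V7) → Mat → Bool
affine (cert _ _ u π o π′ o′) c L =
  -- An entry depends on the difference of the block and point coordinates, so the offset is o′ - o;
  -- 6 stands for -1.
  all (λ i → all (λ j → affine-at u (c (index (π ! i)) (index (π′ ! j))) (L ! i ! j) (o′ ! j + 6 * (o ! i))) (allFin 10)) (allFin 10)

matches : Mat → Cert → Bool
matches L c@(cert k dual _ _ _ _ _) = affine c (variant dual k) L

known : Mat → Bool
known L = any (matches L) certs

leafOK : Leaf
leafOK R C u c₂₂ c₂₄ e x y z = known (build R C u c₂₂ c₂₄ e x y z)

-- Completeness of the enumerations.

⟹-elim : ∀ {p q} → T (p ⟹ q) → T p → T q
⟹-elim {true} h _ = h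

∧-elim : ∀ {p q} → T (p ∧ q) → T p × T q
∧-elim = Equivalence.to T-∧

∧-intro : ∀ {p q} → T p → T q → T (p ∧ q)
∧-intro p q = Equivalence.from T-∧ (p , q)

all-∈ : ∀ {A : Set} {p : A → Bool} {x xs} → T (all p xs) → x ∈ xs → T (p x)
all-∈ {p = p} {xs = xs} h = All.lookup (all⁺ p xs h)

≡⇒T : ∀ {m n} → m ≡ n → T (m ≡ᵇ n)
≡⇒T {m} {n} = ≡⇒≡ᵇ m n

∈-concat : ∀ {A A′ : Set} (f : A → List A′) {x xs y} → x ∈ xs → y ∈ f x → y ∈ concatMap f xs
∈-concat f x∈ y∈ = ∈-concatMap⁺ f (lose x∈ y∈)

∈-filter : ∀ {A : Set} (p : A → Bool) {x xs} → x ∈ xs → T (p x) → x ∈ filterᵇ p xs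
∈-filter p = ∈-filter⁺ (T? ∘ p)

all3-∈ : ∀ {d a b c} → a ∈ d → b ∈ d → c ∈ d → v3 a b c ∈ all3 d
all3-∈ {d} a b c = ∈-concat (λ a → concatMap (λ b → map (v3 a b) d) d) a (∈-concat (λ b → map (v3 _ b) d) b (∈-map⁺ (v3 _ _) c))

choices-∈ : ∀ {d₀ d₁ d₂ d₃ d₄ d₅ d₆ a b c d e f g} →
  a ∈ d₀ → b ∈ d₁ → c ∈ d₂ → d ∈ d₃ → e ∈ d₄ → f ∈ d₅ → g ∈ d₆ →
  v7 a b c d e f g ∈ choices d₀ d₁ d₂ d₃ d₄ d₅ d₆
choices-∈ {d₀} {d₁} {d₂} {d₃} {d₄} {d₅} {d₆} a∈ b∈ c∈ d∈ e∈ f∈ g∈ =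
  ∈-concat (λ a → concatMap (λ b → concatMap (λ c → concatMap (λ d → concatMap (λ e → concatMap (λ f → map (v7 a b c d e f) d₆) d₅) d₄) d₃) d₂) d₁) a∈
  (∈-concat (λ b → concatMap (λ c → concatMap (λ d → concatMap (λ e → concatMap (λ f → map (v7 _ b c d e f) d₆) d₅) d₄) d₃) d₂) b∈
  (∈-concat (λ c → concatMap (λ d → concatMap (λ e → concatMap (λ f → map (v7 _ _ c d e f) d₆) d₅) d₄) d₃) c∈
  (∈-concat (λ d → concatMap (λ e → concatMap (λ f → map (v7 _ _ _ d e f) d₆) d₅) d₄) d∈
  (∈-concat (λ e → concatMap (λ f → map (v7 _ _ _ _ e f) d₆) d₅) e∈
  (∈-concat (λ f → map (v7 _ _ _ _ _ f) d₆) f∈ (∈-map⁺ (v7 _ _ _ _ _ _) g∈))))))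

data Each (P : ℕ → Set) : V7 → Set where
  each : ∀ {a b c d e f g} → P a → P b → P c → P d → P e → P f → P g → Each P (v7 a b c d e f g)

all7-∈ : ∀ {d v} → Each (_∈ d) v → v ∈ all7 d
all7-∈ (each a b c d e f g) = choices-∈ a b c d e f g

Each-⊕ : ∀ {P Q R : ℕ → Set} {u v} → (∀ {x y} → P x → Q y → R (x + y)) → Each P u → Each Q v → Each R (u ⊕ v)
Each-⊕ k (each a b c d e f g) (each a′ b′ c′ d′ e′ f′ g′) =
  each (k a a′) (k b b′) (k c c′) (k d d′) (k e e′) (k f f′) (k g g′)

Each-double : ∀ {P R : ℕ → Set} {u} → (∀ {x} → P x → R (x + x)) → Each P u → Each R (u ⊕ u)
Each-double k (each a b c d e f g) = each (k a) (k b) (k c) (k d) (k e) (k f) (k g)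

double-bit : ∀ {x} → x ≤ 1 → x + x ∈ D₀
double-bit z≤n       = here refl
double-bit (s≤s z≤n) = there (here refl)

add-bits : ∀ {x y} → x ≤ 1 → y ≤ 1 → x + y ∈ D₁
add-bits z≤n       z≤n       = here refl
add-bits z≤n       (s≤s z≤n) = there (here refl)
add-bits (s≤s z≤n) z≤n       = there (here refl)
add-bits (s≤s z≤n) (s≤s z≤n) = there (there (here refl))

tr3 : V7 → V3
tr3 (v7 a b _ d _ _ _) = v3 a b d

cell-tr3 : ∀ v → θ v ≡ v → cell (tr3 v) ≡ v
cell-tr3 (v7 a b c d e f g) p = helper (cong digit₁ p) (cong digit₂ p) (cong digit₃ p) (cong digit₆ p)
  where
  digit₁ digit₂ digit₃ digit₆ : V7 → ℕ
  digit₁ (v7 _ x _ _ _ _ _) = x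
  digit₂ (v7 _ _ x _ _ _ _) = x
  digit₃ (v7 _ _ _ x _ _ _) = x
  digit₆ (v7 _ _ _ _ _ _ x) = x
  helper : e ≡ b → b ≡ c → f ≡ d → d ≡ g → v7 a b b d b d d ≡ v7 a b c d e f g
  helper refl refl refl refl = refl

Each-tr3 : ∀ {d v} → Each (_∈ d) v → tr3 v ∈ all3 d
Each-tr3 (each a b _ c _ _ _) = all3-∈ a b c

rev-⊕ : ∀ u v → rev (u ⊕ v) ≡ rev u ⊕ rev v
rev-⊕ (v7 _ _ _ _ _ _ _) (v7 _ _ _ _ _ _ _) = refl

θ-⊕ : ∀ u v → θ (u ⊕ v) ≡ θ u ⊕ θ v
θ-⊕ (v7 _ _ _ _ _ _ _) (v7 _ _ _ _ _ _ _) = refl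

rev-rev : ∀ v → rev (rev v) ≡ v
rev-rev (v7 _ _ _ _ _ _ _) = refl

⊕-⊖ : ∀ u v → u ⊕ v ⊖ u ≡ v
⊕-⊖ (v7 a b c d e f g) (v7 a′ b′ c′ d′ e′ f′ g′)
  rewrite m+n∸m≡n a a′ | m+n∸m≡n b b′ | m+n∸m≡n c c′ | m+n∸m≡n d d′ | m+n∸m≡n e e′ | m+n∸m≡n f f′ | m+n∸m≡n g g′ = refl

tot-⊕ : ∀ u v → tot (u ⊕ v) ≡ tot u + tot v
tot-⊕ (v7 a b c d e f g) (v7 a′ b′ c′ d′ e′ f′ g′) =
  solve 14 (λ a b c d e f g a′ b′ c′ d′ e′ f′ g′ →
    (a :+ a′) :+ ((b :+ b′) :+ ((c :+ c′) :+ ((d :+ d′) :+ ((e :+ e′) :+ ((f :+ f′) :+ (g :+ g′)))))) :=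
    (a :+ (b :+ (c :+ (d :+ (e :+ (f :+ g)))))) :+ (a′ :+ (b′ :+ (c′ :+ (d′ :+ (e′ :+ (f′ :+ g′)))))))
    refl a b c d e f g a′ b′ c′ d′ e′ f′ g′
  where open +-*-Solver

tot-θ : ∀ v → tot (θ v) ≡ tot v
tot-θ (v7 a b c d e f g) =
  solve 7 (λ a b c d e f g → a :+ (e :+ (b :+ (f :+ (c :+ (g :+ d))))) := a :+ (b :+ (c :+ (d :+ (e :+ (f :+ g)))))) refl a b c d e f g
  where open +-*-Solver

-- Merged rows of an invariant matrix.

-- The classes 0 and 1 are the orbits of length 7, the classes 2 and 3 form the orbit of length 14,
-- and 4 to 9 the regular one. `σ` and `ζ` are the actions of the elements of order 3 and 2 on
-- classes.
σ ζ : Fin 10 → Fin 10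
σ 0F = 0F
σ 1F = 1F
σ 2F = 2F
σ 3F = 3F
σ 4F = 6F
σ 5F = 7F
σ 6F = 8F
σ 7F = 9F
σ 8F = 4F
σ 9F = 5F
ζ 0F = 0F
ζ 1F = 1F
ζ 2F = 3F
ζ 3F = 2F
ζ 4F = 5F
ζ 5F = 4F
ζ 6F = 7F
ζ 7F = 6F
ζ 8F = 9F
ζ 9F = 8F

ζζ : ∀ j → ζ (ζ j) ≡ j
ζζ 0F = refl
ζζ 1F = refl
ζζ 2F = refl
ζζ 3F = refl
ζζ 4F = refl
ζζ 5F = refl
ζζ 6F = refl
ζζ 7F = refl
ζζ 8F = refl
ζζ 9F = refl

σσσ : ∀ j → σ (σ (σ j)) ≡ j
σσσ 0F = refl
σσσ 1F = refl
σσσ 2F = refl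
σσσ 3F = refl
σσσ 4F = refl
σσσ 5F = refl
σσσ 6F = refl
σσσ 7F = refl
σσσ 8F = refl
σσσ 9F = refl

σζ : ∀ j → σ (ζ j) ≡ ζ (σ j)
σζ 0F = refl
σζ 1F = refl
σζ 2F = refl
σζ 3F = refl
σζ 4F = refl
σζ 5F = refl
σζ 6F = refl
σζ 7F = refl
σζ 8F = refl
σζ 9F = refl

fold10 : ∀ {A : Set} → (A → A → A) → (Fin 10 → A) → A
fold10 _+_ f = f 0F + (f 1F + (f 2F + (f 3F + (f 4F + (f 5F + (f 6F + (f 7F + (f 8F + f 9F))))))))

sum10 : (Fin 10 → ℕ) → ℕ
sum10 = fold10 _+_

fold10-cong : ∀ {A : Set} (_∙_ : A → A → A) {f g : Fin 10 → A} → (∀ i → f i ≡ g i) → fold10 _∙_ f ≡ fold10 _∙_ g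
fold10-cong _∙_ p = go (p 0F) (go (p 1F) (go (p 2F) (go (p 3F) (go (p 4F) (go (p 5F) (go (p 6F) (go (p 7F) (go (p 8F) (p 9F)))))))))
  where
  go : ∀ {a b c d} → a ≡ b → c ≡ d → a ∙ c ≡ b ∙ d
  go = cong₂ _∙_

-- Rows of an incidence matrix that is circulant in blocks of size 7: block (i , j) holds c i j.
Blocks : Set
Blocks = Fin 10 → Fin 10 → V7

corrs : Blocks → Fin 10 → Fin 10 → V7
corrs c i k = fold10 _⊕_ (λ j → corr (c i j) (c k j))

-- All conditions concern rows; a design provides one such record for its matrix and, by duality,
-- one for the transpose.
record Half (c : Blocks) : Set where
  field
    isBit  : ∀ i j → Each (_≤ 1) (c i j)
    σ-inv  : ∀ i j → c (σ i) (σ j) ≡ θ (c i j)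
    ζ-inv  : ∀ i j → c (ζ i) (ζ j) ≡ c i j
    same   : ∀ i → corrs c i i ≡ v7 24 8 8 8 8 8 8
    diff   : ∀ i k → i ≢ k → corrs c i k ≡ v7 8 8 8 8 8 8 8
    weight : ∀ i → sum10 (λ j → tot (c i j)) ≡ 24

num-8s : num (v7 8 8 8 8 8 8 8) ≡ 8 * J
num-8s = trans (num-⊛ 8 (v7 1 1 1 1 1 1 1)) (cong (8 *_) (sym J≡num))

num-24 : num (v7 24 8 8 8 8 8 8) ≡ 16 + 8 * J
num-24 = trans (num-⊕ (v7 16 0 0 0 0 0 0) (v7 8 8 8 8 8 8 8)) (cong₂ _+_ (go B 16) num-8s)
  where
  go : ∀ B n → n + B * (0 + B * (0 + B * (0 + B * (0 + B * (0 + B * 0))))) ≡ n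
  go = solve 2 (λ B n → n :+ B :* (con 0 :+ B :* (con 0 :+ B :* (con 0 :+ B :* (con 0 :+ B :* (con 0 :+ B :* con 0))))) := n) refl
    where open +-*-Solver

module Sound (c : Blocks) (h : Half c) where
  open Half h

  m : Blocks
  m i j = c i j ⊕ c i (ζ j)

  c-ζ : ∀ i j → c (ζ i) j ≡ c i (ζ j)
  c-ζ i j = trans (cong (c (ζ i)) (sym (ζζ j))) (ζ-inv i (ζ j))

  m-σ : ∀ i j → m (σ i) (σ j) ≡ θ (m i j)
  m-σ i j = begin
    c (σ i) (σ j) ⊕ c (σ i) (ζ (σ j))  ≡⟨ cong (λ k → c (σ i) (σ j) ⊕ c (σ i) k) (σζ j) ⟨
    c (σ i) (σ j) ⊕ c (σ i) (σ (ζ j))  ≡⟨ cong₂ _⊕_ (σ-inv i j) (σ-inv i (ζ j)) ⟩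
    θ (c i j) ⊕ θ (c i (ζ j))          ≡⟨ θ-⊕ (c i j) (c i (ζ j)) ⟨
    θ (m i j)                          ∎
    where open ≡-Reasoning

  n ñ N Ñ : Fin 10 → Fin 10 → ℕ
  n i j = num (c i j)
  ñ i j = num (rev (c i j))
  N i j = num (m i j)
  Ñ i j = num (rev (m i j))

  N≡ : ∀ i j → N i j ≡ n i j + n i (ζ j)
  N≡ i j = num-⊕ (c i j) (c i (ζ j))

  Ñ≡ : ∀ i j → Ñ i j ≡ ñ i j + ñ i (ζ j)
  Ñ≡ i j = trans (cong num (rev-⊕ (c i j) (c i (ζ j)))) (num-⊕ (rev (c i j)) (rev (c i (ζ j))))

  P : Fin 10 → Fin 10 → ℕ
  P i k = sum10 (λ j → n i j * ñ k j)

  P≈num : ∀ i k → P i k ModM.≈ num (corrs c i k)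
  P≈num i k = go 0F (go 1F (go 2F (go 3F (go 4F (go 5F (go 6F (go 7F (go 8F (num-corr (c i 9F) (c k 9F))))))))))
    where
    go : ∀ j {x v} → x ModM.≈ num v → n i j * ñ k j + x ModM.≈ num (corr (c i j) (c k j) ⊕ v)
    go j {v = v} p = ModM.≈-trans (ModM.+-cong (num-corr (c i j) (c k j)) p) (ModM.≡⇒≈ (sym (num-⊕ (corr (c i j) (c k j)) v)))

  P-same : ∀ i → P i i ModM.≈ 16 + 8 * J
  P-same i = ModM.≈-trans (P≈num i i) (ModM.≡⇒≈ (trans (cong num (same i)) num-24))

  P-diff : ∀ i k → i ≢ k → P i k ModM.≈ 8 * J
  P-diff i k i≢k = ModM.≈-trans (P≈num i k) (ModM.≡⇒≈ (trans (cong num (diff i k i≢k)) num-8s))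

  IP : Fin 10 → Fin 10 → ℕ
  IP i k = N i 0F * Ñ k 0F + N i 1F * Ñ k 1F + 2 * (N i 2F * Ñ k 2F + N i 4F * Ñ k 4F + N i 6F * Ñ k 6F + N i 8F * Ñ k 8F)

  -- Merging the columns of row i amounts to adding row `ζ i`, because c (ζ i) j = c i (ζ j).
  IP≡ : ∀ i k → IP i k ≡ 2 * (P i k + P (ζ i) k)
  IP≡ i k = begin
    IP i k
      ≡⟨ cong₂ _+_ (cong₂ _+_ (t 0F) (t 1F)) (cong (2 *_) (cong₂ _+_ (cong₂ _+_ (cong₂ _+_ (t 2F) (t 4F)) (t 6F)) (t 8F))) ⟩
    q 0F + q 1F + 2 * (q 2F + q 4F + q 6F + q 8F)
      ≡⟨ ring (n i 0F) (n i 1F) (n i 2F) (n i 3F) (n i 4F) (n i 5F) (n i 6F) (n i 7F) (n i 8F) (n i 9F)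
              (ñ k 0F) (ñ k 1F) (ñ k 2F) (ñ k 3F) (ñ k 4F) (ñ k 5F) (ñ k 6F) (ñ k 7F) (ñ k 8F) (ñ k 9F) ⟩
    2 * (P i k + sum10 (λ j → n i (ζ j) * ñ k j))
      ≡⟨ cong (λ x → 2 * (P i k + x)) (fold10-cong _+_ (λ j → cong (λ v → num v * ñ k j) (c-ζ i j))) ⟨
    2 * (P i k + P (ζ i) k) ∎
    where
    open ≡-Reasoning
    open +-*-Solver
    q : Fin 10 → ℕ
    q j = (n i j + n i (ζ j)) * (ñ k j + ñ k (ζ j))
    t : ∀ j → N i j * Ñ k j ≡ q j
    t j = cong₂ _*_ (N≡ i j) (Ñ≡ k j)
    ring = solve 20 (λ a b c d e f g h i j a′ b′ c′ d′ e′ f′ g′ h′ i′ j′ →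
      (a :+ a) :* (a′ :+ a′) :+ (b :+ b) :* (b′ :+ b′) :+ con 2 :* ((c :+ d) :* (c′ :+ d′) :+ (e :+ f) :* (e′ :+ f′) :+ (g :+ h) :* (g′ :+ h′) :+ (i :+ j) :* (i′ :+ j′)) :=
      con 2 :* ((a :* a′ :+ (b :* b′ :+ (c :* c′ :+ (d :* d′ :+ (e :* e′ :+ (f :* f′ :+ (g :* g′ :+ (h :* h′ :+ (i :* i′ :+ j :* j′)))))))))
           :+ (a :* a′ :+ (b :* b′ :+ (d :* c′ :+ (c :* d′ :+ (f :* e′ :+ (e :* f′ :+ (h :* g′ :+ (g :* h′ :+ (j :* i′ :+ i :* j′)))))))))))
      refl

  IP-ortho : ∀ i k → i ≢ k → ζ i ≢ k → IP i k ModM.≈ 32 * J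
  IP-ortho i k p q =
    IP i k                    ≡⟨ IP≡ i k ⟩≈
    2 * (P i k + P (ζ i) k)   ≈⟨ *-congˡ 2 (+-cong (P-diff i k p) (P-diff (ζ i) k q)) ⟩
    2 * (8 * J + 8 * J)       ≡⟨ solve 1 (λ J → con 2 :* (con 8 :* J :+ con 8 :* J) := con 32 :* J) refl J ⟩≈
    32 * J                    ∎≈
    where
    open ModM
    open +-*-Solver

  IP-fixed : ∀ i → ζ i ≡ i → IP i i ModM.≈ 32 * J + 64
  IP-fixed i p =
    IP i i                    ≡⟨ trans (IP≡ i i) (cong (λ k → 2 * (P i i + P k i)) p) ⟩≈
    2 * (P i i + P i i)       ≈⟨ *-congˡ 2 (+-cong (P-same i) (P-same i)) ⟩
    2 * (16 + 8 * J + (16 + 8 * J)) ≡⟨ solve 1 (λ J → con 2 :* (con 16 :+ con 8 :* J :+ (con 16 :+ con 8 :* J)) := con 32 :* J :+ con 64) refl J ⟩≈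
    32 * J + 64               ∎≈
    where
    open ModM
    open +-*-Solver

  IP-moved : ∀ i → ζ i ≢ i → IP i i ModM.≈ 32 * J + 32
  IP-moved i p =
    IP i i                    ≡⟨ IP≡ i i ⟩≈
    2 * (P i i + P (ζ i) i)   ≈⟨ *-congˡ 2 (+-cong (P-same i) (P-diff (ζ i) i p)) ⟩
    2 * (16 + 8 * J + 8 * J)  ≡⟨ solve 1 (λ J → con 2 :* (con 16 :+ con 8 :* J :+ con 8 :* J) := con 32 :* J :+ con 32) refl J ⟩≈
    32 * J + 32               ∎≈
    where
    open ModM
    open +-*-Solver

  m-double : ∀ i j → c i (ζ j) ≡ c i j → Each (_∈ D₀) (m i j)
  m-double i j p = subst (λ v → Each (_∈ D₀) (c i j ⊕ v)) (sym p) (Each-double double-bit (isBit i j))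

  m-trits : ∀ i j → Each (_∈ D₁) (m i j)
  m-trits i j = Each-⊕ add-bits (isBit i j) (isBit i (ζ j))

  row-ζ : ∀ i → ζ i ≡ i → ∀ j → c i (ζ j) ≡ c i j
  row-ζ i p j = trans (sym (c-ζ i j)) (cong (λ k → c k j) p)

  t : Fin 10 → Fin 10 → V3
  t i j = tr3 (m i j)

  aOf : Fin 10 → AInfo
  aOf i = aInfo (t i 0F) (t i 1F) (t i 2F)

  bOf : Fin 10 → BInfo
  bOf i = bInfo (m i 4F)

  rowOf : Fin 10 → Row
  rowOf i = mkR (aOf i) (bOf i)

  module _ {i} (fix : σ i ≡ i) where

    m-σʳ : ∀ j → m i (σ j) ≡ θ (m i j)
    m-σʳ j = trans (cong (λ k → m k (σ j)) (sym fix)) (m-σ i j)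

    cell-t : ∀ j → σ j ≡ j → cell (t i j) ≡ m i j
    cell-t j p = cell-tr3 (m i j) (trans (sym (m-σʳ j)) (cong (m i) p))

    m6 : θ (m i 4F) ≡ m i 6F
    m6 = sym (m-σʳ 4F)

    m8 : θ (θ (m i 4F)) ≡ m i 8F
    m8 = trans (cong θ m6) (sym (m-σʳ 6F))

    weight-eq : tot (cell (t i 0F)) + tot (cell (t i 1F)) + 2 * tot (cell (t i 2F)) + 6 * tot (m i 4F) ≡ 48
    weight-eq = begin
      tot (cell (t i 0F)) + tot (cell (t i 1F)) + 2 * tot (cell (t i 2F)) + 6 * tot (m i 4F)
        ≡⟨ cong₂ _+_ (cong₂ _+_ (cong₂ _+_ (e 0F refl) (e 1F refl)) (cong (2 *_) (e 2F refl))) six ⟩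
      s 0F + s 1F + 2 * s 2F + 2 * (s 4F + s 6F + s 8F)
        ≡⟨ ring (w 0F) (w 1F) (w 2F) (w 3F) (w 4F) (w 5F) (w 6F) (w 7F) (w 8F) (w 9F) ⟩
      2 * sum10 w
        ≡⟨ cong (2 *_) (weight i) ⟩
      48 ∎
      where
      open ≡-Reasoning
      open +-*-Solver
      w s : Fin 10 → ℕ
      w j = tot (c i j)
      s j = w j + w (ζ j)
      ms : ∀ j → tot (m i j) ≡ s j
      ms j = tot-⊕ (c i j) (c i (ζ j))
      e : ∀ j → σ j ≡ j → tot (cell (t i j)) ≡ s j
      e j p = trans (cong tot (cell-t j p)) (ms j)
      t6 : tot (m i 4F) ≡ s 6F
      t6 = trans (sym (tot-θ (m i 4F))) (trans (cong tot m6) (ms 6F))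
      t8 : tot (m i 4F) ≡ s 8F
      t8 = trans (sym (trans (tot-θ (θ (m i 4F))) (tot-θ (m i 4F)))) (trans (cong tot m8) (ms 8F))
      six : 6 * tot (m i 4F) ≡ 2 * (s 4F + s 6F + s 8F)
      six = trans (solve 1 (λ x → con 6 :* x := con 2 :* (x :+ x :+ x)) refl (tot (m i 4F)))
                  (cong (2 *_) (cong₂ _+_ (cong₂ _+_ (ms 4F) t6) t8))
      ring = solve 10 (λ a b c d e f g h i j →
        (a :+ a) :+ (b :+ b) :+ con 2 :* (c :+ d) :+ con 2 :* ((e :+ f) :+ (g :+ h) :+ (i :+ j)) :=
        con 2 :* (a :+ (b :+ (c :+ (d :+ (e :+ (f :+ (g :+ (h :+ (i :+ j)))))))))) refl

    feasible-aOf : T (feasible (aOf i))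
    feasible-aOf = ≡⇒T (trans (sym ([m+kn]%n≡m%n s (tot (m i 4F)) 6)) (cong (_% 6) (trans (cong (s +_) (*-comm (tot (m i 4F)) 6)) weight-eq)))
      where s = tot (cell (t i 0F)) + tot (cell (t i 1F)) + 2 * tot (cell (t i 2F))

    weight48-OK : T (weight48 (aOf i) (bOf i))
    weight48-OK = ≡⇒T weight-eq

  module _ {i k} (fixᵢ : σ i ≡ i) (fixₖ : σ k ≡ k) where

    ip≡ : ip (rowOf i) (rowOf k) ≡ modM (IP i k)
    ip≡ = cong modM (cong₂ _+_ (cong₂ _+_ (e 0F refl) (e 1F refl)) (cong (2 *_) (cong₂ _+_ (cong₂ _+_ (cong₂ _+_ (e 2F refl) refl) e6) e8)))
      where
      e : ∀ j → σ j ≡ j → num (cell (t i j)) * num (rev (cell (t k j))) ≡ N i j * Ñ k j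
      e j p = cong₂ (λ v w → num v * num (rev w)) (cell-t fixᵢ j p) (cell-t fixₖ j p)
      e6 : num (θ (m i 4F)) * num (rev (θ (m k 4F))) ≡ N i 6F * Ñ k 6F
      e6 = cong₂ (λ v w → num v * num (rev w)) (m6 fixᵢ) (m6 fixₖ)
      e8 : num (θ (θ (m i 4F))) * num (rev (θ (θ (m k 4F)))) ≡ N i 8F * Ñ k 8F
      e8 = cong₂ (λ v w → num v * num (rev w)) (m8 fixᵢ) (m8 fixₖ)

    orthogonal-OK : i ≢ k → ζ i ≢ k → T (orthogonal (rowOf i) (rowOf k))
    orthogonal-OK p q = ≡⇒T (trans ip≡ (ModM.≈⇒% (IP-ortho i k p q)))

  selfOK-fixed : ∀ {i} → σ i ≡ i → ζ i ≡ i → T (selfOK T96 (rowOf i))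
  selfOK-fixed fix p = ≡⇒T (trans (ip≡ fix fix) (ModM.≈⇒% (IP-fixed _ p)))

  selfOK-moved : ∀ {i} → σ i ≡ i → ζ i ≢ i → T (selfOK T64 (rowOf i))
  selfOK-moved fix p = ≡⇒T (trans (ip≡ fix fix) (ModM.≈⇒% (IP-moved _ p)))

  rows-∈ : ∀ {tgt d bs i} → σ i ≡ i → (∀ j → ζ j ≡ j → Each (_∈ D₀) (m i j)) → Each (_∈ d) (m i 2F) →
    m i 4F ∈ bs → T (selfOK tgt (rowOf i)) → rowOf i ∈ rows tgt d (map bInfo bs)
  rows-∈ {tgt} {d} {bs} {i} fix d₀ d₂ b self =
    ∈-concat (rowsFrom tgt (map bInfo bs))
      (∈-filter feasible
        (∈-concat (λ a₀ → concatMap (λ a₁ → map (aInfo a₀ a₁) (all3 d)) (all3 D₀)) (Each-tr3 (d₀ 0F refl))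
          (∈-concat (λ a₁ → map (aInfo (t i 0F) a₁) (all3 d)) (Each-tr3 (d₀ 1F refl)) (∈-map⁺ (aInfo _ _) (Each-tr3 d₂))))
        (feasible-aOf fix))
      (∈-filter (selfOK tgt) (∈-map⁺ (mkR (aOf i)) (∈-filter (weight48 (aOf i)) (∈-map⁺ bInfo b) (weight48-OK fix))) self)

  triple : Tri
  triple = mkT (rowOf 0F) (rowOf 1F) (rowOf 2F)

  triple-∈ : m 0F 4F ∈ canonical → triple ∈ triples rows₀ rows₁ rows₂
  triple-∈ can =
    ∈-concat (λ r₀ → concatMap (triplesFrom rows₂ r₀) (filterᵇ (orthogonal r₀) rows₁)) r₀
      (∈-concat (triplesFrom rows₂ (rowOf 0F)) (∈-filter (orthogonal (rowOf 0F)) r₁ (orthogonal-OK refl refl (λ ()) (λ ())))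
        (∈-map⁺ (mkT (rowOf 0F) (rowOf 1F)) (∈-filter (orthogonal₂ (rowOf 0F) (rowOf 1F)) r₂
          (∧-intro (orthogonal-OK refl refl (λ ()) (λ ())) (orthogonal-OK refl refl (λ ()) (λ ()))))))
    where
    dbl : ∀ i → ζ i ≡ i → ∀ j → Each (_∈ D₀) (m i j)
    dbl i p j = m-double i j (row-ζ i p j)
    r₀ : rowOf 0F ∈ rows₀
    r₀ = rows-∈ refl (λ j _ → dbl 0F refl j) (dbl 0F refl 2F) can (selfOK-fixed refl refl)
    r₁ : rowOf 1F ∈ rows₁
    r₁ = rows-∈ refl (λ j _ → dbl 1F refl j) (dbl 1F refl 2F) (all7-∈ (dbl 1F refl 4F)) (selfOK-fixed refl refl)
    r₂ : rowOf 2F ∈ rows₂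
    r₂ = rows-∈ refl (λ j p → m-double 2F j (cong (c 2F) p)) (m-trits 2F 2F) (all7-∈ (m-trits 2F 4F)) (selfOK-moved refl (λ ()))

-- Completeness of decoding and of the linear systems.

≡ᵇ-sound : ∀ {m n} → T (m ≡ᵇ n) → m ≡ n
≡ᵇ-sound {m} {n} = ≡ᵇ⇒≡ m n

module _ {a : ℕ} (x : ℕ) (a<14 : a < 14) where

  low-digit : (a + 14 * x) % 14 ≡ a
  low-digit = trans (cong (λ y → (a + y) % 14) (*-comm 14 x)) (trans ([m+kn]%n≡m%n a x 14) (m<n⇒m%n≡m a<14))

  high-digits : (a + 14 * x) / 14 ≡ x
  high-digits = begin
    (a + 14 * x) / 14    ≡⟨ cong (λ y → (a + y) / 14) (*-comm 14 x) ⟩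
    (a + x * 14) / 14    ≡⟨ +-distrib-/-∣ʳ a (n∣m*n x) ⟩
    a / 14 + x * 14 / 14 ≡⟨ cong₂ _+_ (m<n⇒m/n≡0 a<14) (m*n/n≡m x 14) ⟩
    x                    ∎
    where open ≡-Reasoning

v7-≡ : ∀ {a b c d e f g a′ b′ c′ d′ e′ f′ g′} → a ≡ a′ → b ≡ b′ → c ≡ c′ → d ≡ d′ → e ≡ e′ → f ≡ f′ → g ≡ g′ →
  v7 a b c d e f g ≡ v7 a′ b′ c′ d′ e′ f′ g′
v7-≡ refl refl refl refl refl refl refl = refl

digits-num : ∀ {v} → Each (_< 14) v → digits (num v) ≡ v
digits-num {v} (each {a} {b} {c} {d} {e} {f} {g} pa pb pc pd pe pf pg) = trans (cong digits (num14 B≡)) go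
  where
  k₅ k₄ k₃ k₂ k₁ k₀ : ℕ
  k₅ = f + 14 * g
  k₄ = e + 14 * k₅
  k₃ = d + 14 * k₄
  k₂ = c + 14 * k₃
  k₁ = b + 14 * k₂
  k₀ = a + 14 * k₁
  num14 : ∀ {B} → B ≡ 14 → a + B * (b + B * (c + B * (d + B * (e + B * (f + B * g))))) ≡ k₀
  num14 refl = refl
  e₁ : k₀ / 14 ≡ k₁
  e₁ = high-digits k₁ pa
  e₂ : k₀ / 14 / 14 ≡ k₂
  e₂ = trans (cong (_/ 14) e₁) (high-digits k₂ pb)
  e₃ : k₀ / 14 / 14 / 14 ≡ k₃
  e₃ = trans (cong (_/ 14) e₂) (high-digits k₃ pc)
  e₄ : k₀ / 14 / 14 / 14 / 14 ≡ k₄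
  e₄ = trans (cong (_/ 14) e₃) (high-digits k₄ pd)
  e₅ : k₀ / 14 / 14 / 14 / 14 / 14 ≡ k₅
  e₅ = trans (cong (_/ 14) e₄) (high-digits k₅ pe)
  e₆ : k₀ / 14 / 14 / 14 / 14 / 14 / 14 ≡ g
  e₆ = trans (cong (_/ 14) e₅) (high-digits g pf)
  low : ∀ {x y z} → x ≡ y → y % 14 ≡ z → x % 14 ≡ z
  low p q = trans (cong (_% 14) p) q
  go : digits k₀ ≡ v7 a b c d e f g
  go = v7-≡ (low-digit k₁ pa) (low e₁ (low-digit k₂ pb)) (low e₂ (low-digit k₃ pc)) (low e₃ (low-digit k₄ pd))
            (low e₄ (low-digit k₅ pe)) (low e₅ (low-digit g pf)) (low e₆ (m<n⇒m%n≡m pg))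

-- The vector with all entries k has value k J, and `num` is monotone in each digit.
num-≤ : ∀ {k v} → Each (_≤ k) v → num v ≤ k * J
num-≤ {k} {v} (each a b c d e f g) =
  ≤-trans (+-mono-≤ a (l (+-mono-≤ b (l (+-mono-≤ c (l (+-mono-≤ d (l (+-mono-≤ e (l (+-mono-≤ f (l g))))))))))))
    (≤-reflexive (trans (solve 2 (λ B k → horner B k k k k k k k := k :* horner B (con 1) (con 1) (con 1) (con 1) (con 1) (con 1) (con 1)) refl B k)
                        (cong (k *_) (sym J≡num))))
  where
  open +-*-Solver
  l : ∀ {x y} → x ≤ y → B * x ≤ B * y
  l = *-monoʳ-≤ B

Each-map : ∀ {P Q : ℕ → Set} {v} → (∀ {x} → P x → Q x) → Each P v → Each Q v
Each-map k (each a b c d e f g) = each (k a) (k b) (k c) (k d) (k e) (k f) (k g)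

D₁-≤2 : ∀ {x} → x ∈ D₁ → x ≤ 2
D₁-≤2 (here refl) = z≤n
D₁-≤2 (there (here refl)) = s≤s z≤n
D₁-≤2 (there (there (here refl))) = s≤s (s≤s z≤n)

isTrits-complete : ∀ {v} → Each (_∈ D₁) v → T (isTrits v)
isTrits-complete (each a b c d e f g) =
  ∧-intro (l a) (∧-intro (l b) (∧-intro (l c) (∧-intro (l d) (∧-intro (l e) (∧-intro (l f) (l g))))))
  where
  l : ∀ {x} → x ∈ D₁ → T (x <ᵇ 3)
  l x∈ = <⇒<ᵇ (s≤s (D₁-≤2 x∈))

decode-complete : ∀ {v r} → Each (_∈ D₁) v → num v ModJ.≈ r → v ∈ decode (modJ r)
decode-complete {v} {r} v∈ p = go (num v / J) refl q≤2
  where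
  bound : Each (_≤ 2) v
  bound = Each-map D₁-≤2 v∈
  q≤2 : num v / J ≤ 2
  q≤2 = ≤-trans (/-monoˡ-≤ J (num-≤ bound)) (≤-reflexive (m*n/n≡m 2 J))
  split : ∀ {q} → num v / J ≡ q → num v ≡ modJ r + q * J
  split refl = trans (m≡m%n+[m/n]*n (num v) J) (cong (_+ num v / J * J) (ModJ.≈⇒% p))
  found : ∀ {x} → num v ≡ x → digits x ≡ v
  found refl = digits-num (Each-map (λ x≤2 → s≤s (≤-trans x≤2 (s≤s (s≤s z≤n)))) bound)
  ok : T (isTrits v)
  ok = isTrits-complete v∈
  L : List V7
  L = digits (modJ r) ∷ digits (modJ r + J) ∷ digits (modJ r + 2 * J) ∷ []
  pick′ : ∀ {x} → x ∈ L → v ≡ x → v ∈ filterᵇ isTrits L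
  pick′ x∈ refl = ∈-filter isTrits x∈ ok
  go : ∀ q → num v / J ≡ q → q ≤ 2 → v ∈ decode (modJ r)
  go 0 e _ = pick′ (here refl) (sym (found (trans (split e) (+-identityʳ (modJ r)))))
  go 1 e _ = pick′ (there (here refl)) (sym (found (trans (split e) (cong (modJ r +_) (+-identityʳ J)))))
  go 2 e _ = pick′ (there (there (here refl))) (sym (found (split e)))
  go (suc (suc (suc _))) _ (s≤s (s≤s ()))

combos-∈ : ∀ l₄ l₆ l₈ {x y z} → x ∈ l₄ → y ∈ l₆ → z ∈ l₈ → u3 x y z ∈ combos l₄ l₆ l₈
combos-∈ l₄ l₆ l₈ x∈ y∈ z∈ =
  ∈-concat (λ x → concatMap (λ y → map (u3 x y) l₈) l₆) x∈ (∈-concat (λ y → map (u3 _ y) l₈) y∈ (∈-map⁺ (u3 _ _) z∈))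

Trits : V7 → Set
Trits = Each (_∈ D₁)

-- One row (a, b, c) of a left inverse is applied to the system; in the uses (p, q, r) is a row of
-- the identity matrix.
eliminate : ∀ {a b c a′ b′ c′ d′ e′ f′ g′ h′ i′ p q r x y z} U V W → let open ModJ in
  a * a′ + b * d′ + c * g′ ≈ p → a * b′ + b * e′ + c * h′ ≈ q → a * c′ + b * f′ + c * i′ ≈ r →
  a′ * U + b′ * V + c′ * W ≈ x → d′ * U + e′ * V + f′ * W ≈ y → g′ * U + h′ * V + i′ * W ≈ z →
  p * U + q * V + r * W ≈ a * x + b * y + c * z
eliminate {a} {b} {c} {a′} {b′} {c′} {d′} {e′} {f′} {g′} {h′} {i′} {p} {q} {r} {x} {y} {z} U V W P Q R X Y Z =
  p * U + q * V + r * W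
    ≈⟨ ≈-sym (+-cong (+-cong (*-cong P (≈-refl {U})) (*-cong Q (≈-refl {V}))) (*-cong R (≈-refl {W}))) ⟩
  (a * a′ + b * d′ + c * g′) * U + (a * b′ + b * e′ + c * h′) * V + (a * c′ + b * f′ + c * i′) * W
    ≡⟨ solve 15 (λ a b c a′ b′ c′ d′ e′ f′ g′ h′ i′ U V W →
         (a :* a′ :+ b :* d′ :+ c :* g′) :* U :+ (a :* b′ :+ b :* e′ :+ c :* h′) :* V :+ (a :* c′ :+ b :* f′ :+ c :* i′) :* W :=
         a :* (a′ :* U :+ b′ :* V :+ c′ :* W) :+ b :* (d′ :* U :+ e′ :* V :+ f′ :* W) :+ c :* (g′ :* U :+ h′ :* V :+ i′ :* W))
         refl a b c a′ b′ c′ d′ e′ f′ g′ h′ i′ U V W ⟩≈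
  a * (a′ * U + b′ * V + c′ * W) + b * (d′ * U + e′ * V + f′ * W) + c * (g′ * U + h′ * V + i′ * W)
    ≈⟨ +-cong (+-cong (*-congˡ a X) (*-congˡ b Y)) (*-congˡ c Z) ⟩
  a * x + b * y + c * z ∎≈
  where
  open ModJ
  open +-*-Solver

eliminate₂ : ∀ {a b a′ b′ c′ d′ p q x y} V W → let open ModJ in
  a * a′ + b * c′ ≈ p → a * b′ + b * d′ ≈ q →
  a′ * V + b′ * W ≈ x → c′ * V + d′ * W ≈ y →
  p * V + q * W ≈ a * x + b * y
eliminate₂ {a} {b} {a′} {b′} {c′} {d′} {p} {q} {x} {y} V W P Q X Y =
  p * V + q * W
    ≈⟨ ≈-sym (+-cong (*-cong P (≈-refl {V})) (*-cong Q (≈-refl {W}))) ⟩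
  (a * a′ + b * c′) * V + (a * b′ + b * d′) * W
    ≡⟨ solve 8 (λ a b a′ b′ c′ d′ V W →
         (a :* a′ :+ b :* c′) :* V :+ (a :* b′ :+ b :* d′) :* W :=
         a :* (a′ :* V :+ b′ :* W) :+ b :* (c′ :* V :+ d′ :* W))
         refl a b a′ b′ c′ d′ V W ⟩≈
  a * (a′ * V + b′ * W) + b * (c′ * V + d′ * W)
    ≈⟨ +-cong (*-congˡ a X) (*-congˡ b Y) ⟩
  a * x + b * y ∎≈
  where
  open ModJ
  open +-*-Solver

Solves : M3 → ℕ → ℕ → ℕ → (U V W : ℕ) → Set
Solves (m3 a b c d e f g h i) x y z U V W =
  (a * U + b * V + c * W ModJ.≈ x) × (d * U + e * V + f * W ModJ.≈ y) × (g * U + h * V + i * W ModJ.≈ z)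

%J-sound : ∀ {x n} → T (modJ x ≡ᵇ n) → x ModJ.≈ n
%J-sound h = ModJ.%⇒≈ (≡ᵇ-sound h)

solve3-complete : ∀ V A {x y z u v w} → T (isInv3 V A) → Trits u → Trits v → Trits w →
  Solves A x y z (num u) (num v) (num w) → u3 u v w ∈ solve3 V x y z
solve3-complete (m3 a b c d e f g h i) (m3 a′ b′ c′ d′ e′ f′ g′ h′ i′) {x} {y} {z} {u} {v} {w} inv U V W (X , Y , Z) =
  combos-∈ (decode (modJ (a * x + b * y + c * z))) (decode (modJ (d * x + e * y + f * z))) (decode (modJ (g * x + h * y + i * z)))
           (decode-complete U (via (first (num u) (num v) (num w)) (elim a b c p₁ p₂ p₃)))
           (decode-complete V (via (second (num u) (num v) (num w)) (elim d e f p₄ p₅ p₆)))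
           (decode-complete W (via (third (num u) (num v) (num w)) (elim g h i p₇ p₈ p₉)))
  where
  r₂ = proj₂ (∧-elim {modJ (a * a′ + b * d′ + c * g′) ≡ᵇ 1} inv)
  r₃ = proj₂ (∧-elim {modJ (a * b′ + b * e′ + c * h′) ≡ᵇ 0} r₂)
  r₄ = proj₂ (∧-elim {modJ (a * c′ + b * f′ + c * i′) ≡ᵇ 0} r₃)
  r₅ = proj₂ (∧-elim {modJ (d * a′ + e * d′ + f * g′) ≡ᵇ 0} r₄)
  r₆ = proj₂ (∧-elim {modJ (d * b′ + e * e′ + f * h′) ≡ᵇ 1} r₅)
  r₇ = proj₂ (∧-elim {modJ (d * c′ + e * f′ + f * i′) ≡ᵇ 0} r₆)
  r₈ = proj₂ (∧-elim {modJ (g * a′ + h * d′ + i * g′) ≡ᵇ 0} r₇)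
  r₉ = proj₂ (∧-elim {modJ (g * b′ + h * e′ + i * h′) ≡ᵇ 0} r₈)
  p₁ : a * a′ + b * d′ + c * g′ ModJ.≈ 1
  p₁ = %J-sound (proj₁ (∧-elim {modJ (a * a′ + b * d′ + c * g′) ≡ᵇ 1} inv))
  p₂ : a * b′ + b * e′ + c * h′ ModJ.≈ 0
  p₂ = %J-sound (proj₁ (∧-elim {modJ (a * b′ + b * e′ + c * h′) ≡ᵇ 0} r₂))
  p₃ : a * c′ + b * f′ + c * i′ ModJ.≈ 0
  p₃ = %J-sound (proj₁ (∧-elim {modJ (a * c′ + b * f′ + c * i′) ≡ᵇ 0} r₃))
  p₄ : d * a′ + e * d′ + f * g′ ModJ.≈ 0
  p₄ = %J-sound (proj₁ (∧-elim {modJ (d * a′ + e * d′ + f * g′) ≡ᵇ 0} r₄))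
  p₅ : d * b′ + e * e′ + f * h′ ModJ.≈ 1
  p₅ = %J-sound (proj₁ (∧-elim {modJ (d * b′ + e * e′ + f * h′) ≡ᵇ 1} r₅))
  p₆ : d * c′ + e * f′ + f * i′ ModJ.≈ 0
  p₆ = %J-sound (proj₁ (∧-elim {modJ (d * c′ + e * f′ + f * i′) ≡ᵇ 0} r₆))
  p₇ : g * a′ + h * d′ + i * g′ ModJ.≈ 0
  p₇ = %J-sound (proj₁ (∧-elim {modJ (g * a′ + h * d′ + i * g′) ≡ᵇ 0} r₇))
  p₈ : g * b′ + h * e′ + i * h′ ModJ.≈ 0
  p₈ = %J-sound (proj₁ (∧-elim {modJ (g * b′ + h * e′ + i * h′) ≡ᵇ 0} r₈))
  p₉ : g * c′ + h * f′ + i * i′ ModJ.≈ 1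
  p₉ = %J-sound r₉
  via : ∀ {x y z} → x ≡ y → x ModJ.≈ z → y ModJ.≈ z
  via refl p = p
  elim : ∀ k l n {p q r} → k * a′ + l * d′ + n * g′ ModJ.≈ p → k * b′ + l * e′ + n * h′ ModJ.≈ q → k * c′ + l * f′ + n * i′ ModJ.≈ r →
    p * num u + q * num v + r * num w ModJ.≈ k * x + l * y + n * z
  elim k l n P Q R = eliminate {a = k} {l} {n} (num u) (num v) (num w) P Q R X Y Z
  open +-*-Solver
  first : ∀ x y z → 1 * x + 0 * y + 0 * z ≡ x
  first = solve 3 (λ x y z → con 1 :* x :+ con 0 :* y :+ con 0 :* z := x) refl
  second : ∀ x y z → 0 * x + 1 * y + 0 * z ≡ y
  second = solve 3 (λ x y z → con 0 :* x :+ con 1 :* y :+ con 0 :* z := y) refl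
  third : ∀ x y z → 0 * x + 0 * y + 1 * z ≡ z
  third = solve 3 (λ x y z → con 0 :* x :+ con 0 :* y :+ con 1 :* z := z) refl

solve2-complete : ∀ W A {x y z u v w} → T (isInv2 W A) → Trits u → Trits v → Trits w →
  Solves A x y z (num u) (num v) (num w) → u3 u v w ∈ solve2 W A x y
solve2-complete W@(m2 p q r s) (m3 a b c d e f _ _ _) {x} {y} {u = u} {v} {w} inv U V W′ (X , Y , _) =
  ∈-concat (λ u → solve2-from W u (x + neg (a * num u)) (y + neg (d * num u))) (all7-∈ U)
    (combos-∈ (u ∷ []) (decode (modJ (p * x′ + q * y′))) (decode (modJ (r * x′ + s * y′))) (here refl)
      (decode-complete V (via (first (num v) (num w)) (eliminate₂ {a = p} {q} (num v) (num w) p₁ p₂ X′ Y′)))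
      (decode-complete W′ (via (second (num v) (num w)) (eliminate₂ {a = r} {s} (num v) (num w) p₃ p₄ X′ Y′))))
  where
  x′ = x + neg (a * num u)
  y′ = y + neg (d * num u)
  r₂ = proj₂ (∧-elim {modJ (p * b + q * e) ≡ᵇ 1} inv)
  r₃ = proj₂ (∧-elim {modJ (p * c + q * f) ≡ᵇ 0} r₂)
  p₁ : p * b + q * e ModJ.≈ 1
  p₁ = %J-sound (proj₁ (∧-elim {modJ (p * b + q * e) ≡ᵇ 1} inv))
  p₂ : p * c + q * f ModJ.≈ 0
  p₂ = %J-sound (proj₁ (∧-elim {modJ (p * c + q * f) ≡ᵇ 0} r₂))
  p₃ : r * b + s * e ModJ.≈ 0
  p₃ = %J-sound (proj₁ (∧-elim {modJ (r * b + s * e) ≡ᵇ 0} r₃))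
  p₄ : r * c + s * f ModJ.≈ 1
  p₄ = %J-sound (proj₂ (∧-elim {modJ (r * b + s * e) ≡ᵇ 0} r₃))
  via : ∀ {x y z} → x ≡ y → x ModJ.≈ z → y ModJ.≈ z
  via refl p = p
  open +-*-Solver
  first : ∀ x y → 1 * x + 0 * y ≡ x
  first = solve 2 (λ x y → con 1 :* x :+ con 0 :* y := x) refl
  second : ∀ x y → 0 * x + 1 * y ≡ y
  second = solve 2 (λ x y → con 0 :* x :+ con 1 :* y := y) refl
  drop : ∀ {k y} x → x + y ModJ.≈ k → y ModJ.≈ k + neg x
  drop {k} {y} x p =
    y                 ≡⟨ sym (+-identityʳ y) ⟩≈
    y + 0             ≈⟨ +-congˡ y (≈-sym (ν-negates x)) ⟩
    y + (x + neg x)   ≡⟨ trans (sym (+-assoc y x (neg x))) (cong (_+ neg x) (+-comm y x)) ⟩≈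
    x + y + neg x     ≈⟨ +-cong p ≈-refl ⟩
    k + neg x         ∎≈
    where open ModJ
  X′ : b * num v + c * num w ModJ.≈ x + neg (a * num u)
  X′ = drop (a * num u) (via (+-assoc (a * num u) (b * num v) (c * num w)) X)
  Y′ : e * num v + f * num w ModJ.≈ y + neg (d * num u)
  Y′ = drop (d * num u) (via (+-assoc (d * num u) (e * num v) (f * num w)) Y)

neg3-tr3-rev : ∀ v → θ v ≡ v → neg3 (tr3 (rev v)) ≡ tr3 v
neg3-tr3-rev (v7 a b c d e f g) p = cong₂ (v3 a) (cong digit₁ p) (sym (cong digit₆ p))
  where
  digit₁ digit₆ : V7 → ℕ
  digit₁ (v7 _ x _ _ _ _ _) = x
  digit₆ (v7 _ _ _ _ _ _ x) = x

-- The row triple and the column triple of one matrix.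

module Pair (c : Blocks) (h : Half c) (h′ : Half (transp c)) where
  module R = Sound c h
  module C = Sound (transp c) h′

  m′ : ∀ i j → C.m i j ≡ rev (R.m j i)
  m′ i j = trans (cong (λ v → rev (c j i) ⊕ rev v) (R.c-ζ j i)) (sym (rev-⊕ (c j i) (c j (ζ i))))

  rev-m′ : ∀ i j → rev (C.m i j) ≡ R.m j i
  rev-m′ i j = trans (cong rev (m′ i j)) (rev-rev (R.m j i))

  Ñ′ : ∀ i j → C.Ñ i j ≡ R.N j i
  Ñ′ i j = cong num (rev-m′ i j)

  t′ : ∀ i j → σ i ≡ i → σ j ≡ j → neg3 (C.t j i) ≡ R.t i j
  t′ i j p q = trans (cong (λ v → neg3 (tr3 v)) (m′ j i))
    (neg3-tr3-rev (R.m i j) (trans (sym (R.m-σ i j)) (cong₂ R.m p q)))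

  keys : keyC C.triple ≡ keyR R.triple
  keys = encode-cong (t′ 0F 0F refl refl) (t′ 0F 1F refl refl) (t′ 0F 2F refl refl) (t′ 1F 0F refl refl) (t′ 1F 1F refl refl)
                     (t′ 1F 2F refl refl) (t′ 2F 0F refl refl) (t′ 2F 1F refl refl) (t′ 2F 2F refl refl)
    where
    encode-cong : ∀ {a b c d e f g h i a′ b′ c′ d′ e′ f′ g′ h′ i′} →
      a ≡ a′ → b ≡ b′ → c ≡ c′ → d ≡ d′ → e ≡ e′ → f ≡ f′ → g ≡ g′ → h ≡ h′ → i ≡ i′ →
      encode a b c d e f g h i ≡ encode a′ b′ c′ d′ e′ f′ g′ h′ i′
    encode-cong refl refl refl refl refl refl refl refl refl = refl

  u : U3
  u = u3 (R.m 4F 4F) (R.m 4F 6F) (R.m 4F 8F)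

  module _ {i} (fix : σ i ≡ i) where

    cross : Fin 10 → Fin 10 → ℕ
    cross j k = R.N 4F j * R.Ñ k j

    e₀₁₂ : ∀ j → σ j ≡ j → num (rev (cell (R.t i j))) ≡ R.Ñ i j
    e₀₁₂ j p = cong (λ v → num (rev v)) (R.cell-t fix j p)

    e₆ : num (rev (θ (R.m i 4F))) ≡ R.Ñ i 6F
    e₆ = cong (λ v → num (rev v)) (R.m6 fix)

    e₈ : num (rev (θ (θ (R.m i 4F)))) ≡ R.Ñ i 8F
    e₈ = cong (λ v → num (rev v)) (R.m8 fix)

    -- Both row 4 and its partner, row 5, differ from row i, so the merged product is 32 J modulo M
    -- and hence 0 modulo J; the known columns go to the right-hand side.
    solves : 4F ≢ i → 5F ≢ i →
      2 * num (rev (R.m i 4F)) * R.N 4F 4F + 2 * num (rev (θ (R.m i 4F))) * R.N 4F 6F + 2 * num (rev (θ (θ (R.m i 4F)))) * R.N 4F 8F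
        ModJ.≈ rhs (R.rowOf i) C.triple
    solves p q = ≈-trans (≈-trans (≡⇒≈ lhs) (negate X total)) (≈-sym (≈-trans (%≈ _) (≡⇒≈ (cong (ν *_) K≡))))
      where
      open ModJ
      open +-*-Solver
      X K : ℕ
      X = 2 * R.Ñ i 4F * R.N 4F 4F + 2 * R.Ñ i 6F * R.N 4F 6F + 2 * R.Ñ i 8F * R.N 4F 8F
      K = R.Ñ i 0F * R.N 4F 0F + R.Ñ i 1F * R.N 4F 1F + 2 * (R.Ñ i 2F * R.N 4F 2F)
      lhs : _ ≡ X
      lhs = cong₂ (λ x y → 2 * R.Ñ i 4F * R.N 4F 4F + 2 * x * R.N 4F 6F + 2 * y * R.N 4F 8F) e₆ e₈
      K≡ : _ ≡ K
      K≡ = cong₂ _+_ (cong₂ _+_ (cong₂ _*_ (e₀₁₂ 0F refl) (Ñ′ 0F 4F)) (cong₂ _*_ (e₀₁₂ 1F refl) (Ñ′ 1F 4F)))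
                     (cong (2 *_) (cong₂ _*_ (e₀₁₂ 2F refl) (Ñ′ 2F 4F)))
      total : X + K ≈ 0
      total =
        X + K           ≡⟨ ring (R.N 4F 0F) (R.N 4F 1F) (R.N 4F 2F) (R.N 4F 4F) (R.N 4F 6F) (R.N 4F 8F)
                                (R.Ñ i 0F) (R.Ñ i 1F) (R.Ñ i 2F) (R.Ñ i 4F) (R.Ñ i 6F) (R.Ñ i 8F) ⟩≈
        R.IP 4F i       ≈⟨ M⇒J (R.IP-ortho 4F i p q) ⟩
        32 * J          ≈⟨ multiple≈0 32 ⟩
        0               ∎≈
        where
        ring = solve 12 (λ a b c d e f a′ b′ c′ d′ e′ f′ →
          (con 2 :* d′ :* d :+ con 2 :* e′ :* e :+ con 2 :* f′ :* f) :+ (a′ :* a :+ b′ :* b :+ con 2 :* (c′ :* c)) :=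
          a :* a′ :+ b :* b′ :+ con 2 :* (c :* c′ :+ d :* d′ :+ e :* e′ :+ f :* f′)) refl

    ip4-OK : 4F ≢ i → 5F ≢ i → T (ip4 (R.rowOf i) C.triple u ≡ᵇ T32)
    ip4-OK p q = ≡⇒T (trans (cong modM eq) (ModM.≈⇒% (R.IP-ortho 4F i p q)))
      where
      eq : _ ≡ R.IP 4F i
      eq = cong₂ _+_ (cong₂ _+_ (cong₂ _*_ (Ñ′ 0F 4F) (e₀₁₂ 0F refl)) (cong₂ _*_ (Ñ′ 1F 4F) (e₀₁₂ 1F refl)))
        (cong (2 *_) (cong₂ _+_ (cong₂ _+_ (cong (_+ cross 4F i) (cong₂ _*_ (Ñ′ 2F 4F) (e₀₁₂ 2F refl)))
          (cong (R.N 4F 6F *_) e₆)) (cong (R.N 4F 8F *_) e₈)))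

  self4-OK : T (self4 (rev (C.m 0F 4F)) (rev (C.m 1F 4F)) (rev (C.m 2F 4F)) u)
  self4-OK rewrite rev-m′ 0F 4F | rev-m′ 1F 4F | rev-m′ 2F 4F =
    ∧-intro (≡⇒T (ModM.≈⇒% (R.IP-moved 4F (λ ()))))
            (≡⇒T (trans (cong modM eq) (ModM.≈⇒% (R.IP-ortho 4F 6F (λ ()) (λ ())))))
    where
    e : ∀ j → R.m 4F j ∙ θ (R.m 4F (σ (σ j))) ≡ R.N 4F j * R.Ñ 6F j
    -- `σ` applied twice is its inverse, so row 6 in column j is `θ` of row 4 in column σ (σ j).
    e j = cong (λ v → R.m 4F j ∙ v) (trans (sym (R.m-σ 4F (σ (σ j)))) (cong (R.m 6F) (σσσ j)))
    eq : _ ≡ R.IP 4F 6F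
    eq = cong₂ _+_ (cong₂ _+_ (e 0F) (e 1F)) (cong (2 *_) (cong₂ _+_ (cong₂ _+_ (cong₂ _+_ (e 2F) (e 4F)) (e 6F)) (e 8F)))

  row4-OK : T (row4OK R.triple C.triple u)
  row4-OK = ∧-intro (ip4-OK {0F} refl (λ ()) (λ ())) (∧-intro (ip4-OK {1F} refl (λ ()) (λ ())) (∧-intro (ip4-OK {2F} refl (λ ()) (λ ())) self4-OK))

  A : M3
  A = coeffs R.triple

  candidates-∈ : ∀ b V W → T (b ∨ isInv2 W A) → (T b → T (isInv3 V A)) → u ∈ candidates b A V W R.triple C.triple
  candidates-∈ b V W ok inv = go b ok inv
    where
    tr : ∀ j → Trits (R.m 4F j)
    tr = R.m-trits 4F
    sol : Solves A (rhs (R.rowOf 0F) C.triple) (rhs (R.rowOf 1F) C.triple) (rhs (R.rowOf 2F) C.triple) (R.N 4F 4F) (R.N 4F 6F) (R.N 4F 8F)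
    sol = solves {0F} refl (λ ()) (λ ()) , solves {1F} refl (λ ()) (λ ()) , solves {2F} refl (λ ()) (λ ())
    go : ∀ b → T (b ∨ isInv2 W A) → (T b → T (isInv3 V A)) → u ∈ candidates b A V W R.triple C.triple
    go true  _  inv = solve3-complete V A (inv tt) (tr 4F) (tr 6F) (tr 8F) sol
    go false ok _   = solve2-complete W A ok (tr 4F) (tr 6F) (tr 8F) sol

  allPairs-sound : ∀ k l → T (allPairs k l) → R.triple ∈ l → C.triple ∈ l → T (ordered R.triple) → T (k R.triple C.triple u)
  allPairs-sound k l H R∈ C∈ ord =
    ⟹-elim {row4OK R.triple C.triple u} (all-∈ {p = λ v → row4OK R.triple C.triple v ⟹ k R.triple C.triple v} matched
      (candidates-∈ b V W (proj₁ (∧-elim {b ∨ isInv2 W A} found)) (λ x → x))) row4-OK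
    where
    V = inv3 A
    W = inv2 A
    b = isInv3 V A
    found : T (pairs k (map withKey l) R.triple)
    found = all-∈ {p = pairs k (map withKey l)} H (∈-filter ordered R∈ ord)
    matched : T (all (λ v → row4OK R.triple C.triple v ⟹ k R.triple C.triple v) (candidates b A V W R.triple C.triple))
    matched = ⟹-elim {keyC C.triple ≡ᵇ keyR R.triple}
      (all-∈ {p = match k R.triple (keyR R.triple) (candidates b A V W R.triple)} (proj₂ (∧-elim {b ∨ isInv2 W A} found)) (∈-map⁺ withKey C∈))
      (≡⇒T keys)

-- Completeness of the lift.

bit-∈ : ∀ {x y} → x ≤ 1 → y ≤ 1 → x ∈ bit (x + y)
bit-∈ z≤n       z≤n       = here refl
bit-∈ z≤n       (s≤s z≤n) = here refl
bit-∈ (s≤s z≤n) z≤n       = there (here refl)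
bit-∈ (s≤s z≤n) (s≤s z≤n) = here refl

Bits : V7 → Set
Bits = Each (_≤ 1)

bits-∈ : ∀ {u v} → Bits u → Bits v → u ∈ bits (u ⊕ v)
bits-∈ (each a b c d e f g) (each a′ b′ c′ d′ e′ f′ g′) =
  choices-∈ (bit-∈ a a′) (bit-∈ b b′) (bit-∈ c c′) (bit-∈ d d′) (bit-∈ e e′) (bit-∈ f f′) (bit-∈ g g′)

bits3-∈ : ∀ {u v} → Bits u → Bits v → tr3 u ∈ bits3 (tr3 (u ⊕ v))
bits3-∈ (each {a} {b} {d = c} pa pb _ pc _ _ _) (each {a′} {b′} {d = c′} pa′ pb′ _ pc′ _ _ _) =
  ∈-concat (λ x → concatMap (λ y → map (v3 x y) (bit (c + c′))) (bit (b + b′))) (bit-∈ pa pa′)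
    (∈-concat (λ y → map (v3 a y) (bit (c + c′))) (bit-∈ pb pb′) (∈-map⁺ (v3 a b) (bit-∈ pc pc′)))

halve-double : ∀ v → halve (v ⊕ v) ≡ v
halve-double (v7 a b c d e f g) = v7-≡ (k a) (k b) (k c) (k d) (k e) (k f) (k g)
  where
  k : ∀ x → (x + x) / 2 ≡ x
  k x = trans (cong (_/ 2) (trans (cong (x +_) (sym (+-identityʳ x))) (*-comm 2 x))) (m*n/n≡m x 2)

module SoundLift (c : Blocks) (h : Half c) where
  open Half h
  open Sound c h

  Q : (v : Fin 10 → V7) (w : Fin 10 → V7) → ℕ
  Q v w = v 2F ∙ w 2F + v 3F ∙ w 3F + (v 4F ∙ w 4F + v 6F ∙ w 6F + v 8F ∙ w 8F) + (v 5F ∙ w 5F + v 7F ∙ w 7F + v 9F ∙ w 9F)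

  4P : ∀ i k → N i 0F * Ñ k 0F + N i 1F * Ñ k 1F + 4 * Q (c i) (c k) ≡ 4 * P i k
  4P i k = trans (cong₂ (λ x y → x + y + 4 * Q (c i) (c k)) (cong₂ _*_ (N≡ i 0F) (Ñ≡ k 0F)) (cong₂ _*_ (N≡ i 1F) (Ñ≡ k 1F)))
    (ring (n i 0F) (n i 1F) (ñ k 0F) (ñ k 1F) (n i 2F * ñ k 2F) (n i 3F * ñ k 3F) (n i 4F * ñ k 4F) (n i 5F * ñ k 5F)
          (n i 6F * ñ k 6F) (n i 7F * ñ k 7F) (n i 8F * ñ k 8F) (n i 9F * ñ k 9F))
    where
    open +-*-Solver
    ring = solve 12 (λ a b a′ b′ c d e f g h i j →
      (a :+ a) :* (a′ :+ a′) :+ (b :+ b) :* (b′ :+ b′) :+ con 4 :* (c :+ d :+ (e :+ g :+ i) :+ (f :+ h :+ j)) :=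
      con 4 :* (a :* a′ :+ (b :* b′ :+ (c :+ (d :+ (e :+ (f :+ (g :+ (h :+ (i :+ j)))))))))) refl

  4P-same : ∀ i → 4 * P i i ModM.≈ 32 * J + 64
  4P-same i = ≈-trans (*-congˡ 4 (P-same i)) (≡⇒≈ (solve 1 (λ J → con 4 :* (con 16 :+ con 8 :* J) := con 32 :* J :+ con 64) refl J))
    where
    open ModM
    open +-*-Solver

  4P-diff : ∀ i k → i ≢ k → 4 * P i k ModM.≈ 32 * J
  4P-diff i k p = ≈-trans (*-congˡ 4 (P-diff i k p)) (≡⇒≈ (solve 1 (λ J → con 4 :* (con 8 :* J) := con 32 :* J) refl J))
    where
    open ModM
    open +-*-Solver

  m⊖c : ∀ i j → m i j ⊖ c i j ≡ c i (ζ j)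
  m⊖c i j = ⊕-⊖ (c i j) (c i (ζ j))

  cell⊖c : ∀ {i} (fix : σ i ≡ i) j → σ j ≡ j → cell (t i j) ⊖ c i j ≡ c i (ζ j)
  cell⊖c fix j p = trans (cong (_⊖ c _ j) (cell-t fix j p)) (m⊖c _ j)

  c-σ : ∀ {i} → σ i ≡ i → ∀ j → θ (c i j) ≡ c i (σ j)
  c-σ {i} fix j = trans (sym (σ-inv i j)) (cong (λ k → c k (σ j)) fix)

  c-σσ : ∀ {i} → σ i ≡ i → ∀ j → θ (θ (c i j)) ≡ c i (σ (σ j))
  c-σσ fix j = trans (cong θ (c-σ fix j)) (c-σ fix (σ j))

  c₃≡ : cell (t 2F 2F) ⊖ c 2F 2F ≡ c 2F 3F
  c₃≡ = cell⊖c refl 2F refl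

  c₅≡ : m 2F 4F ⊖ c 2F 4F ≡ c 2F 5F
  c₅≡ = m⊖c 2F 4F

  c₇≡ : θ (m 2F 4F ⊖ c 2F 4F) ≡ c 2F 7F
  c₇≡ = trans (cong θ c₅≡) (c-σ refl 5F)

  c₉≡ : θ (θ (m 2F 4F ⊖ c 2F 4F)) ≡ c 2F 9F
  c₉≡ = trans (cong θ c₇≡) (c-σ refl 7F)

  row2OK-true : T (row2OK (rowOf 2F) (c 2F 2F) (c 2F 4F))
  row2OK-true = ≡⇒T (trans (cong modM (trans eq (4P 2F 2F))) (ModM.≈⇒% (4P-same 2F)))
    where
    sq : ∀ {v w} → v ≡ w → v ∙ v ≡ w ∙ w
    sq = cong (λ v → v ∙ v)
    eq : _ ≡ N 2F 0F * Ñ 2F 0F + N 2F 1F * Ñ 2F 1F + 4 * Q (c 2F) (c 2F)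
    eq = cong₂ _+_ (cong₂ _+_ (sq (cell-t refl 0F refl)) (sq (cell-t refl 1F refl)))
      (cong (4 *_) (cong₂ _+_ (cong₂ _+_ (cong (c 2F 2F ∙ c 2F 2F +_) (sq c₃≡))
        (cong₂ _+_ (cong (c 2F 4F ∙ c 2F 4F +_) (sq (c-σ refl 4F))) (sq (c-σσ refl 4F))))
        (cong₂ _+_ (cong₂ _+_ (sq c₅≡) (sq c₇≡)) (sq c₉≡))))

  row2Lifts-∈ : T (lead7 (m 2F 4F) (c 2F 4F)) → c 2F 4F ∈ row2Lifts (rowOf 2F) (c 2F 2F)
  row2Lifts-∈ ld = ∈-filter (row2OK (rowOf 2F) (c 2F 2F))
    (∈-filter (lead7 (m 2F 4F)) (bits-∈ (isBit 2F 4F) (isBit 2F 5F)) ld) row2OK-true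

-- The value is at most J. Below J it is its own residue and keeps its lowest digit; the value J has
-- residue 0.
num-%14 : ∀ {v} → Bits v → T (modJ (num v) % 14 <ᵇ 2)
num-%14 {v} b@(each {a} {b₁} {c} {d} {e} {f} {g} a≤1 _ _ _ _ _ _) with m≤n⇒m<n∨m≡n (≤-trans (num-≤ b) (≤-reflexive (+-identityʳ J)))
... | inj₁ <J = <⇒<ᵇ (s≤s (≤-trans (≤-reflexive (trans (cong (_% 14) (m<n⇒m%n≡m <J)) low)) a≤1))
  where
  low : num v % 14 ≡ a
  low = trans (cong (λ B′ → (a + B′ * rest) % 14) B≡) (low-digit rest (s≤s (≤-trans a≤1 (s≤s z≤n))))
    where
    rest : ℕ
    rest = b₁ + B * (c + B * (d + B * (e + B * (f + B * g))))
... | inj₂ ≡J = subst (λ x → T (x % 14 <ᵇ 2)) (sym (trans (cong (_% J) ≡J) (n%n≡0 J))) tt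

module Lifted (c : Blocks) (h : Half c) (h′ : Half (transp c)) where
  open Half h
  open Pair c h h′
  open R
  module RL = SoundLift c h
  module CL = SoundLift (transp c) h′
  open RL using (Q; 4P; 4P-same; 4P-diff; m⊖c; c-σ; c-σσ)

  e : V7
  e = transp c 2F 4F

  e₂ : rev e ≡ c 4F 2F
  e₂ = rev-rev (c 4F 2F)

  e₃ : rev (C.m 2F 4F ⊖ e) ≡ c 4F 3F
  e₃ = trans (cong rev (CL.m⊖c 2F 4F)) (trans (rev-rev (c 5F 2F)) (c-ζ 4F 2F))

  row4Lift-true : T (row4Lift C.triple e u (c 4F 4F) (c 4F 6F) (c 4F 8F))
  row4Lift-true = ∧-intro
    (≡⇒T (trans (cong modM (trans eq₁ (4P 4F 4F))) (ModM.≈⇒% (4P-same 4F))))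
    (≡⇒T (trans (cong modM (trans eq₂ (4P 4F 6F))) (ModM.≈⇒% (4P-diff 4F 6F (λ ())))))
    where
    sq : ∀ {v w} → v ≡ w → v ∙ v ≡ w ∙ w
    sq = cong (λ v → v ∙ v)
    eq₁ : _ ≡ N 4F 0F * Ñ 4F 0F + N 4F 1F * Ñ 4F 1F + 4 * Q (c 4F) (c 4F)
    eq₁ = cong₂ _+_ (cong₂ _+_ (sq (rev-m′ 0F 4F)) (sq (rev-m′ 1F 4F)))
      (cong (4 *_) (cong₂ _+_ (cong (_+ (c 4F 4F ∙ c 4F 4F + c 4F 6F ∙ c 4F 6F + c 4F 8F ∙ c 4F 8F)) (cong₂ _+_ (sq e₂) (sq e₃)))
        (cong₂ _+_ (cong₂ _+_ (sq (m⊖c 4F 4F)) (sq (m⊖c 4F 6F))) (sq (m⊖c 4F 8F)))))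
    m6′ : ∀ {v} j → v ≡ m 4F j → v ∙ θ v ≡ N 4F j * num (rev (m 6F (σ j)))
    m6′ j refl = cong (m 4F j ∙_) (sym (m-σ 4F j))
    c6 : ∀ {v w} j → v ≡ c 4F (σ j) → w ≡ c 4F j → v ∙ θ w ≡ c 4F (σ j) ∙ c 6F (σ j)
    c6 j refl refl = cong (c 4F (σ j) ∙_) (sym (σ-inv 4F j))
    eq₂ : _ ≡ N 4F 0F * Ñ 6F 0F + N 4F 1F * Ñ 6F 1F + 4 * Q (c 4F) (c 6F)
    eq₂ = cong₂ _+_ (cong₂ _+_ (m6′ 0F (rev-m′ 0F 4F)) (m6′ 1F (rev-m′ 1F 4F)))
      (cong (4 *_) (cong₂ _+_ (cong₂ _+_ (cong₂ _+_ (c6 2F e₂ e₂) (c6 3F e₃ e₃))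
        (cong₂ _+_ (cong₂ _+_ (c6 8F refl refl) (c6 4F refl refl)) (c6 6F refl refl)))
        (cong₂ _+_ (cong₂ _+_ (c6 9F (m⊖c 4F 4F) (m⊖c 4F 8F)) (c6 5F (m⊖c 4F 6F) (m⊖c 4F 4F))) (c6 7F (m⊖c 4F 8F) (m⊖c 4F 6F)))))

  -- With y = num (c 4 8) the equation 4 P(4,2) ≡ 0 reads y · a + K ≡ 0.
  module _ (r₂ r₃ r₄ r₅ r₆ r₇ r₈ r₉ κ κ′ : ℕ)
           (p₂ : r₂ ≡ ñ 2F 2F) (p₃ : r₃ ≡ ñ 2F 3F) (p₄ : r₄ ≡ ñ 2F 4F) (p₅ : r₅ ≡ ñ 2F 5F)
           (p₆ : r₆ ≡ ñ 2F 6F) (p₇ : r₇ ≡ ñ 2F 7F) (p₈ : r₈ ≡ ñ 2F 8F) (p₉ : r₉ ≡ ñ 2F 9F)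
           (inv : κ * (4 * (r₈ + ν * r₉)) ModJ.≈ 1) where
    open ModJ
    open +-*-Solver

    K base : ℕ
    base = constant (rowOf 2F) C.triple e (mkC r₂ r₃ r₄ r₅ r₆ r₇ r₈ r₉ κ′) u
    K = base + (modJ (4 * (num (c 4F 4F) * r₄ + num (m 4F 4F ⊖ c 4F 4F) * r₅)) + modJ (4 * (num (c 4F 6F) * r₆ + num (m 4F 6F ⊖ c 4F 6F) * r₇)))

    y : ℕ
    y = num (c 4F 8F)

    exact : ℕ
    exact = N 4F 0F * Ñ 2F 0F + N 4F 1F * Ñ 2F 1F + 4 * (n 4F 2F * ñ 2F 2F + n 4F 3F * ñ 2F 3F + (n 4F 8F + n 4F 9F) * ñ 2F 9F)
      + (4 * (n 4F 4F * ñ 2F 4F + n 4F 5F * ñ 2F 5F) + 4 * (n 4F 6F * ñ 2F 6F + n 4F 7F * ñ 2F 7F))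

    K≈ : K ≈ exact
    K≈ = +-cong (≈-trans (%≈ _) (≡⇒≈ eq)) (+-cong (≈-trans (%≈ _) (≡⇒≈ eq₄)) (≈-trans (%≈ _) (≡⇒≈ eq₆)))
      where
      eq : _ ≡ N 4F 0F * Ñ 2F 0F + N 4F 1F * Ñ 2F 1F + 4 * (n 4F 2F * ñ 2F 2F + n 4F 3F * ñ 2F 3F + (n 4F 8F + n 4F 9F) * ñ 2F 9F)
      eq = cong₂ _+_ (cong₂ _+_ (cong₂ _*_ (Ñ′ 0F 4F) (e₀₁₂ {2F} refl 0F refl)) (cong₂ _*_ (Ñ′ 1F 4F) (e₀₁₂ {2F} refl 1F refl)))
        (cong (4 *_) (cong₂ _+_ (cong₂ _+_ (cong₂ _*_ (cong num e₂) p₂) (cong₂ _*_ (cong num e₃) p₃)) (cong₂ _*_ (N≡ 4F 8F) p₉)))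
      eq₄ : _ ≡ 4 * (n 4F 4F * ñ 2F 4F + n 4F 5F * ñ 2F 5F)
      eq₄ = cong (4 *_) (cong₂ _+_ (cong (n 4F 4F *_) p₄) (cong₂ _*_ (cong num (m⊖c 4F 4F)) p₅))
      eq₆ : _ ≡ 4 * (n 4F 6F * ñ 2F 6F + n 4F 7F * ñ 2F 7F)
      eq₆ = cong (4 *_) (cong₂ _+_ (cong (n 4F 6F *_) p₆) (cong₂ _*_ (cong num (m⊖c 4F 6F)) p₇))

    equation : 4 * (r₈ + ν * r₉) * y + K ≈ 0
    equation =
      4 * (r₈ + ν * r₉) * y + K
        ≈⟨ +-cong (≡⇒≈ (cong₂ (λ a b → 4 * (a + ν * b) * y) p₈ p₉)) K≈ ⟩
      -- Only the sum of the entries in the columns 8 and 9 is known, which eliminates column 9: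
      -- `exact` contains the product y * ñ 2F 9F in excess, and the `ν` term cancels it.
      4 * (ñ 2F 8F + ν * ñ 2F 9F) * y + exact
        ≡⟨ ring ν (N 4F 0F * Ñ 2F 0F) (N 4F 1F * Ñ 2F 1F) (n 4F 2F * ñ 2F 2F) (n 4F 3F * ñ 2F 3F) (n 4F 4F * ñ 2F 4F) (n 4F 5F * ñ 2F 5F)
             (n 4F 6F * ñ 2F 6F) (n 4F 7F * ñ 2F 7F) (n 4F 8F) (ñ 2F 8F) (n 4F 9F) (ñ 2F 9F) ⟩≈
      (N 4F 0F * Ñ 2F 0F + N 4F 1F * Ñ 2F 1F + 4 * Q (c 4F) (c 2F)) + (4 * (y * ñ 2F 9F) + ν * (4 * (y * ñ 2F 9F)))
        ≈⟨ +-cong (≈-trans (≡⇒≈ (4P 4F 2F)) (≈-trans (M⇒J (4P-diff 4F 2F (λ ()))) (multiple≈0 32))) (ν-negates _) ⟩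
      0 ∎≈
      where
      ring = solve 13 (λ ν a b c d e f g h i i′ j j′ →
        con 4 :* (i′ :+ ν :* j′) :* i :+ (a :+ b :+ con 4 :* (c :+ d :+ (i :+ j) :* j′) :+ (con 4 :* (e :+ f) :+ con 4 :* (g :+ h))) :=
        (a :+ b :+ con 4 :* (c :+ d :+ (e :+ g :+ i :* i′) :+ (f :+ h :+ j :* j′))) :+ (con 4 :* (i :* j′) :+ ν :* (con 4 :* (i :* j′)))) refl

    solved : modJ y ≡ modJ (modJ (ν * κ) * K)
    solved = ≈⇒% (
      y                              ≡⟨ sym (+-identityʳ y) ⟩≈
      1 * y                          ≈⟨ *-cong (≈-sym inv) (≈-refl {y}) ⟩
      κ * (4 * (r₈ + ν * r₉)) * y    ≡⟨ *-assoc κ _ y ⟩≈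
      κ * (4 * (r₈ + ν * r₉) * y)    ≈⟨ *-congˡ κ (negate _ equation) ⟩
      κ * (ν * K)                    ≡⟨ trans (sym (*-assoc κ ν K)) (cong (_* K) (*-comm κ ν)) ⟩≈
      ν * κ * K                      ≈⟨ *-cong (≈-sym (%≈ (ν * κ))) (≈-refl {K}) ⟩
      modJ (ν * κ) * K               ∎≈)

  module _ (leaf : Leaf)
           (lead₃ : T (lead3 (R.t 2F 2F) (tr3 (c 2F 2F))))
           (lead₇ : T (lead7 (R.m 2F 4F) (c 2F 4F)))
           (lead₇′ : T (lead7 (C.m 2F 4F) (transp c 2F 4F))) where

    result : (V7 → V7 → V7 → V7 → Bool)
    result = leaf R.triple C.triple u (c 2F 2F) (c 2F 4F)

    coefs : Coeffs
    coefs = row2Coeffs (rowOf 2F) (c 2F 2F) (c 2F 4F)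

    residues : List Tagged
    residues = map residue (bits (m 4F 8F))

    liftRow2-sound : T (liftRow2 result (rowOf 2F) C.triple u (row2Lifts (C.rowOf 2F) (rev (c 2F 2F))) residues coefs) →
      T (result e (c 4F 4F) (c 4F 6F) (c 4F 8F))
    liftRow2-sound H = ⟹-elim {row4Lift C.triple e u (c 4F 4F) (c 4F 6F) (c 4F 8F)} picked row4Lift-true
      where
      r₈ r₉ κ : ℕ
      r₈ = num (rev (θ (θ (c 2F 4F))))
      r₉ = num (rev (θ (θ (m 2F 4F ⊖ c 2F 4F))))
      κ = invJ (modJ (4 * (r₈ + ν * r₉)))
      num-rev : ∀ {v w} → v ≡ w → num (rev v) ≡ num (rev w)
      num-rev = cong (λ v → num (rev v))
      split = ∧-elim {modJ (κ * (4 * (r₈ + ν * r₉))) ≡ᵇ 1} H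
      e∈ : e ∈ row2Lifts (C.rowOf 2F) (rev (c 2F 2F))
      e∈ = CL.row2Lifts-∈ lead₇′
      xs ys : List Tagged
      xs = map (term (num (rev (c 2F 4F))) (num (rev (m 2F 4F ⊖ c 2F 4F))) (m 4F 4F)) (bits (m 4F 4F))
      ys = map (term (num (rev (θ (c 2F 4F)))) (num (rev (θ (m 2F 4F ⊖ c 2F 4F)))) (m 4F 6F)) (bits (m 4F 6F))
      leaf′ : V7 → V7 → V7 → Bool
      leaf′ x y z = row4Lift C.triple e u x y z ⟹ result e x y z
      b₀ : ℕ
      b₀ = constant (rowOf 2F) C.triple e coefs u
      atE : T (all (λ x → all (combineTerms leaf′ (modJ (ν * κ)) b₀ residues x) ys) xs)
      atE = all-∈ {p = liftRow4 result (rowOf 2F) C.triple u (modJ (ν * κ)) coefs xs ys residues} (proj₂ split) e∈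
      X Y : Tagged
      X = term (num (rev (c 2F 4F))) (num (rev (m 2F 4F ⊖ c 2F 4F))) (m 4F 4F) (c 4F 4F)
      Y = term (num (rev (θ (c 2F 4F)))) (num (rev (θ (m 2F 4F ⊖ c 2F 4F)))) (m 4F 6F) (c 4F 6F)
      atX : T (all (combineTerms leaf′ (modJ (ν * κ)) b₀ residues X) ys)
      atX = all-∈ {p = λ x → all (combineTerms leaf′ (modJ (ν * κ)) b₀ residues x) ys} atE (∈-map⁺ (term (num (rev (c 2F 4F))) (num (rev (m 2F 4F ⊖ c 2F 4F))) (m 4F 4F)) (bits-∈ (isBit 4F 4F) (isBit 4F 5F)))
      atY : T (combineTerms leaf′ (modJ (ν * κ)) b₀ residues X Y)
      atY = all-∈ {p = combineTerms leaf′ (modJ (ν * κ)) b₀ residues X} atX (∈-map⁺ (term (num (rev (θ (c 2F 4F)))) (num (rev (θ (m 2F 4F ⊖ c 2F 4F)))) (m 4F 6F)) (bits-∈ (isBit 4F 6F) (isBit 4F 7F)))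
      total : ℕ
      total = b₀ + (modJ (4 * (num (c 4F 4F) * num (rev (c 2F 4F)) + num (m 4F 4F ⊖ c 4F 4F) * num (rev (m 2F 4F ⊖ c 2F 4F))))
              + modJ (4 * (num (c 4F 6F) * num (rev (θ (c 2F 4F))) + num (m 4F 6F ⊖ c 4F 6F) * num (rev (θ (m 2F 4F ⊖ c 2F 4F))))))
      eq : modJ (num (c 4F 8F)) ≡ modJ (modJ (ν * κ) * total)
      eq = solved (num (rev (c 2F 2F))) (num (rev (cell (t 2F 2F) ⊖ c 2F 2F))) (num (rev (c 2F 4F))) (num (rev (m 2F 4F ⊖ c 2F 4F)))
                  (num (rev (θ (c 2F 4F)))) (num (rev (θ (m 2F 4F ⊖ c 2F 4F)))) r₈ r₉ κ κ
                  refl (num-rev RL.c₃≡) refl (num-rev RL.c₅≡) (num-rev (c-σ refl 4F)) (num-rev RL.c₇≡) (num-rev (c-σσ refl 4F)) (num-rev RL.c₉≡)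
                  (%J-sound (proj₁ split))
      picked : T (leaf′ (c 4F 4F) (c 4F 6F) (c 4F 8F))
      picked = ⟹-elim {modJ (num (c 4F 8F)) ≡ᵇ modJ (modJ (ν * κ) * total)}
        (all-∈ {p = pick (leaf′ (c 4F 4F) (c 4F 6F)) (modJ (modJ (ν * κ) * total))}
          (⟹-elim {modJ (modJ (ν * κ) * total) % 14 <ᵇ 2} atY (subst (λ r → T (r % 14 <ᵇ 2)) eq (num-%14 (isBit 4F 8F))))
          (∈-map⁺ residue (bits-∈ (isBit 4F 8F) (isBit 4F 9F))))
        (≡⇒T eq)

    lift-sound : T (lift leaf R.triple C.triple u) → T (result e (c 4F 4F) (c 4F 6F) (c 4F 8F))
    lift-sound H = liftRow2-sound
      (all-∈ {p = λ c₄ → liftRow2 (leaf R.triple C.triple u (c 2F 2F) c₄) (rowOf 2F) C.triple u (row2Lifts (C.rowOf 2F) (rev (c 2F 2F))) residues (row2Coeffs (rowOf 2F) (c 2F 2F) c₄)}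
        at22 (RL.row2Lifts-∈ lead₇))
      where
      cell22 : cell (tr3 (c 2F 2F)) ≡ c 2F 2F
      cell22 = cell-tr3 (c 2F 2F) (c-σ refl 2F)
      at22 : T (lift22 leaf R.triple C.triple u residues (c 2F 2F))
      at22 = subst (λ v → T (lift22 leaf R.triple C.triple u residues v)) cell22
        (all-∈ {p = λ a → lift22 leaf R.triple C.triple u residues (cell a)} H
          (∈-filter (lead3 (t 2F 2F)) (bits3-∈ (isBit 2F 2F) (isBit 2F 3F)) lead₃))

  x10-≡ : ∀ {A : Set} {a b c d e f g h i j a′ b′ c′ d′ e′ f′ g′ h′ i′ j′ : A} →
    a ≡ a′ → b ≡ b′ → c ≡ c′ → d ≡ d′ → e ≡ e′ → f ≡ f′ → g ≡ g′ → h ≡ h′ → i ≡ i′ → j ≡ j′ →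
    x10 a b c d e f g h i j ≡ x10 a′ b′ c′ d′ e′ f′ g′ h′ i′ j′
  x10-≡ refl refl refl refl refl refl refl refl refl refl = refl

  rowX : Fin 10 → X10 V7
  rowX i = x10 (c i 0F) (c i 1F) (c i 2F) (c i 3F) (c i 4F) (c i 5F) (c i 6F) (c i 7F) (c i 8F) (c i 9F)

  ζrow-X : ∀ i → ζrow (rowX i) ≡ rowX (ζ i)
  ζrow-X i = x10-≡ (k 0F) (k 1F) (k 2F) (k 3F) (k 4F) (k 5F) (k 6F) (k 7F) (k 8F) (k 9F)
    where
    k : ∀ j → c i (ζ j) ≡ c (ζ i) j
    k j = sym (c-ζ i j)

  σrow-X : ∀ i → σrow (rowX i) ≡ rowX (σ i)
  σrow-X i = x10-≡ (k 0F) (k 1F) (k 2F) (k 3F) (k 8F) (k 9F) (k 4F) (k 5F) (k 6F) (k 7F)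
    where
    k : ∀ j → θ (c i j) ≡ c (σ i) (σ j)
    k j = sym (σ-inv i j)

  halve-m : ∀ i j → c i (ζ j) ≡ c i j → halve (m i j) ≡ c i j
  halve-m i j p = trans (cong (λ v → halve (c i j ⊕ v)) p) (halve-double (c i j))

  halve-cell : ∀ {i} → σ i ≡ i → ∀ j → σ j ≡ j → c i (ζ j) ≡ c i j → halve (cell (t i j)) ≡ c i j
  halve-cell fix j p q = trans (cong halve (cell-t fix j p)) (halve-m _ j q)

  row01-X : ∀ {i} → σ i ≡ i → ζ i ≡ i → row01 (rowOf i) ≡ rowX i
  row01-X {i} fix fixζ = x10-≡ (halve-cell fix 0F refl (z 0F)) (halve-cell fix 1F refl (z 1F)) c₂ (trans c₂ (sym (z 2F))) c₄ (trans c₄ (sym (z 4F)))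
      c₆ (trans c₆ (sym (z 6F))) c₈ (trans c₈ (sym (z 8F)))
    where
    z : ∀ j → c i (ζ j) ≡ c i j
    z = row-ζ i fixζ
    c₂ = halve-cell fix 2F refl (z 2F)
    c₄ = halve-m i 4F (z 4F)
    c₆ = trans (cong θ c₄) (c-σ fix 4F)
    c₈ = trans (cong θ c₆) (c-σ fix 6F)

  L : Mat
  L = build R.triple C.triple u (c 2F 2F) (c 2F 4F) e (c 4F 4F) (c 4F 6F) (c 4F 8F)

  L≡ : L ≡ x10 (rowX 0F) (rowX 1F) (rowX 2F) (rowX 3F) (rowX 4F) (rowX 5F) (rowX 6F) (rowX 7F) (rowX 8F) (rowX 9F)
  L≡ = trans (fill-cong (row01-X refl refl) (row01-X refl refl) r₂ r₄)
      (x10-≡ refl refl refl (ζrow-X 2F) refl (ζrow-X 4F) (σrow-X 4F) (trans (cong ζrow (σrow-X 4F)) (ζrow-X 6F))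
        s₈ (trans (cong ζrow s₈) (ζrow-X 8F)))
    where
    fill-cong : ∀ {a b c d a′ b′ c′ d′} → a ≡ a′ → b ≡ b′ → c ≡ c′ → d ≡ d′ → fill a b c d ≡ fill a′ b′ c′ d′
    fill-cong refl refl refl refl = refl
    s₈ : σrow (σrow (rowX 4F)) ≡ rowX 8F
    s₈ = trans (cong σrow (σrow-X 4F)) (σrow-X 6F)
    r₂ = x10-≡ (halve-cell refl 0F refl refl) (halve-cell refl 1F refl refl) refl RL.c₃≡ refl RL.c₅≡ (c-σ refl 4F) RL.c₇≡ (c-σσ refl 4F) RL.c₉≡
    r₄ = x10-≡ (trans (cong halve (rev-m′ 0F 4F)) (halve-m 4F 0F refl)) (trans (cong halve (rev-m′ 1F 4F)) (halve-m 4F 1F refl))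
               e₂ e₃ refl (m⊖c 4F 4F) refl (m⊖c 4F 6F) refl (m⊖c 4F 8F)

  rowX-! : ∀ i j → rowX i ! j ≡ c i j
  rowX-! i 0F = refl
  rowX-! i 1F = refl
  rowX-! i 2F = refl
  rowX-! i 3F = refl
  rowX-! i 4F = refl
  rowX-! i 5F = refl
  rowX-! i 6F = refl
  rowX-! i 7F = refl
  rowX-! i 8F = refl
  rowX-! i 9F = refl

  L-! : ∀ i j → L ! i ! j ≡ c i j
  L-! i j = trans (cong (λ L → L ! i ! j) L≡) (go i)
    where
    go : ∀ i → x10 (rowX 0F) (rowX 1F) (rowX 2F) (rowX 3F) (rowX 4F) (rowX 5F) (rowX 6F) (rowX 7F) (rowX 8F) (rowX 9F) ! i ! j ≡ c i j
    go 0F = rowX-! 0F j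
    go 1F = rowX-! 1F j
    go 2F = rowX-! 2F j
    go 3F = rowX-! 3F j
    go 4F = rowX-! 4F j
    go 5F = rowX-! 5F j
    go 6F = rowX-! 6F j
    go 7F = rowX-! 7F j
    go 8F = rowX-! 8F j
    go 9F = rowX-! 9F j

-- Designs from circulant blocks and their affine isomorphisms.

module Mod7 = Congruence 7

≡true⇒T : ∀ {b} → b ≡ true → T b
≡true⇒T = Equivalence.from T-≡

-- Turns an evaluation by `refl` into a universal statement; the finite facts about tables and the
-- group are obtained in this way.
forall-Fin : ∀ {n} (p : Fin n → Bool) → all p (allFin n) ≡ true → ∀ i → T (p i)
forall-Fin p h i = all-∈ {p = p} (≡true⇒T h) (∈-allFin i)

≟-sound : ∀ {n} {i j : Fin n} → T ⌊ i ≟ j ⌋ → i ≡ j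
≟-sound {i = i} {j} = toWitness {a? = i ≟ j}

≈-mod7 : ∀ {m n} → m Mod7.≈ n → m mod 7 ≡ n mod 7
≈-mod7 p = toℕ-injective (trans (toℕ-fromℕ< _) (trans (Mod7.≈⇒% p) (sym (toℕ-fromℕ< _))))

mod7≈ : ∀ n → toℕ (n mod 7) Mod7.≈ n
mod7≈ n = Mod7.≈-trans (Mod7.≡⇒≈ (toℕ-fromℕ< (m%n<n n 7))) (Mod7.%≈ n)

toℕ-mod7 : ∀ (a : Fin 7) → toℕ a mod 7 ≡ a
toℕ-mod7 a = toℕ-injective (trans (toℕ-fromℕ< _) (m<n⇒m%n≡m (toℕ<n a)))

at-cong : ∀ v {m n} → m Mod7.≈ n → at v m ≡ at v n
at-cong v p = cong (digit v) (Mod7.≈⇒% p)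

at-rev : ∀ v n → at (rev v) n ≡ at v (6 * n)
at-rev v n = trans (go v (n % 7) (m%n<n n 7)) (at-cong v (Mod7.*-congˡ 6 (Mod7.%≈ n)))
  where
  go : ∀ v r → r < 7 → digit (rev v) r ≡ at v (6 * r)
  go (v7 a b c d e f g) 0 _ = refl
  go (v7 a b c d e f g) 1 _ = refl
  go (v7 a b c d e f g) 2 _ = refl
  go (v7 a b c d e f g) 3 _ = refl
  go (v7 a b c d e f g) 4 _ = refl
  go (v7 a b c d e f g) 5 _ = refl
  go (v7 a b c d e f g) 6 _ = refl
  go _ (suc (suc (suc (suc (suc (suc (suc _))))))) (s≤s (s≤s (s≤s (s≤s (s≤s (s≤s (s≤s ())))))))

Point : Set
Point = Fin 10 × Fin 7

-- Incidence depends on b - a alone, with 6 in place of -1; this is what makes each 7 × 7 block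
-- circulant.
E : Blocks → Point → Point → Bool
E c (i , a) (j , b) = at (c i j) (toℕ b + 6 * toℕ a) ≡ᵇ 1

split : Fin 70 → Point
split x = (toℕ x / 7) mod 10 , toℕ x mod 7

join : Point → Fin 70
join = uncurry combine

split-join : ∀ p → split (join p) ≡ p
split-join (i , a) = cong₂ _,_
  (≟-sound (all-∈ {p = λ a → ⌊ proj₁ (split (combine i a)) ≟ i ⌋} (forall-Fin (λ i → all (λ a → ⌊ proj₁ (split (combine i a)) ≟ i ⌋) (allFin 7)) refl i) (∈-allFin a)))
  (≟-sound (all-∈ {p = λ a → ⌊ proj₂ (split (combine i a)) ≟ a ⌋} (forall-Fin (λ i → all (λ a → ⌊ proj₂ (split (combine i a)) ≟ a ⌋) (allFin 7)) refl i) (∈-allFin a)))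

join-split : ∀ x → join (split x) ≡ x
join-split x = ≟-sound (forall-Fin (λ x → ⌊ join (split x) ≟ x ⌋) refl x)

toD : Blocks → Design
toD c p q = E c (split p) (split q)

toD-transp : ∀ c p q → toD (transp c) p q ≡ dual (toD c) p q
toD-transp c p q = cong (_≡ᵇ 1) (trans (at-rev (c j i) (b + 6 * a)) (at-cong (c j i) (
    6 * (b + 6 * a)        ≡⟨ solve 2 (λ a b → con 6 :* (b :+ con 6 :* a) := (a :+ con 6 :* b) :+ con 5 :* a :* con 7) refl a b ⟩≈
    a + 6 * b + 5 * a * 7  ≈⟨ +-congˡ (a + 6 * b) (multiple≈0 (5 * a)) ⟩
    a + 6 * b + 0          ≡⟨ +-identityʳ (a + 6 * b) ⟩≈
    a + 6 * b              ∎≈)))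
  where
  open Mod7
  open +-*-Solver
  i = proj₁ (split p)
  j = proj₁ (split q)
  a = toℕ (proj₂ (split p))
  b = toℕ (proj₂ (split q))

record Affine : Set where
  field
    π π⁻  : Fin 10 → Fin 10
    u u⁻  : ℕ
    o     : Fin 10 → ℕ

  forward backward : Point → Point
  forward  (i , a) = π i , (u * toℕ a + o i) mod 7
  backward (i , a) = π⁻ i , (u⁻ * (toℕ a + 6 * o (π⁻ i))) mod 7

  record Valid : Set where
    field
      left  : ∀ i → π⁻ (π i) ≡ i
      right : ∀ i → π (π⁻ i) ≡ i
      unit  : u * u⁻ % 7 ≡ 1

  module _ (valid : Valid) where
    open Valid valid
    open Mod7
    open +-*-Solver

    u⁻u : u⁻ * u ≈ 1
    u⁻u = ≈-trans (≡⇒≈ (*-comm u⁻ u)) (%⇒≈ unit)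

    back-forth : ∀ p → backward (forward p) ≡ p
    back-forth (i , a) = cong₂ _,_ (left i) (trans (cong (λ k → (u⁻ * (toℕ ((u * toℕ a + o i) mod 7) + 6 * o k)) mod 7) (left i))
      (trans (≈-mod7 (
        u⁻ * (toℕ ((u * toℕ a + o i) mod 7) + 6 * o i)
          ≈⟨ *-congˡ u⁻ (+-cong (mod7≈ (u * toℕ a + o i)) (≈-refl {6 * o i})) ⟩
        u⁻ * (u * toℕ a + o i + 6 * o i)
          ≡⟨ solve 4 (λ v u a o → v :* (u :* a :+ o :+ con 6 :* o) := v :* u :* a :+ v :* o :* con 7) refl u⁻ u (toℕ a) (o i) ⟩≈
        u⁻ * u * toℕ a + u⁻ * o i * 7
          ≈⟨ +-cong (*-cong u⁻u (≈-refl {toℕ a})) (multiple≈0 (u⁻ * o i)) ⟩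
        1 * toℕ a + 0
          ≡⟨ solve 1 (λ a → con 1 :* a :+ con 0 := a) refl (toℕ a) ⟩≈
        toℕ a ∎≈)) (toℕ-mod7 a)))

    forth-back : ∀ p → forward (backward p) ≡ p
    forth-back (i , a) = cong₂ _,_ (right i) (trans (≈-mod7 (
        u * toℕ ((u⁻ * (toℕ a + 6 * o k)) mod 7) + o k
          ≈⟨ +-cong (*-congˡ u (mod7≈ (u⁻ * (toℕ a + 6 * o k)))) (≈-refl {o k}) ⟩
        u * (u⁻ * (toℕ a + 6 * o k)) + o k
          ≡⟨ solve 4 (λ v u a o → u :* (v :* (a :+ con 6 :* o)) :+ o := v :* u :* (a :+ con 6 :* o) :+ o) refl u⁻ u (toℕ a) (o k) ⟩≈
        u⁻ * u * (toℕ a + 6 * o k) + o k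
          ≈⟨ +-cong (*-cong u⁻u (≈-refl {toℕ a + 6 * o k})) (≈-refl {o k}) ⟩
        1 * (toℕ a + 6 * o k) + o k
          ≡⟨ solve 2 (λ a o → con 1 :* (a :+ con 6 :* o) :+ o := a :+ o :* con 7) refl (toℕ a) (o k) ⟩≈
        toℕ a + o k * 7
          ≈⟨ +-congˡ (toℕ a) (multiple≈0 (o k)) ⟩
        toℕ a + 0
          ≡⟨ +-identityʳ (toℕ a) ⟩≈
        toℕ a ∎≈)) (toℕ-mod7 a))
      where k = π⁻ i

    perm : Permutation′ 70
    perm = permutation (join ∘ forward ∘ split) (join ∘ backward ∘ split)
      (λ x → trans (cong (join ∘ forward) (split-join _)) (trans (cong join (forth-back (split x))) (join-split x)))
      (λ x → trans (cong (join ∘ backward) (split-join _)) (trans (cong join (back-forth (split x))) (join-split x)))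

open Affine using (forward; perm)

residues7 : List ℕ
residues7 = 0 ∷ 1 ∷ 2 ∷ 3 ∷ 4 ∷ 5 ∷ 6 ∷ []

residues7-∈ : ∀ {x} → x < 7 → x ∈ residues7
residues7-∈ {0} _ = here refl
residues7-∈ {1} _ = there (here refl)
residues7-∈ {2} _ = there (there (here refl))
residues7-∈ {3} _ = there (there (there (here refl)))
residues7-∈ {4} _ = there (there (there (there (here refl))))
residues7-∈ {5} _ = there (there (there (there (there (here refl)))))
residues7-∈ {6} _ = there (there (there (there (there (there (here refl))))))
residues7-∈ {suc (suc (suc (suc (suc (suc (suc _))))))} (s≤s (s≤s (s≤s (s≤s (s≤s (s≤s (s≤s ())))))))

affine-at-sound : ∀ {u v w o} → T (affine-at u v w o) → ∀ n → at v (u * n + o) ≡ at w n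
affine-at-sound {u} {v} {w} {o} h n =
  trans (at-cong v (+-cong (*-congˡ u (≈-sym (%≈ n))) (≈-refl {o})))
    (trans (≡ᵇ-sound (all-∈ {p = λ x → at v (u * x + o) ≡ᵇ at w x} {xs = residues7} h (residues7-∈ (m%n<n n 7)))) (at-cong w (%≈ n)))
  where open Mod7

module _ (α β : Affine) where
  private
    module α = Affine α
    module β = Affine β

  -- With a common multiplier the difference of coordinates x becomes u x + (o′ j - o i), so the
  -- seven values tested by `affine-at` settle a whole 7 × 7 block.
  E-affine : ∀ c d → α.u ≡ β.u →
    (∀ i j → T (affine-at α.u (d (α.π i) (β.π j)) (c i j) (β.o j + 6 * α.o i))) →
    ∀ p q → E d (α.forward p) (β.forward q) ≡ E c p q
  E-affine c d u≡ h (i , a) (j , b) = cong (_≡ᵇ 1) (trans (at-cong v (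
      toℕ ((β.u * toℕ b + β.o j) mod 7) + 6 * toℕ ((α.u * toℕ a + α.o i) mod 7)
        ≈⟨ +-cong (≈-trans (mod7≈ _) (≡⇒≈ (cong (λ u → u * toℕ b + β.o j) (sym u≡)))) (*-congˡ 6 (mod7≈ (α.u * toℕ a + α.o i))) ⟩
      α.u * toℕ b + β.o j + 6 * (α.u * toℕ a + α.o i)
        ≡⟨ solve 5 (λ u a b o o′ → u :* b :+ o′ :+ con 6 :* (u :* a :+ o) := u :* (b :+ con 6 :* a) :+ (o′ :+ con 6 :* o)) refl α.u (toℕ a) (toℕ b) (α.o i) (β.o j) ⟩≈
      α.u * (toℕ b + 6 * toℕ a) + (β.o j + 6 * α.o i) ∎≈))
    (affine-at-sound {α.u} {v} {c i j} (h i j) (toℕ b + 6 * toℕ a)))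
    where
    open Mod7
    open +-*-Solver
    v : V7
    v = d (α.π i) (β.π j)

  toD-affine : ∀ c d → (vα : α.Valid) (vβ : β.Valid) → α.u ≡ β.u →
    (∀ i j → T (affine-at α.u (d (α.π i) (β.π j)) (c i j) (β.o j + 6 * α.o i))) →
    ∀ p q → toD d (perm α vα ⟨$⟩ʳ p) (perm β vβ ⟨$⟩ʳ q) ≡ toD c p q
  toD-affine c d vα vβ u≡ h p q =
    trans (cong₂ (E d) (split-join (α.forward (split p))) (split-join (β.forward (split q))))
          (E-affine c d u≡ h (split p) (split q))

-- The default 0 is harmless, as `validAff` tests that the result inverts π on both sides.
search : X10 ℕ → Fin 10 → Fin 10
search π k = foldr (λ i r → if ⌊ index (π ! i) ≟ k ⌋ then i else r) 0F (allFin 10)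

affineOf : ℕ → X10 ℕ → X10 ℕ → Affine
-- u⁵ inverts u modulo 7 by Fermat's theorem.
affineOf u π o = record { π = λ i → index (π ! i) ; π⁻ = search π ; u = u ; u⁻ = u ^ 5 ; o = o !_ }

validAff : ℕ → X10 ℕ → Bool
validAff u π = all (λ i → ⌊ search π (index (π ! i)) ≟ i ⌋) (allFin 10) ∧ all (λ i → ⌊ index (π ! search π i) ≟ i ⌋) (allFin 10) ∧ (u * u ^ 5 % 7 ≡ᵇ 1)

validAff-sound : ∀ u π o → T (validAff u π) → Affine.Valid (affineOf u π o)
validAff-sound u π o h = record
  { left  = λ i → ≟-sound (all-∈ {p = λ i → ⌊ search π (index (π ! i)) ≟ i ⌋} (proj₁ h₁) (∈-allFin i))
  ; right = λ i → ≟-sound (all-∈ {p = λ i → ⌊ index (π ! search π i) ≟ i ⌋} (proj₁ h₂) (∈-allFin i))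
  ; unit  = ≡ᵇ-sound (proj₂ h₂) }
  where
  h₁ = ∧-elim {all (λ i → ⌊ search π (index (π ! i)) ≟ i ⌋) (allFin 10)} h
  h₂ = ∧-elim {all (λ i → ⌊ index (π ! search π i) ≟ i ⌋) (allFin 10)} (proj₂ h₁)

validCert : Cert → Bool
validCert (cert k _ u π _ π′ _) = (k <ᵇ 9) ∧ validAff u π ∧ validAff u π′

certs-valid : all validCert certs ≡ true
certs-valid = refl

Ds : Fin 9 → Design
Ds k = toD (table (toℕ k))

≅-pointwise : ∀ {D D₁ D₂} → (∀ p q → D₁ p q ≡ D₂ p q) → D ≅ D₁ → D ≅ D₂
≅-pointwise eq (σ , τ , iso) = σ , τ , λ p b → trans (sym (eq _ _)) (iso p b)

≅-trans : ∀ {D₁ D₂ D₃} → D₁ ≅ D₂ → D₂ ≅ D₃ → D₁ ≅ D₃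
≅-trans (σ , τ , iso) (σ′ , τ′ , iso′) = σ ∘ₚ σ′ , τ ∘ₚ τ′ , λ p b → trans (iso′ _ _) (iso p b)

affine-≅ : ∀ {ct c} → T (validCert ct) → (L : Mat) → (∀ i j → L ! i ! j ≡ c i j) → T (matches L ct) →
  ∃ λ k → ∃ λ dual → toD c ≅ toD (variant dual (toℕ {9} k))
affine-≅ {cert k d u π o π′ o′} {c} valid L L≡ h = fromℕ< k<9 , d ,
  subst (λ k → toD c ≅ toD (variant d k)) (sym (toℕ-fromℕ< k<9))
    (perm α vα , perm β vβ , toD-affine α β c (variant d k) vα vβ refl λ i j →
      subst (λ w → T (affine-at u (variant d k (index (π ! i)) (index (π′ ! j))) w (o′ ! j + 6 * (o ! i)))) (L≡ i j)
        (all-∈ {p = λ j → affine-at u (variant d k (index (π ! i)) (index (π′ ! j))) (L ! i ! j) (o′ ! j + 6 * (o ! i))}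
          (all-∈ {p = λ i → all (λ j → affine-at u (variant d k (index (π ! i)) (index (π′ ! j))) (L ! i ! j) (o′ ! j + 6 * (o ! i))) (allFin 10)} h (∈-allFin i))
          (∈-allFin j)))
  where
  v = ∧-elim {k <ᵇ 9} valid
  v₂ = ∧-elim {validAff u π} (proj₂ v)
  k<9 : k < 9
  k<9 = <ᵇ⇒< k 9 (proj₁ v)
  α = affineOf u π o
  β = affineOf u π′ o′
  vα = validAff-sound u π o (proj₁ v₂)
  vβ = validAff-sound u π′ o′ (proj₂ v₂)

known-≅ : ∀ {c} L → (∀ i j → L ! i ! j ≡ c i j) → T (known L) →
  ∃ λ k → ∃ λ dual → toD c ≅ toD (variant dual (toℕ {9} k))
known-≅ L L≡ h with ct , ct∈ , m ← find (any⁻ (matches L) certs h) =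
  affine-≅ {ct} (all-∈ {p = validCert} (≡true⇒T certs-valid) ct∈) L L≡ m

-- Finite sums, pigeonhole and the dual design.

-- The leftover `zs` is retained because the pigeonhole arguments ask whether it is empty.
unique-⊆ : ∀ {A : Set} {xs ys : List A} → Unique xs → (∀ {x} → x ∈ xs → x ∈ ys) → ∃ λ zs → ys ↭ xs ++ zs
unique-⊆ {ys = ys} [] _ = ys , ↭-refl
unique-⊆ {xs = x ∷ xs} {ys} (x∉ ∷ u) sub with ys₁ , ys₂ , refl ← ∈-∃++ (sub (here refl)) =
  proj₁ rec , ↭-trans (↭-shift x ys₁ ys₂) (prep x (proj₂ rec))
  where
  sub′ : ∀ {z} → z ∈ xs → z ∈ ys₁ ++ ys₂
  sub′ {z} z∈ with ∈-resp-↭ (↭-shift x ys₁ ys₂) (sub (there z∈))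
  ... | here refl = ⊥-elim (All.lookup x∉ z∈ refl)
  ... | there z∈′ = z∈′
  rec = unique-⊆ u sub′

unique-length : ∀ {A : Set} {xs ys : List A} → Unique xs → (∀ {x} → x ∈ xs → x ∈ ys) → length xs ≤ length ys
unique-length {xs = xs} u sub with zs , p ← unique-⊆ u sub =
  ≤-trans (m≤m+n (length xs) (length zs)) (≤-reflexive (trans (sym (length-++ xs)) (sym (↭-length p))))

cover-↭ : ∀ {n} (L : List (Fin n)) → length L ≡ n → (∀ y → y ∈ L) → L ↭ allFin n
cover-↭ {n} L len cov with unique-⊆ (allFin⁺ n) (λ {x} _ → cov x)
... | [] , p = ↭-trans p (subst (_↭ allFin n) (sym (++-[] (allFin n))) ↭-refl)
  where
  ++-[] : ∀ {A : Set} (xs : List A) → xs ++ [] ≡ xs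
  ++-[] [] = refl
  ++-[] (x ∷ xs) = cong (x ∷_) (++-[] xs)
... | z ∷ zs , p = ⊥-elim (m+1+n≢m (length (allFin n))
  (trans (sym (length-++ (allFin n))) (trans (sym (↭-length p)) (trans len (sym (length-tabulate (λ x → x)))))))

Σ⟨_⟩ : ∀ {A : Set} → List A → (A → ℕ) → ℕ
Σ⟨ xs ⟩ f = sum (map f xs)

Σ-cong : ∀ {A : Set} (xs : List A) {f g : A → ℕ} → (∀ x → f x ≡ g x) → Σ⟨ xs ⟩ f ≡ Σ⟨ xs ⟩ g
Σ-cong xs p = cong sum (map-cong p xs)

Σ-↭ : ∀ {A : Set} {xs ys : List A} (f : A → ℕ) → xs ↭ ys → Σ⟨ xs ⟩ f ≡ Σ⟨ ys ⟩ f
Σ-↭ f p = sum-↭ (↭-map⁺ f p)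

Σ-map : ∀ {A C : Set} (g : A → C) (xs : List A) (f : C → ℕ) → Σ⟨ map g xs ⟩ f ≡ Σ⟨ xs ⟩ (f ∘ g)
Σ-map g xs f = cong sum (sym (map-∘ xs))

Σ-+ : ∀ {A : Set} (xs : List A) (f g : A → ℕ) → Σ⟨ xs ⟩ (λ x → f x + g x) ≡ Σ⟨ xs ⟩ f + Σ⟨ xs ⟩ g
Σ-+ [] f g = refl
Σ-+ (x ∷ xs) f g = trans (cong (f x + g x +_) (Σ-+ xs f g))
  (solve 4 (λ a b c d → a :+ b :+ (c :+ d) := a :+ c :+ (b :+ d)) refl (f x) (g x) (Σ⟨ xs ⟩ f) (Σ⟨ xs ⟩ g))
  where open +-*-Solver

Σ-* : ∀ {A : Set} (xs : List A) (k : ℕ) (f : A → ℕ) → Σ⟨ xs ⟩ (λ x → k * f x) ≡ k * Σ⟨ xs ⟩ f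
Σ-* [] k f = sym (*-zeroʳ k)
Σ-* (x ∷ xs) k f = trans (cong (k * f x +_) (Σ-* xs k f)) (sym (*-distribˡ-+ k (f x) (Σ⟨ xs ⟩ f)))

Σ-const : ∀ {A : Set} (xs : List A) (k : ℕ) → Σ⟨ xs ⟩ (λ _ → k) ≡ length xs * k
Σ-const [] k = refl
Σ-const (x ∷ xs) k = cong (k +_) (Σ-const xs k)

Σ-swap : ∀ {A C : Set} (xs : List A) (ys : List C) (f : A → C → ℕ) →
  Σ⟨ xs ⟩ (λ x → Σ⟨ ys ⟩ (f x)) ≡ Σ⟨ ys ⟩ (λ y → Σ⟨ xs ⟩ (λ x → f x y))
Σ-swap [] ys f = sym (trans (Σ-const ys 0) (*-zeroʳ (length ys)))
Σ-swap (x ∷ xs) ys f = trans (cong (Σ⟨ ys ⟩ (f x) +_) (Σ-swap xs ys f)) (sym (Σ-+ ys (f x) (λ y → Σ⟨ xs ⟩ (λ x → f x y))))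

-- The extra k on the left avoids the subtraction in f p + (length - 1) k.
Σ-exception : ∀ {A : Set} {xs : List A} {f : A → ℕ} {k p} → Unique xs → p ∈ xs → (∀ q → p ≢ q → f q ≡ k) →
  Σ⟨ xs ⟩ f + k ≡ f p + length xs * k
Σ-exception {xs = p ∷ xs} {f} {k} (p∉ ∷ _) (here refl) h = begin
  f p + Σ⟨ xs ⟩ f + k           ≡⟨ cong (λ s → f p + s + k) (trans (go xs p∉) (Σ-const xs k)) ⟩
  f p + length xs * k + k       ≡⟨ solve 3 (λ a b c → a :+ b :+ c := a :+ (c :+ b)) refl (f p) (length xs * k) k ⟩
  f p + (k + length xs * k)     ∎
  where
  open ≡-Reasoning
  open +-*-Solver
  go : ∀ ys → All (p ≢_) ys → Σ⟨ ys ⟩ f ≡ Σ⟨ ys ⟩ (λ _ → k)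
  go [] [] = refl
  go (y ∷ ys) (p≢y ∷ r) = cong₂ _+_ (h y p≢y) (go ys r)
Σ-exception {xs = x ∷ xs} {f} {k} {p} (x∉ ∷ u) (there p∈) h = begin
  f x + Σ⟨ xs ⟩ f + k           ≡⟨ +-assoc (f x) _ k ⟩
  f x + (Σ⟨ xs ⟩ f + k)         ≡⟨ cong₂ _+_ (h x λ p≡x → All.lookup x∉ p∈ (sym p≡x)) (Σ-exception u p∈ h) ⟩
  k + (f p + length xs * k)     ≡⟨ solve 3 (λ a b c → a :+ (b :+ c) := b :+ (a :+ c)) refl k (f p) (length xs * k) ⟩
  f p + (k + length xs * k)     ∎
  where
  open ≡-Reasoning
  open +-*-Solver

-- The summand at p already exhausts the sum. The variance argument ends in this form: the squared
-- deviations of all blocks add up to that of the fixed block.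
Σ-zero : ∀ {A : Set} {xs : List A} {f : A → ℕ} {p} → Unique xs → p ∈ xs → Σ⟨ xs ⟩ f ≡ f p → ∀ {q} → q ∈ xs → p ≢ q → f q ≡ 0
Σ-zero {xs = p ∷ xs} {f} (p∉ ∷ _) (here refl) s = λ where
    (here refl) p≢q → ⊥-elim (p≢q refl)
    (there q∈)  _   → go xs (+-cancelˡ-≡ (f p) _ 0 (trans s (sym (+-identityʳ (f p))))) q∈
  where
  go : ∀ ys → Σ⟨ ys ⟩ f ≡ 0 → ∀ {q} → q ∈ ys → f q ≡ 0
  go (y ∷ ys) z (here refl) = m+n≡0⇒m≡0 (f y) z
  go (y ∷ ys) z (there q∈)  = go ys (m+n≡0⇒n≡0 (f y) z) q∈
Σ-zero {xs = x ∷ xs} {f} {p} (x∉ ∷ u) (there p∈) s = λ where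
    (here refl) _   → fx≡0
    (there q∈)  p≢q → Σ-zero u p∈ rest q∈ p≢q
  where
  ge : ∀ {ys p} → p ∈ ys → f p ≤ Σ⟨ ys ⟩ f
  ge (here refl) = m≤m+n _ _
  ge {y ∷ ys} (there r) = ≤-trans (ge r) (m≤n+m (Σ⟨ ys ⟩ f) (f y))
  rest : Σ⟨ xs ⟩ f ≡ f p
  rest = ≤-antisym (≤-trans (m≤n+m _ (f x)) (≤-reflexive s)) (ge p∈)
  fx≡0 : f x ≡ 0
  fx≡0 = +-cancelʳ-≡ (f p) (f x) 0 (trans (cong (f x +_) (sym rest)) s)

ΣF : ∀ {n} → (Fin n → ℕ) → ℕ
ΣF {n} = Σ⟨ allFin n ⟩

Σ-perm : ∀ {n} (σ : Permutation′ n) (f : Fin n → ℕ) → ΣF (λ x → f (σ ⟨$⟩ʳ x)) ≡ ΣF f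
Σ-perm {n} σ f = trans (sym (Σ-map (σ ⟨$⟩ʳ_) (allFin n) f)) (Σ-↭ f (cover-↭ (map (σ ⟨$⟩ʳ_) (allFin n))
  (trans (length-map _ (allFin n)) (length-tabulate (λ x → x)))
  (λ y → subst (_∈ map (σ ⟨$⟩ʳ_) (allFin n)) (inverseʳ σ) (∈-map⁺ (σ ⟨$⟩ʳ_) (∈-allFin (σ ⟨$⟩ˡ y))))))

𝟙 : Bool → ℕ
𝟙 b = if b then 1 else 0

𝟙-∧ : ∀ a b → 𝟙 (a ∧ b) ≡ 𝟙 a * 𝟙 b
𝟙-∧ false b = refl
𝟙-∧ true  b = sym (+-identityʳ (𝟙 b))

count-∧ : ∀ {n} (f g : Fin n → Bool) → count (λ x → f x ∧ g x) ≡ ΣF (λ x → 𝟙 (f x) * 𝟙 (g x))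
count-∧ {n} f g = Σ-cong (allFin n) (λ x → 𝟙-∧ (f x) (g x))

𝟙-idem : ∀ b → 𝟙 b * 𝟙 b ≡ 𝟙 b
𝟙-idem false = refl
𝟙-idem true  = refl

square-distance : ∀ x → x * x + 64 ≡ ∣ x - 8 ∣ * ∣ x - 8 ∣ + 16 * x
square-distance x with ≤-total x 8
... | inj₁ x≤8 = go (8 ∸ x) (m≤n⇒∣m-n∣≡n∸m x≤8) (sym (m+[n∸m]≡n x≤8))
  where
  go : ∀ d → ∣ x - 8 ∣ ≡ d → 8 ≡ x + d → x * x + 64 ≡ ∣ x - 8 ∣ * ∣ x - 8 ∣ + 16 * x
  go d e s rewrite e = trans (cong (λ k → x * x + k * k) s) (trans
    (solve 2 (λ x d → x :* x :+ (x :+ d) :* (x :+ d) := d :* d :+ con 2 :* (x :+ d) :* x) refl x d)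
    (cong (λ k → d * d + 2 * k * x) (sym s)))
    where open +-*-Solver
... | inj₂ 8≤x = go (x ∸ 8) (m≤n⇒∣n-m∣≡n∸m 8≤x) (sym (m+[n∸m]≡n 8≤x))
  where
  go : ∀ d → ∣ x - 8 ∣ ≡ d → x ≡ 8 + d → x * x + 64 ≡ ∣ x - 8 ∣ * ∣ x - 8 ∣ + 16 * x
  go d e refl rewrite e = solve 1 (λ d → (con 8 :+ d) :* (con 8 :+ d) :+ con 64 := d :* d :+ con 16 :* (con 8 :+ d)) refl d
    where open +-*-Solver

-- Counting flags gives 24 blocks on every point.  For a block C the intersection numbers x_B with the
-- other blocks have first two moments forcing Σ (x_B - 8)² = 0, so the dual structure is a design as well.
difference : ∀ s x {y k l} → s + x ≡ y → x ≡ k → y ≡ l → s ≡ l ∸ k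
difference s x p refl refl = trans (sym (m+n∸n≡m s x)) (cong (_∸ x) p)

-- With n a variable, sums over all points stay folded during type checking; 70 enters through an
-- equation.
module Symmetric (n : ℕ) (n≡70 : n ≡ 70) (D : Fin n → Fin n → Bool)
  (blocks : ∀ b → count (λ p → D p b) ≡ 24) (pairs : ∀ p q → p ≢ q → count (λ b → D p b ∧ D q b) ≡ 8) where

  d : Fin n → Fin n → ℕ
  d p b = 𝟙 (D p b)

  blockSize : ∀ b → ΣF (λ p → d p b) ≡ 24
  blockSize = blocks

  meet : Fin n → Fin n → ℕ
  meet p q = ΣF (λ b → d p b * d q b)

  meet-≢ : ∀ p q → p ≢ q → meet p q ≡ 8
  meet-≢ p q p≢q = trans (sym (count-∧ (D p) (D q))) (pairs p q p≢q)

  rowSum : Fin n → ℕ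
  rowSum p = ΣF (d p)

  meet-self : ∀ p → meet p p ≡ rowSum p
  meet-self p = Σ-cong (allFin n) (λ b → 𝟙-idem (D p b))

  points : List (Fin n)
  points = allFin n

  Σ-const-n : ∀ k → Σ⟨ points ⟩ (λ _ → k) ≡ 70 * k
  Σ-const-n k = trans (Σ-const points k) (cong (_* k) (trans (length-tabulate (λ x → x)) n≡70))

  -- Count the pairs of a block b through p and a point q on b in two ways: with r blocks through p,
  -- 24 r = r + 69 · 8, and 69 · 8 = 552.
  rowSum≡24 : ∀ p → rowSum p ≡ 24
  rowSum≡24 p = *-cancelˡ-≡ (rowSum p) 24 23 (+-cancelˡ-≡ (rowSum p) _ _ (begin
    rowSum p + 23 * rowSum p  ≡⟨⟩
    24 * rowSum p             ≡⟨ Σ-* points 24 (d p) ⟨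
    ΣF (λ b → 24 * d p b)     ≡⟨ Σ-cong points (λ b → trans (*-comm 24 (d p b)) (trans (cong (d p b *_) (sym (blockSize b))) (sym (Σ-* points (d p b) (λ q → d q b))))) ⟩
    ΣF (λ b → ΣF (λ q → d p b * d q b)) ≡⟨ Σ-swap points points (λ b q → d p b * d q b) ⟩
    ΣF (meet p)               ≡⟨ +-cancelʳ-≡ 8 _ _ (trans (Σ-exception {f = meet p} (allFin⁺ n) (∈-allFin p) (meet-≢ p))
                                   (trans (cong (λ l → meet p p + l * 8) (trans (length-tabulate (λ x → x)) n≡70))
                                   (trans (cong (_+ 560) (meet-self p)) (sym (+-assoc (rowSum p) 552 8))))) ⟩
    rowSum p + 552            ∎))
    where open ≡-Reasoning

  module _ (B : Fin n) where

    x : Fin n → ℕ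
    x C = ΣF (λ p → d p B * d p C)

    x-self : x B ≡ 24
    x-self = trans (Σ-cong points (λ p → 𝟙-idem (D p B))) (blockSize B)

    sum-x : ΣF x ≡ 576
    sum-x = begin
      ΣF x                                   ≡⟨ Σ-swap points points (λ C p → d p B * d p C) ⟩
      ΣF (λ p → ΣF (λ C → d p B * d p C))    ≡⟨ Σ-cong points (λ p → trans (Σ-* points (d p B) (d p)) (trans (cong (d p B *_) (rowSum≡24 p)) (*-comm (d p B) 24))) ⟩
      ΣF (λ p → 24 * d p B)                  ≡⟨ Σ-* points 24 (λ p → d p B) ⟩
      24 * ΣF (λ p → d p B)                  ≡⟨ cong (24 *_) (blockSize B) ⟩
      576                                    ∎
      where open ≡-Reasoning

    -- For p on B the sum is 24 + 23 · 8 = 208; for p off B both sides vanish.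
    weighted : ∀ p → d p B * ΣF (λ q → d q B * meet p q) ≡ 208 * d p B
    weighted p = go (D p B) refl
      where
      open +-*-Solver
      eq : ΣF (λ q → d q B * meet p q) ≡ 192 + 16 * d p B
      eq = +-cancelʳ-≡ (8 * d p B) _ _ (begin
        ΣF (λ q → d q B * meet p q) + 8 * d p B ≡⟨ exchange (allFin⁺ n) (∈-allFin p) ⟩
        24 * d p B + ΣF (λ q → 8 * d q B)       ≡⟨ cong (24 * d p B +_) (trans (Σ-* points 8 (λ q → d q B)) (cong (8 *_) (blockSize B))) ⟩
        24 * d p B + 192                        ≡⟨ solve 1 (λ x → con 24 :* x :+ con 192 := con 192 :+ con 16 :* x :+ con 8 :* x) refl (d p B) ⟩
        192 + 16 * d p B + 8 * d p B            ∎)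
        where
        open ≡-Reasoning
        others : ∀ ys → All (p ≢_) ys → Σ⟨ ys ⟩ (λ q → d q B * meet p q) ≡ Σ⟨ ys ⟩ (λ q → 8 * d q B)
        others [] [] = refl
        others (y ∷ ys) (p≢y ∷ r) = cong₂ _+_ (trans (cong (d y B *_) (meet-≢ p y p≢y)) (*-comm (d y B) 8)) (others ys r)
        exchange : ∀ {xs} → Unique xs → p ∈ xs → Σ⟨ xs ⟩ (λ q → d q B * meet p q) + 8 * d p B ≡ 24 * d p B + Σ⟨ xs ⟩ (λ q → 8 * d q B)
        exchange {_ ∷ xs} (p∉ ∷ _) (here refl) = trans (cong₂ (λ a b → d p B * a + b + 8 * d p B) (trans (meet-self p) (rowSum≡24 p)) (others xs p∉))
          (solve 2 (λ x s → x :* con 24 :+ s :+ con 8 :* x := con 24 :* x :+ (con 8 :* x :+ s)) refl (d p B) (Σ⟨ xs ⟩ (λ q → 8 * d q B)))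
        exchange {y ∷ xs} (y∉ ∷ u) (there p∈) = trans (cong₂ (λ a b → d y B * a + b + 8 * d p B) (meet-≢ p y (λ p≡y → All.lookup y∉ p∈ (sym p≡y))) refl)
          (trans (solve 3 (λ y s t → y :* con 8 :+ s :+ t := con 8 :* y :+ (s :+ t)) refl (d y B) (Σ⟨ xs ⟩ (λ q → d q B * meet p q)) (8 * d p B))
            (trans (cong (8 * d y B +_) (exchange u p∈))
              (solve 3 (λ y s t → con 8 :* y :+ (s :+ t) := s :+ (con 8 :* y :+ t)) refl (d y B) (24 * d p B) (Σ⟨ xs ⟩ (λ q → 8 * d q B)))))
      go : ∀ b → D p B ≡ b → d p B * ΣF (λ q → d q B * meet p q) ≡ 208 * d p B
      go b e = trans (cong (d p B *_) eq) (trans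
        (solve 1 (λ x → x :* (con 192 :+ con 16 :* x) := con 192 :* x :+ con 16 :* (x :* x)) refl (d p B))
        (trans (cong (λ y → 192 * d p B + 16 * y) (𝟙-idem (D p B))) (solve 1 (λ x → con 192 :* x :+ con 16 :* x := con 208 :* x) refl (d p B))))

    -- The sum of squares counts pairs of points p, q of B together with a block through both: 24
    -- points p with 208 each.
    sum-x² : ΣF (λ C → x C * x C) ≡ 4992
    sum-x² = begin
      ΣF (λ C → x C * x C)
        ≡⟨ Σ-cong points (λ C → trans (sym (Σ-* points (x C) (λ p → d p B * d p C))) (Σ-cong points (λ p → expand C p))) ⟩
      ΣF (λ C → ΣF (λ p → ΣF (λ q → d p B * (d q B * (d p C * d q C)))))
        ≡⟨ Σ-swap points points _ ⟩
      ΣF (λ p → ΣF (λ C → ΣF (λ q → d p B * (d q B * (d p C * d q C)))))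
        ≡⟨ Σ-cong points (λ p → trans (Σ-swap points points _) (collect p)) ⟩
      ΣF (λ p → d p B * ΣF (λ q → d q B * meet p q))
        ≡⟨ Σ-cong points weighted ⟩
      ΣF (λ p → 208 * d p B)
        ≡⟨ trans (Σ-* points 208 (λ p → d p B)) (cong (208 *_) (blockSize B)) ⟩
      4992 ∎
      where
      open ≡-Reasoning
      open +-*-Solver
      expand : ∀ C p → x C * (d p B * d p C) ≡ ΣF (λ q → d p B * (d q B * (d p C * d q C)))
      expand C p = trans (*-comm (x C) _) (trans (sym (Σ-* points (d p B * d p C) (λ q → d q B * d q C)))
        (Σ-cong points (λ q → solve 4 (λ a b c e → a :* b :* (c :* e) := a :* (c :* (b :* e))) refl (d p B) (d p C) (d q B) (d q C))))
      collect : ∀ p → ΣF (λ q → ΣF (λ C → d p B * (d q B * (d p C * d q C)))) ≡ d p B * ΣF (λ q → d q B * meet p q)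
      collect p = trans (Σ-cong points (λ q → trans (Σ-* points (d p B) _) (cong (d p B *_) (Σ-* points (d q B) _)))) (Σ-* points (d p B) _)

    deviation : Fin n → ℕ
    deviation C = ∣ x C - 8 ∣ * ∣ x C - 8 ∣

    -- 4992 + 70 · 64 - 16 · 576 = 256 = (24 - 8)², which is the share of B itself.
    sum-deviation : ΣF deviation ≡ deviation B
    sum-deviation = trans
      (difference (ΣF deviation) (ΣF (λ C → 16 * x C))
        (trans (sym (Σ-+ points deviation (λ C → 16 * x C)))
          (trans (sym (Σ-cong points (λ C → square-distance (x C)))) (Σ-+ points (λ C → x C * x C) (λ _ → 64))))
        (trans (Σ-* points 16 x) (cong (16 *_) sum-x))
        (cong₂ _+_ sum-x² (Σ-const-n 64)))
      (cong (λ y → ∣ y - 8 ∣ * ∣ y - 8 ∣) (sym x-self))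

    x-other : ∀ C → B ≢ C → x C ≡ 8
    x-other C B≢C = ∣m-n∣≡0⇒m≡n (square-zero (Σ-zero {f = deviation} (allFin⁺ n) (∈-allFin B) sum-deviation (∈-allFin C) B≢C))
      where
      square-zero : ∀ {m} → m * m ≡ 0 → m ≡ 0
      square-zero {zero} _ = refl

  columns-meet : ∀ B C → B ≢ C → count (λ p → D p B ∧ D p C) ≡ 8
  columns-meet B C B≢C = trans (count-∧ (λ p → D p B) (λ p → D p C)) (x-other B C B≢C)

dual-symmetric : ∀ D → IsSymmetric-70-24-8 D → IsSymmetric-70-24-8 (dual D)
dual-symmetric D (blocks , pairs) = S.rowSum≡24 , S.columns-meet
  where module S = Symmetric 70 refl D blocks pairs

-- The standard action of Frob₂₁ × ℤ₂ on 70 points.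

open Affine using (forward; perm)

_^^_ : ∀ {A : Set} → (A → A) → ℕ → A → A
(f ^^ zero)  x = x
(f ^^ suc k) x = f ((f ^^ k) x)

moveIndex : Fin 3 → Fin 2 → Fin 10 → Fin 10
moveIndex e c i = (σ ^^ toℕ e) ((ζ ^^ toℕ c) i)

moveIndex⁻ : Fin 3 → Fin 2 → Fin 10 → Fin 10
moveIndex⁻ e c i = (ζ ^^ toℕ c) ((σ ^^ (2 * toℕ e)) i)

-- All classes are translated by the same a, and 4 is the inverse of 2 modulo 7.
affineG : G → Affine
affineG (a , e , c) = record { π = moveIndex e c ; π⁻ = moveIndex⁻ e c ; u = 2 ^ toℕ e ; u⁻ = 4 ^ toℕ e ; o = λ _ → toℕ a }

T⇒≡true : ∀ {b} → T b → b ≡ true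
T⇒≡true {true} _ = refl

∀-Fin₂ : ∀ {m n} (p : Fin m → Fin n → Bool) → all (λ i → all (p i) (allFin n)) (allFin m) ≡ true → ∀ i j → T (p i j)
∀-Fin₂ p h i = forall-Fin (p i) (T⇒≡true (forall-Fin (λ i → all (p i) (allFin _)) h i))

∀-Fin₃ : ∀ {l m n} (p : Fin l → Fin m → Fin n → Bool) →
  all (λ i → all (λ j → all (p i j) (allFin n)) (allFin m)) (allFin l) ≡ true → ∀ i j k → T (p i j k)
∀-Fin₃ p h i = ∀-Fin₂ (p i) (T⇒≡true (forall-Fin (λ i → all (λ j → all (p i j) (allFin _)) (allFin _)) h i))

∀-Fin₅ : ∀ {k l m n o} (p : Fin k → Fin l → Fin m → Fin n → Fin o → Bool) →
  all (λ i → all (λ j → all (λ k → all (λ l → all (p i j k l) (allFin o)) (allFin n)) (allFin m)) (allFin l)) (allFin k) ≡ true →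
  ∀ i j k l m → T (p i j k l m)
∀-Fin₅ p h i j = ∀-Fin₃ (p i j) (T⇒≡true (∀-Fin₂ (λ i j → all (λ k → all (λ l → all (p i j k l) (allFin _)) (allFin _)) (allFin _)) h i j))

valid-G : ∀ g → Affine.Valid (affineG g)
valid-G (a , e , c) = record
  { left  = λ i → ≟-sound (∀-Fin₃ (λ e c i → ⌊ moveIndex⁻ e c (moveIndex e c i) ≟ i ⌋) refl e c i)
  ; right = λ i → ≟-sound (∀-Fin₃ (λ e c i → ⌊ moveIndex e c (moveIndex⁻ e c i) ≟ i ⌋) refl e c i)
  ; unit  = ≡ᵇ-sound (forall-Fin (λ e → 2 ^ toℕ e * 4 ^ toℕ e % 7 ≡ᵇ 1) refl e) }

act : G → Permutation′ 70
act g = perm (affineG g) (valid-G g)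

moveIndex-hom : Fin 3 → Fin 2 → Fin 10 → Fin 3 → Fin 2 → Bool
moveIndex-hom e c i e′ c′ = ⌊ moveIndex ((toℕ e + toℕ e′) mod 3) ((toℕ c + toℕ c′) mod 2) i ≟ moveIndex e c (moveIndex e′ c′ i) ⌋

residue-hom : Fin 3 → Fin 3 → Fin 7 → Fin 7 → Fin 7 → Bool
residue-hom e e′ a a′ x =
  ⌊ (2 ^ toℕ ((toℕ e + toℕ e′) mod 3) * toℕ x + toℕ ((toℕ a + 2 ^ toℕ e * toℕ a′) mod 7)) mod 7
    ≟ (2 ^ toℕ e * toℕ ((2 ^ toℕ e′ * toℕ x + toℕ a′) mod 7) + toℕ a) mod 7 ⌋

forward-hom : ∀ g h p → forward (affineG (g · h)) p ≡ forward (affineG g) (forward (affineG h) p)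
forward-hom (a , e , c) (a′ , e′ , c′) (i , x) = cong₂ _,_
  (≟-sound (∀-Fin₅ moveIndex-hom refl e c i e′ c′))
  (≟-sound (∀-Fin₅ residue-hom refl e e′ a a′ x))

act-hom : ∀ g h x → act (g · h) ⟨$⟩ʳ x ≡ act g ⟨$⟩ʳ (act h ⟨$⟩ʳ x)
act-hom g h x = cong join (trans (forward-hom g h (split x)) (cong (forward (affineG g)) (sym (split-join _))))

start : Fin 4 → Fin 10
start 0F = 0F
start 1F = 1F
start 2F = 2F
start 3F = 4F

rep : Fin 4 → Fin 70
rep r = join (start r , 0F)

orbitOf : Fin 10 → Fin 4
orbitOf 0F = 0F
orbitOf 1F = 1F
orbitOf 2F = 2F
orbitOf 3F = 2F
orbitOf _  = 3F

-- A choice of exponents that carry the base class of the orbit to class i; they are unique on the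
-- regular orbit only.
exponents : Fin 10 → Fin 3 × Fin 2
exponents 0F = 0F , 0F
exponents 1F = 0F , 0F
exponents 2F = 0F , 0F
exponents 3F = 0F , 1F
exponents 4F = 0F , 0F
exponents 5F = 0F , 1F
exponents 6F = 1F , 0F
exponents 7F = 1F , 1F
exponents 8F = 2F , 0F
exponents 9F = 2F , 1F

element : Fin 10 → Fin 7 → G
element i a = a , exponents i

residue-0 : ∀ k (a : Fin 7) → (k * 0 + toℕ a) mod 7 ≡ a
residue-0 k a = trans (cong (λ z → (z + toℕ a) mod 7) (*-zeroʳ k)) (toℕ-mod7 a)

act-join : ∀ g p → act g ⟨$⟩ʳ join p ≡ join (forward (affineG g) p)
act-join g p = cong (join ∘ forward (affineG g)) (split-join p)

act-element : ∀ i a → act (element i a) ⟨$⟩ʳ rep (orbitOf i) ≡ join (i , a)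
act-element i a = trans (act-join (element i a) (start (orbitOf i) , 0F)) (cong join (cong₂ _,_
  (≟-sound (forall-Fin (λ i → ⌊ moveIndex (proj₁ (exponents i)) (proj₂ (exponents i)) (start (orbitOf i)) ≟ i ⌋) refl i))
  (residue-0 (2 ^ toℕ (proj₁ (exponents i))) a)))

reached : ∀ x → ∃₂ λ g r → act g ⟨$⟩ʳ rep r ≡ x
reached x = element (proj₁ (split x)) (proj₂ (split x)) , orbitOf (proj₁ (split x)) ,
  trans (act-element (proj₁ (split x)) (proj₂ (split x))) (join-split x)

join-injective : ∀ {p q} → join p ≡ join q → p ≡ q
join-injective {p} {q} eq = trans (sym (split-join p)) (trans (cong split eq) (split-join q))

-- `rep 3F` has trivial stabiliser: the class of its image determines e and c, and the coordinate of
-- its image is a.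
act-faithful : ∀ g h → act g ⟨$⟩ʳ rep 3F ≡ act h ⟨$⟩ʳ rep 3F → g ≡ h
act-faithful (a , e , c) (a′ , e′ , c′) eq = cong₂ _,_
  (trans (sym (residue-0 (2 ^ toℕ e) a)) (trans (cong proj₂ same) (residue-0 (2 ^ toℕ e′) a′)))
  (trans (sym (known-exponents e c)) (trans (cong (exponents ∘ proj₁) same) (known-exponents e′ c′)))
  where
  same : forward (affineG (a , e , c)) (4F , 0F) ≡ forward (affineG (a′ , e′ , c′)) (4F , 0F)
  same = join-injective (trans (sym (act-join (a , e , c) (4F , 0F))) (trans eq (act-join (a′ , e′ , c′) (4F , 0F))))
  known-exponents : ∀ e c → exponents (moveIndex e c 4F) ≡ (e , c)
  known-exponents 0F 0F = refl
  known-exponents 0F 1F = refl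
  known-exponents 1F 0F = refl
  known-exponents 1F 1F = refl
  known-exponents 2F 0F = refl
  known-exponents 2F 1F = refl

orbits : orbitLengths act ≡ 7 ∷ 7 ∷ 14 ∷ 42 ∷ []
orbits = refl

all-intro : ∀ {A : Set} (p : A → Bool) xs → (∀ x → T (p x)) → T (all p xs)
all-intro p []       h = _
all-intro p (x ∷ xs) h = ∧-intro (h x) (all-intro p xs h)

invariant : Fin 9 → Fin 3 → Fin 2 → Bool
invariant k e c = all (λ i → all (λ j → affine-at (2 ^ toℕ e) (table (toℕ k) (moveIndex e c i) (moveIndex e c j)) (table (toℕ k) i j) 0) (allFin 10)) (allFin 10)

invariant-true : ∀ k e c → T (invariant k e c)
invariant-true = ∀-Fin₃ invariant refl

byAutos-Ds : ∀ k g → IsAutomorphism (Ds k) (act g) (act g)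
byAutos-Ds k g@(a , e , c) = toD-affine (affineG g) (affineG g) (table (toℕ k)) (table (toℕ k)) (valid-G g) (valid-G g) refl λ i j →
  affine-at-shift (2 ^ toℕ e) (table (toℕ k) (moveIndex e c i) (moveIndex e c j)) (table (toℕ k) i j) (all-∈ {p = λ j → affine-at (2 ^ toℕ e) (table (toℕ k) (moveIndex e c i) (moveIndex e c j)) (table (toℕ k) i j) 0}
    (all-∈ {p = λ i → all (λ j → affine-at (2 ^ toℕ e) (table (toℕ k) (moveIndex e c i) (moveIndex e c j)) (table (toℕ k) i j) 0) (allFin 10)}
      (invariant-true k e c) (∈-allFin i)) (∈-allFin j))
  where
  -- A common translation cancels from the difference of coordinates: a + 6 a = 7 a.
  affine-at-shift : ∀ u v w → T (affine-at u v w 0) → T (affine-at u v w (toℕ a + 6 * toℕ a))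
  affine-at-shift u v w h = all-intro _ residues7 λ x → ≡⇒T (trans (at-cong v (Mod7.+-congˡ (u * x) (Mod7.≈-trans (Mod7.≡⇒≈ (*-comm 7 (toℕ a))) (Mod7.multiple≈0 (toℕ a))))) (affine-at-sound {u} {v} {w} h x))

-- The nine tables are designs.

𝟙-row 𝟙-column : ∀ {n} → (Fin n → Fin n → Bool) → Fin n → List ℕ
𝟙-row    {n} D p = map (λ b → 𝟙 (D p b)) (allFin n)
𝟙-column {n} D b = map (λ p → 𝟙 (D p b)) (allFin n)

dot : List ℕ → List ℕ → ℕ
dot (x ∷ xs) (y ∷ ys) = x * y + dot xs ys
dot _ _ = 0

dot-map : ∀ {A : Set} (f g : A → ℕ) xs → dot (map f xs) (map g xs) ≡ Σ⟨ xs ⟩ (λ x → f x * g x)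
dot-map f g []       = refl
dot-map f g (x ∷ xs) = cong (f x * g x +_) (dot-map f g xs)

sameList : List ℕ → List ℕ → Bool
sameList (x ∷ xs) (y ∷ ys) = (x ≡ᵇ y) ∧ sameList xs ys
sameList _ _ = true

sameList-sound : ∀ {A : Set} (f g : A → ℕ) xs → T (sameList (map f xs) (map g xs)) → ∀ {x} → x ∈ xs → f x ≡ g x
sameList-sound f g (x ∷ xs) h (here refl) = ≡ᵇ-sound (proj₁ (∧-elim {f x ≡ᵇ g x} h))
sameList-sound f g (x ∷ xs) h (there x∈)  = sameList-sound f g xs (proj₂ (∧-elim {f x ≡ᵇ g x} h)) x∈

𝟙-rows 𝟙-columns : ∀ {n} → (Fin n → Fin n → Bool) → List (List ℕ)
𝟙-rows    {n} D = map (𝟙-row D) (allFin n)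
𝟙-columns {n} D = map (𝟙-column D) (allFin n)

opaque
  blockSizesOK : List (List ℕ) → Bool
  blockSizesOK = all (λ c → sum c ≡ᵇ 24)

  meetsOK : ∀ {n} → List (List ℕ) → List ℕ → Fin n → Bool
  meetsOK {n} rows row p = sameList (map (dot row) rows) (map (λ q → if ⌊ p ≟ q ⌋ then 24 else 8) (allFin n))

module _ {n} (D : Fin n → Fin n → Bool) where

  opaque
    unfolding blockSizesOK meetsOK

    blockSizes-sound : T (blockSizesOK (𝟙-columns D)) → ∀ b → count (λ p → D p b) ≡ 24
    blockSizes-sound h b = ≡ᵇ-sound (all-∈ {p = λ c → sum c ≡ᵇ 24} {xs = 𝟙-columns D} h (∈-map⁺ (𝟙-column D) (∈-allFin b)))

    meets-sound : ∀ p → T (meetsOK (𝟙-rows D) (𝟙-row D p) p) → ∀ q → p ≢ q → count (λ b → D p b ∧ D q b) ≡ 8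
    meets-sound p h q p≢q = begin
      count (λ b → D p b ∧ D q b)           ≡⟨ count-∧ (D p) (D q) ⟩
      ΣF (λ b → 𝟙 (D p b) * 𝟙 (D q b))      ≡⟨ dot-map (λ b → 𝟙 (D p b)) (λ b → 𝟙 (D q b)) (allFin n) ⟨
      dot (𝟙-row D p) (𝟙-row D q)           ≡⟨ sameList-sound (λ q → dot (𝟙-row D p) (𝟙-row D q)) (λ q → if ⌊ p ≟ q ⌋ then 24 else 8) (allFin n)
          (subst (λ l → T (sameList l (map (λ q → if ⌊ p ≟ q ⌋ then 24 else 8) (allFin n)))) (sym (map-∘ (allFin n))) h) (∈-allFin q) ⟩
      (if ⌊ p ≟ q ⌋ then 24 else 8)         ≡⟨ go (p ≟ q) ⟩
      8                                     ∎
      where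
      open ≡-Reasoning
      go : (d : Dec (p ≡ q)) → (if ⌊ d ⌋ then 24 else 8) ≡ 8
      go (yes eq) = ⊥-elim (p≢q eq)
      go (no _)   = refl

count-cong : ∀ {n} {f g : Fin n → Bool} → (∀ x → f x ≡ g x) → count f ≡ count g
count-cong {n} h = Σ-cong (allFin n) (λ x → cong 𝟙 (h x))

count-perm : ∀ {n} (σ : Permutation′ n) (f : Fin n → Bool) → count (λ x → f (σ ⟨$⟩ʳ x)) ≡ count f
count-perm σ f = Σ-perm σ (λ x → 𝟙 (f x))

count-automorphism : ∀ {n} {D : Fin n → Fin n → Bool} (σ τ : Permutation′ n) → (∀ p b → D (σ ⟨$⟩ʳ p) (τ ⟨$⟩ʳ b) ≡ D p b) →
  ∀ p q → count (λ b → D (σ ⟨$⟩ʳ p) b ∧ D (σ ⟨$⟩ʳ q) b) ≡ count (λ b → D p b ∧ D q b)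
count-automorphism {D = D} σ τ h p q = trans (sym (count-perm τ (λ b → D (σ ⟨$⟩ʳ p) b ∧ D (σ ⟨$⟩ʳ q) b))) (count-cong (λ b → cong₂ _∧_ (h p b) (h q b)))

pairs70 : List Point
pairs70 = concatMap (λ i → map (i ,_) (allFin 7)) (allFin 10)

rowOfBlocks columnOfBlocks : Blocks → Point → List ℕ
rowOfBlocks    c (i , a) = concatMap (λ j → go (c i j)) (allFin 10)
  where
  go : V7 → List ℕ
  go v = map (λ b → 𝟙 (at v (toℕ b + 6 * toℕ a) ≡ᵇ 1)) (allFin 7)
columnOfBlocks c (j , b) = concatMap (λ i → go (c i j)) (allFin 10)
  where
  go : V7 → List ℕ
  go v = map (λ a → 𝟙 (at v (toℕ b + 6 * toℕ a) ≡ᵇ 1)) (allFin 7)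

map-concatMap : ∀ {A X Y : Set} (f : A × X → Y) (ys : List X) (xs : List A) →
  map f (concatMap (λ i → map (i ,_) ys) xs) ≡ concatMap (λ i → map (λ b → f (i , b)) ys) xs
map-concatMap f ys []       = refl
map-concatMap f ys (x ∷ xs) = trans (map-++ f (map (x ,_) ys) _) (cong₂ _++_ (sym (map-∘ ys)) (map-concatMap f ys xs))

-- Enumerating Fin 70 block by block avoids splitting indices over and over in the checks below.
module _ (ls : List Point) (ls≡ : allFin 70 ≡ map join ls) where

  map-allFin70 : ∀ {X : Set} (f : Fin 70 → X) → map f (allFin 70) ≡ map (λ p → f (join p)) ls
  map-allFin70 f = trans (cong (map f) ls≡) (sym (map-∘ ls))

  𝟙-row-E : ∀ c p → 𝟙-row (toD c) (join p) ≡ map (λ q → 𝟙 (E c p q)) ls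
  𝟙-row-E c p = trans (map-allFin70 (λ q → 𝟙 (toD c (join p) q))) (map-cong (λ q → cong₂ (λ p q → 𝟙 (E c p q)) (split-join p) (split-join q)) ls)

  𝟙-column-E : ∀ c q → 𝟙-column (toD c) (join q) ≡ map (λ p → 𝟙 (E c p q)) ls
  𝟙-column-E c q = trans (map-allFin70 (λ p → 𝟙 (toD c p (join q)))) (map-cong (λ p → cong₂ (λ p q → 𝟙 (E c p q)) (split-join p) (split-join q)) ls)

allFin70≡ : allFin 70 ≡ map join pairs70
allFin70≡ = refl

𝟙-row≡ : ∀ c p → 𝟙-row (toD c) (join p) ≡ rowOfBlocks c p
𝟙-row≡ c p = trans (𝟙-row-E pairs70 allFin70≡ c p) (map-concatMap (λ q → 𝟙 (E c p q)) (allFin 7) (allFin 10))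

𝟙-column≡ : ∀ c q → 𝟙-column (toD c) (join q) ≡ columnOfBlocks c q
𝟙-column≡ c q = trans (𝟙-column-E pairs70 allFin70≡ c q) (map-concatMap (λ p → 𝟙 (E c p q)) (allFin 7) (allFin 10))

𝟙-rows≡ : ∀ c → 𝟙-rows (toD c) ≡ map (rowOfBlocks c) pairs70
𝟙-rows≡ c = trans (map-allFin70 pairs70 allFin70≡ (𝟙-row (toD c))) (map-cong (𝟙-row≡ c) pairs70)

𝟙-columns≡ : ∀ c → 𝟙-columns (toD c) ≡ map (columnOfBlocks c) pairs70
𝟙-columns≡ c = trans (map-allFin70 pairs70 allFin70≡ (𝟙-column (toD c))) (map-cong (𝟙-column≡ c) pairs70)

opaque
  unfolding blockSizesOK

  blockSizes-Ds : all (λ k → blockSizesOK (map (columnOfBlocks (table (toℕ k))) pairs70)) (allFin 9) ≡ true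
  blockSizes-Ds = refl

opaque
  unfolding meetsOK

  allMeetsOK : (Fin 4 → List ℕ) → List (List ℕ) → Bool
  allMeetsOK row rows = all (λ r → meetsOK rows (row r) (rep r)) (allFin 4)

  allMeets-sound : ∀ row rows → T (allMeetsOK row rows) → ∀ r → T (meetsOK rows (row r) (rep r))
  allMeets-sound row rows h r = all-∈ {p = λ r → meetsOK rows (row r) (rep r)} {xs = allFin 4} h (∈-allFin r)

meetsTable : Fin 9 → Bool
meetsTable k = allMeetsOK (λ r → rowOfBlocks (table (toℕ k)) (start r , 0F)) (map (rowOfBlocks (table (toℕ k))) pairs70)

opaque
  unfolding meetsOK allMeetsOK

  meets-Ds : all meetsTable (allFin 9) ≡ true
  meets-Ds = refl

module _ {n} {D : Fin n → Fin n → Bool} {I R : Set} (σ : I → Permutation′ n) (rep : R → Fin n)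
         (automorphism : ∀ g p b → D (σ g ⟨$⟩ʳ p) (σ g ⟨$⟩ʳ b) ≡ D p b)
         (reached : ∀ x → ∃₂ λ g r → σ g ⟨$⟩ʳ rep r ≡ x)
         (atReps : ∀ r q → rep r ≢ q → count (λ b → D (rep r) b ∧ D q b) ≡ 8) where

  -- Automorphisms preserve intersection numbers and carry p to an orbit representative, so the rows
  -- of the representatives suffice.
  meets-everywhere : ∀ p q → p ≢ q → count (λ b → D p b ∧ D q b) ≡ 8
  meets-everywhere p q p≢q with g , r , refl ← reached p = begin
    count (λ b → D (σ g ⟨$⟩ʳ rep r) b ∧ D q b)
      ≡⟨ cong (λ q → count (λ b → D (σ g ⟨$⟩ʳ rep r) b ∧ D q b)) (inverseʳ (σ g)) ⟨
    count (λ b → D (σ g ⟨$⟩ʳ rep r) b ∧ D (σ g ⟨$⟩ʳ (σ g ⟨$⟩ˡ q)) b)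
      ≡⟨ count-automorphism {D = D} (σ g) (σ g) (automorphism g) (rep r) (σ g ⟨$⟩ˡ q) ⟩
    count (λ b → D (rep r) b ∧ D (σ g ⟨$⟩ˡ q) b)
      ≡⟨ atReps r (σ g ⟨$⟩ˡ q) (λ e → p≢q (trans (cong (σ g ⟨$⟩ʳ_) e) (inverseʳ (σ g)))) ⟩
    8 ∎
    where open ≡-Reasoning

module _ (c : Blocks)
         (sizes : T (blockSizesOK (map (columnOfBlocks c) pairs70)))
         (meets : T (allMeetsOK (λ r → rowOfBlocks c (start r , 0F)) (map (rowOfBlocks c) pairs70)))
         (inv : ∀ g → IsAutomorphism (toD c) (act g) (act g)) where

  private
    transport : ∀ {l l′} → l ≡ l′ → T (blockSizesOK l′) → T (blockSizesOK l)
    transport refl h = h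
    transport₂ : ∀ {l l′ row row′} {x : Fin 70} → l ≡ l′ → row ≡ row′ → T (meetsOK l′ row′ x) → T (meetsOK l row x)
    transport₂ refl refl h = h

  symmetric-toD : IsSymmetric-70-24-8 (toD c)
  symmetric-toD = blockSizes-sound (toD c) (transport (𝟙-columns≡ c) sizes) ,
    meets-everywhere {D = toD c} act rep inv reached (λ r → meets-sound (toD c) (rep r)
      (transport₂ (𝟙-rows≡ c) (𝟙-row≡ c (start r , 0F)) (allMeets-sound (λ r → rowOfBlocks c (start r , 0F)) (map (rowOfBlocks c) pairs70) meets r)))

symmetric-Ds : ∀ k → IsSymmetric-70-24-8 (Ds k)
symmetric-Ds k = symmetric-toD (table (toℕ k))
  (forall-Fin (λ k → blockSizesOK (map (columnOfBlocks (table (toℕ k))) pairs70)) blockSizes-Ds k)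
  (forall-Fin meetsTable meets-Ds k) (byAutos-Ds k)

action-Ds : ∀ k → IsFaithfulAutAction (Ds k) act act
action-Ds k = record
  { homP = act-hom ; homB = act-hom ; faithful = λ g h eq _ → act-faithful g h (eq (rep 3F)) ; byAutos = byAutos-Ds k }

admits-Ds : ∀ k → Admits (Ds k)
admits-Ds k = symmetric-Ds k , act , act , action-Ds k , ↭-reflexive orbits , ↭-reflexive orbits

-- A point invariant relative to a base point x: first Σ_z T(x,y,z)³ for the triple intersection numbers T,
-- then one round of refinement through the blocks.  It separates all points when x lies in the regular orbit.
cube square : ℕ → ℕ
cube k = k * k * k
square k = k * k

-- The sum of the selected columns; the first argument fixes the length.
select : List ℕ → List ℕ → List (List ℕ) → List ℕ
select z (zero  ∷ ms) (c ∷ cs) = select z ms cs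
select z (suc _ ∷ ms) (c ∷ cs) = zipWith _+_ c (select z ms cs)
select z _            _        = map (λ _ → 0) z

-- The product of the rows of x and y marks the blocks through both points; adding the marked
-- columns gives, for every z, the number of blocks through x, y and z.
color : List ℕ → List (List ℕ) → List ℕ → ℕ
color rₓ cs r = sum (map cube (select rₓ (zipWith _*_ rₓ r) cs))

throughBlocks : List (List ℕ) → List ℕ → List ℕ
throughBlocks rs ws = map (λ r → dot r ws) rs

refined : List (List ℕ) → List (List ℕ) → List ℕ → List ℕ
refined rs cs colors = throughBlocks rs (map (λ c → square (dot c colors)) cs)

colored : List (List ℕ) → List (List ℕ) → List ℕ → List ℕ
colored rs cs rₓ = refined rs cs (map (color rₓ cs) rs)

module Fingerprint {n} (D : Fin n → Fin n → Bool) (x : Fin n) where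
  fingerprint : List ℕ
  fingerprint = colored (𝟙-rows D) (𝟙-columns D) (𝟙-row D x)

  color′ blockWeight value : Fin n → ℕ
  color′ y = ΣF (λ z → cube (ΣF (λ b → 𝟙 (D x b) * 𝟙 (D y b) * 𝟙 (D z b))))
  blockWeight b = square (ΣF (λ z → 𝟙 (D z b) * color′ z))
  value y = ΣF (λ b → 𝟙 (D y b) * blockWeight b)

  zipWith-map : ∀ {A : Set} (_∙_ : ℕ → ℕ → ℕ) (f g : A → ℕ) xs → zipWith _∙_ (map f xs) (map g xs) ≡ map (λ x → f x ∙ g x) xs
  zipWith-map _∙_ f g []       = refl
  zipWith-map _∙_ f g (x ∷ xs) = cong (_ ∷_) (zipWith-map _∙_ f g xs)

  select-sum : ∀ (μ : Fin n → ℕ) → (∀ b → μ b ≤ 1) → ∀ bs →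
    select (𝟙-row D x) (map μ bs) (map (𝟙-column D) bs) ≡ map (λ z → Σ⟨ bs ⟩ (λ b → μ b * 𝟙 (D z b))) (allFin n)
  select-sum μ μ≤1 []       = sym (map-∘ (allFin n))
  select-sum μ μ≤1 (b ∷ bs) = go (μ b) (μ≤1 b)
    where
    rest : Fin n → ℕ
    rest z = Σ⟨ bs ⟩ (λ b → μ b * 𝟙 (D z b))
    go : ∀ m → m ≤ 1 → select (𝟙-row D x) (m ∷ map μ bs) (map (𝟙-column D) (b ∷ bs)) ≡ map (λ z → m * 𝟙 (D z b) + rest z) (allFin n)
    go 0 _ = select-sum μ μ≤1 bs
    go 1 _ = trans (cong (zipWith _+_ (𝟙-column D b)) (select-sum μ μ≤1 bs))
      (trans (zipWith-map _+_ (λ z → 𝟙 (D z b)) rest (allFin n)) (map-cong (λ z → cong (_+ rest z) (sym (+-identityʳ (𝟙 (D z b))))) (allFin n)))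
    go (suc (suc _)) (s≤s ())

  color≡ : ∀ y → color (𝟙-row D x) (map (𝟙-column D) (allFin n)) (𝟙-row D y) ≡ color′ y
  color≡ y = begin
    sum (map cube (select (𝟙-row D x) (zipWith _*_ (𝟙-row D x) (𝟙-row D y)) (map (𝟙-column D) (allFin n))))
      ≡⟨ cong (λ l → sum (map cube (select (𝟙-row D x) l (map (𝟙-column D) (allFin n))))) (zipWith-map _*_ (λ b → 𝟙 (D x b)) (λ b → 𝟙 (D y b)) (allFin n)) ⟩
    sum (map cube (select (𝟙-row D x) (map (λ b → 𝟙 (D x b) * 𝟙 (D y b)) (allFin n)) (map (𝟙-column D) (allFin n))))
      ≡⟨ cong (λ l → sum (map cube l)) (select-sum (λ b → 𝟙 (D x b) * 𝟙 (D y b)) (λ b → *-mono-≤ (𝟙≤1 (D x b)) (𝟙≤1 (D y b))) (allFin n)) ⟩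
    sum (map cube (map (λ z → ΣF (λ b → 𝟙 (D x b) * 𝟙 (D y b) * 𝟙 (D z b))) (allFin n)))
      ≡⟨ cong sum (map-∘ (allFin n)) ⟨
    color′ y ∎
    where
    open ≡-Reasoning
    𝟙≤1 : ∀ b → 𝟙 b ≤ 1
    𝟙≤1 true  = s≤s z≤n
    𝟙≤1 false = z≤n

  fingerprint≡ : fingerprint ≡ map value (allFin n)
  fingerprint≡ = begin
    throughBlocks rs (map (λ c → square (dot c (map (color (𝟙-row D x) cs) rs))) cs)
      ≡⟨ cong (λ l → throughBlocks rs (map (λ c → square (dot c l)) cs)) (trans (sym (map-∘ (allFin n))) (map-cong color≡ (allFin n))) ⟩
    throughBlocks rs (map (λ c → square (dot c (map color′ (allFin n)))) cs)
      ≡⟨ cong (throughBlocks rs) (trans (sym (map-∘ (allFin n))) (map-cong (λ b → cong square (dot-map (λ z → 𝟙 (D z b)) color′ (allFin n))) (allFin n))) ⟩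
    throughBlocks rs (map blockWeight (allFin n))
      ≡⟨ trans (sym (map-∘ (allFin n))) (map-cong (λ y → dot-map (λ b → 𝟙 (D y b)) blockWeight (allFin n)) (allFin n)) ⟩
    map value (allFin n) ∎
    where
    open ≡-Reasoning
    rs = map (𝟙-row D) (allFin n)
    cs = map (𝟙-column D) (allFin n)

module _ {n} {D D′ : Fin n → Fin n → Bool} (σ τ : Permutation′ n) (iso : ∀ p b → D′ (σ ⟨$⟩ʳ p) (τ ⟨$⟩ʳ b) ≡ D p b) (x : Fin n) where
  private
    module F = Fingerprint D x
    module F′ = Fingerprint D′ (σ ⟨$⟩ʳ x)

  color-invariant : ∀ y → F′.color′ (σ ⟨$⟩ʳ y) ≡ F.color′ y
  color-invariant y = trans (sym (Σ-perm σ _)) (Σ-cong (allFin n) λ z → cong cube (trans (sym (Σ-perm τ _)) (Σ-cong (allFin n) λ b →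
    cong₂ _*_ (cong₂ _*_ (cong 𝟙 (iso x b)) (cong 𝟙 (iso y b))) (cong 𝟙 (iso z b)))))

  value-invariant : ∀ y → F′.value (σ ⟨$⟩ʳ y) ≡ F.value y
  value-invariant y = trans (sym (Σ-perm τ _)) (Σ-cong (allFin n) λ b →
    cong₂ _*_ (cong 𝟙 (iso y b)) (cong square (trans (sym (Σ-perm σ _)) (Σ-cong (allFin n) λ z →
      cong₂ _*_ (cong 𝟙 (iso z b)) (color-invariant z)))))

distinct : List ℕ → Bool
distinct [] = true
distinct (k ∷ ks) = all (λ l → not (k ≡ᵇ l)) ks ∧ distinct ks

distinct-injective : ∀ {A : Set} (f : A → ℕ) xs → T (distinct (map f xs)) → ∀ {x y} → x ∈ xs → y ∈ xs → f x ≡ f y → x ≡ y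
distinct-injective f (z ∷ zs) h x∈ y∈ eq = go x∈ y∈
  where
  split′ = ∧-elim {all (λ l → not (f z ≡ᵇ l)) (map f zs)} h
  clash : ∀ {y} → y ∈ zs → f z ≡ f y → ⊥
  clash {y} y∈ e = absurd (f z ≡ᵇ f y) (≡⇒T e) (all-∈ {p = λ l → not (f z ≡ᵇ l)} (proj₁ split′) (∈-map⁺ f y∈))
    where
    absurd : ∀ b → T b → T (not b) → ⊥
    absurd true _ ()
  go : _ ∈ z ∷ zs → _ ∈ z ∷ zs → _ ≡ _
  go (here refl) (here refl) = refl
  go (here refl) (there y∈)  = ⊥-elim (clash y∈ eq)
  go (there x∈)  (here refl) = ⊥-elim (clash x∈ (sym eq))
  go (there x∈)  (there y∈)  = distinct-injective f zs (proj₂ split′) x∈ y∈ eq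

-- Sums of the invariant over all points, with the base point in the regular orbit, for the designs
-- and for their duals. The lists share only their first two entries, in the same places, which
-- singles out the self-dual designs.
totals totals′ : List ℕ
totals  = 11415939849216 ∷ 11454186710016 ∷ 11409388323840 ∷ 11395203462144 ∷ 11372312715264 ∷
          11506762589184 ∷ 11447628383232 ∷ 11477175690240 ∷ 11376675873792 ∷ []
totals′ = 11415939849216 ∷ 11454186710016 ∷ 11400660486144 ∷ 11388661115904 ∷ 11390845418496 ∷
          11518827761664 ∷ 11427951329280 ∷ 11492512146432 ∷ 11371223909376 ∷ []

total total′ : Fin 9 → ℕ
total  k = nth 0 totals (toℕ k)
total′ k = nth 0 totals′ (toℕ k)

opaque
  -- Opaque, so that statements about the invariant do not trigger its evaluation; invariance,
  -- totals and injectivity are all that later arguments use.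
  value : ∀ {n} → (Fin n → Fin n → Bool) → Fin n → Fin n → ℕ
  value D x = Fingerprint.value D x

  value-≅ : ∀ {n} {D D′ : Fin n → Fin n → Bool} (σ τ : Permutation′ n) → (∀ p b → D′ (σ ⟨$⟩ʳ p) (τ ⟨$⟩ʳ b) ≡ D p b) →
    ∀ x y → value D′ (σ ⟨$⟩ʳ x) (σ ⟨$⟩ʳ y) ≡ value D x y
  value-≅ {D = D} {D′} = value-invariant {D = D} {D′}

  good : (s s′ : ℕ) (rs cs : List (List ℕ)) (r c : List ℕ) → Bool
  good s s′ rs cs r c = go (colored rs cs r) (colored cs rs c)
    where
    go : List ℕ → List ℕ → Bool
    go l l′ = (sum l ≡ᵇ s) ∧ distinct l ∧ (sum l′ ≡ᵇ s′)

module _ {n} (D : Fin n → Fin n → Bool) (x : Fin n) {s s′ : ℕ}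
         (h : T (good s s′ (𝟙-rows D) (𝟙-columns D) (𝟙-row D x) (𝟙-column D x))) where
  opaque
    unfolding value good

    private
      module F = Fingerprint D x
      module F′ = Fingerprint (λ p b → D b p) x
      h₂ : T (distinct F.fingerprint) × T (sum F′.fingerprint ≡ᵇ s′)
      h₂ = ∧-elim {distinct F.fingerprint} (proj₂ (∧-elim {sum F.fingerprint ≡ᵇ s} h))

    value-total : ΣF (value D x) ≡ s
    value-total = trans (cong sum (sym F.fingerprint≡)) (≡ᵇ-sound (proj₁ (∧-elim {sum F.fingerprint ≡ᵇ s} h)))

    value-total-dual : ΣF (value (λ p b → D b p) x) ≡ s′
    value-total-dual = trans (cong sum (sym F′.fingerprint≡)) (≡ᵇ-sound (proj₂ h₂))

    value-injective : ∀ {y z} → value D x y ≡ value D x z → y ≡ z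
    value-injective {y} {z} = distinct-injective F.value (allFin n) (subst (λ l → T (distinct l)) F.fingerprint≡ (proj₁ h₂)) (∈-allFin y) (∈-allFin z)

goodTable : Fin 9 → Bool
goodTable k = go (map (rowOfBlocks (table (toℕ k))) pairs70) (map (columnOfBlocks (table (toℕ k))) pairs70)
  where
  go : List (List ℕ) → List (List ℕ) → Bool
  go rs cs = good (total k) (total′ k) rs cs (rowOfBlocks (table (toℕ k)) (4F , 0F)) (columnOfBlocks (table (toℕ k)) (4F , 0F))

opaque
  unfolding good

  good-tables : all goodTable (allFin 9) ≡ true
  good-tables = refl

good-toD : ∀ c {s s′} → T (good s s′ (map (rowOfBlocks c) pairs70) (map (columnOfBlocks c) pairs70) (rowOfBlocks c (4F , 0F)) (columnOfBlocks c (4F , 0F))) →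
  T (good s s′ (𝟙-rows (toD c)) (𝟙-columns (toD c)) (𝟙-row (toD c) (rep 3F)) (𝟙-column (toD c) (rep 3F)))
good-toD c = transport (𝟙-rows≡ c) (𝟙-columns≡ c) (𝟙-row≡ c (4F , 0F)) (𝟙-column≡ c (4F , 0F))
  where
  transport : ∀ {s s′ rs rs′ cs cs′ r r′ l l′} → rs ≡ rs′ → cs ≡ cs′ → r ≡ r′ → l ≡ l′ →
    T (good s s′ rs′ cs′ r′ l′) → T (good s s′ rs cs r l)
  transport refl refl refl refl h = h

-- Orbits of an arbitrary action with the given lengths.

module _ {n : ℕ} where
  open import Data.List.Membership.DecPropositional (_≟_ {n}) using (_∈?_) public

count≡length : ∀ {n} (f : Fin n → Bool) → count f ≡ length (filterᵇ f (allFin n))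
count≡length {n} f = go (allFin n)
  where
  go : ∀ xs → Σ⟨ xs ⟩ (λ x → 𝟙 (f x)) ≡ length (filterᵇ f xs)
  go [] = refl
  go (x ∷ xs) with f x
  ... | true  = cong suc (go xs)
  ... | false = go xs

count-≤ : ∀ {n} (f : Fin n → Bool) L → (∀ y → T (f y) → y ∈ L) → count f ≤ length L
count-≤ {n} f L h = ≤-trans (≤-reflexive (count≡length f))
  (unique-length (filter⁺ (T? ∘ f) (allFin⁺ n)) (λ {x} x∈ → h x (proj₂ (∈-filter⁻ (T? ∘ f) {xs = allFin n} x∈))))

count-≥ : ∀ {n} (f : Fin n → Bool) {L} → Unique L → (∀ {y} → y ∈ L → T (f y)) → length L ≤ count f
count-≥ f u h = ≤-trans (unique-length u (λ {x} x∈ → ∈-filter f (∈-allFin x) (h x∈))) (≤-reflexive (sym (count≡length f)))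

module _ {A : Set} (f : A → A) where

  ^^-+ : ∀ m k x → (f ^^ (m + k)) x ≡ (f ^^ m) ((f ^^ k) x)
  ^^-+ zero    k x = refl
  ^^-+ (suc m) k x = cong f (^^-+ m k x)

  ^^-fix : ∀ {x} → f x ≡ x → ∀ m → (f ^^ m) x ≡ x
  ^^-fix p zero    = refl
  ^^-fix p (suc m) = trans (cong f (^^-fix p m)) p

  ^^-fix* : ∀ {k x} → (f ^^ k) x ≡ x → ∀ m → (f ^^ (m * k)) x ≡ x
  ^^-fix* p zero = refl
  ^^-fix* {k} {x} p (suc m) = trans (^^-+ k (m * k) x) (trans (cong (f ^^ k) (^^-fix* p m)) p)

-- The action through its generators T, S, Z of orders 7, 3, 2.
record Generators : Set where
  field
    T̂ Ŝ Ẑ : Fin 70 → Fin 70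
    T⁷  : ∀ x → (T̂ ^^ 7) x ≡ x
    S³  : ∀ x → (Ŝ ^^ 3) x ≡ x
    Z²  : ∀ x → (Ẑ ^^ 2) x ≡ x
    ST  : ∀ x → Ŝ (T̂ x) ≡ T̂ (T̂ (Ŝ x))
    ZT  : ∀ x → Ẑ (T̂ x) ≡ T̂ (Ẑ x)
    ZS  : ∀ x → Ẑ (Ŝ x) ≡ Ŝ (Ẑ x)

  word : ℕ → ℕ → ℕ → Fin 70 → Fin 70
  word a e c x = (T̂ ^^ a) ((Ŝ ^^ e) ((Ẑ ^^ c) x))

  T^7 : ∀ m x → (T̂ ^^ (m * 7)) x ≡ x
  T^7 m x = ^^-fix* T̂ {7} (T⁷ x) m

  T-mod : ∀ m x → (T̂ ^^ m) x ≡ (T̂ ^^ (m % 7)) x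
  T-mod m x = trans (cong (λ k → (T̂ ^^ k) x) (m≡m%n+[m/n]*n m 7))
    (trans (^^-+ T̂ (m % 7) (m / 7 * 7) x) (cong (T̂ ^^ (m % 7)) (T^7 (m / 7) x)))

  T-cong : ∀ {m n} x → m Mod7.≈ n → (T̂ ^^ m) x ≡ (T̂ ^^ n) x
  T-cong {m} {n} x p = trans (T-mod m x) (trans (cong (λ k → (T̂ ^^ k) x) (Mod7.≈⇒% p)) (sym (T-mod n x)))

  S-T : ∀ m x → Ŝ ((T̂ ^^ m) x) ≡ (T̂ ^^ (2 * m)) (Ŝ x)
  S-T zero    x = refl
  S-T (suc m) x = trans (ST _) (trans (cong (T̂ ∘ T̂) (S-T m x))
    (cong (λ k → (T̂ ^^ k) (Ŝ x)) (sym (cong suc (+-suc m (m + 0))))))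

  Z-T : ∀ m x → Ẑ ((T̂ ^^ m) x) ≡ (T̂ ^^ m) (Ẑ x)
  Z-T zero    x = refl
  Z-T (suc m) x = trans (ZT _) (cong T̂ (Z-T m x))

  Z-S : ∀ m x → Ẑ ((Ŝ ^^ m) x) ≡ (Ŝ ^^ m) (Ẑ x)
  Z-S zero    x = refl
  Z-S (suc m) x = trans (ZS _) (cong Ŝ (Z-S m x))

  -- k is invertible modulo 7, so `T̂` is itself a power of `T̂ ^^ k`.
  T-power-fix : ∀ k {x} → k % 7 ≢ 0 → (T̂ ^^ k) x ≡ x → T̂ x ≡ x
  T-power-fix k {x} k≢0 p = go (k % 7) (m%n<n k 7) k≢0 (trans (sym (T-mod k x)) p)
    where
    by : ∀ r i → i * r Mod7.≈ 1 → (T̂ ^^ r) x ≡ x → T̂ x ≡ x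
    by r i i≈ q = trans (sym (T-cong x i≈)) (^^-fix* T̂ {r} q i)
    go : ∀ r → r < 7 → r ≢ 0 → (T̂ ^^ r) x ≡ x → T̂ x ≡ x
    go 0 _ r≢0 _ = ⊥-elim (r≢0 refl)
    go 1 _ _ q = q
    go 2 _ _ q = by 2 4 (Mod7.congruent 0 1 refl) q
    go 3 _ _ q = by 3 5 (Mod7.congruent 0 2 refl) q
    go 4 _ _ q = by 4 2 (Mod7.congruent 0 1 refl) q
    go 5 _ _ q = by 5 3 (Mod7.congruent 0 2 refl) q
    go 6 _ _ q = by 6 6 (Mod7.congruent 0 5 refl) q
    go (suc (suc (suc (suc (suc (suc (suc _))))))) (s≤s (s≤s (s≤s (s≤s (s≤s (s≤s (s≤s ()))))))) _ _

  line : Fin 70 → List (Fin 70)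
  line x = map (λ a → (T̂ ^^ toℕ a) x) (allFin 7)

  length-line : ∀ x → length (line x) ≡ 7
  length-line x = refl

  length-lines : ∀ x y → length (line x ++ line y) ≡ 14
  length-lines x y = refl

  line-∈ : ∀ m x → (T̂ ^^ m) x ∈ line x
  line-∈ m x = subst (_∈ line x) (T-cong x (mod7≈ m)) (∈-map⁺ (λ a → (T̂ ^^ toℕ a) x) (∈-allFin (m mod 7)))

  line-∋ : ∀ {x y} → y ∈ line x → ∃ λ (a : Fin 7) → (T̂ ^^ toℕ a) x ≡ y
  line-∋ {x} y∈ with a , _ , eq ← ∈-map⁻ (λ a → (T̂ ^^ toℕ a) x) {xs = allFin 7} y∈ = a , sym eq

  line-sym : ∀ {x y} → y ∈ line x → x ∈ line y
  line-sym {x} y∈ with a , refl ← line-∋ y∈ = subst (_∈ line ((T̂ ^^ toℕ a) x))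
    (trans (sym (^^-+ T̂ (6 * toℕ a) (toℕ a) x)) (trans (cong (λ k → (T̂ ^^ k) x) (solve 1 (λ a → con 6 :* a :+ a := a :* con 7) refl (toℕ a))) (T^7 (toℕ a) x)))
    (line-∈ (6 * toℕ a) ((T̂ ^^ toℕ a) x))
    where open +-*-Solver

  line-trans : ∀ {x y z} → y ∈ line x → z ∈ line y → z ∈ line x
  line-trans {x} y∈ z∈ with a , refl ← line-∋ y∈ | b , refl ← line-∋ z∈ =
    subst (_∈ line x) (^^-+ T̂ (toℕ b) (toℕ a) x) (line-∈ (toℕ b + toℕ a) x)

  line-Z : ∀ {x y} → y ∈ line x → Ẑ y ∈ line (Ẑ x)
  line-Z {x} y∈ with a , refl ← line-∋ y∈ = subst (_∈ line (Ẑ x)) (sym (Z-T (toℕ a) x)) (line-∈ (toℕ a) (Ẑ x))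

  line-S : ∀ {x y} → y ∈ line x → Ŝ y ∈ line (Ŝ x)
  line-S {x} y∈ with a , refl ← line-∋ y∈ = subst (_∈ line (Ŝ x)) (sym (S-T (toℕ a) x)) (line-∈ (2 * toℕ a) (Ŝ x))

  line-unique : ∀ {x} → T̂ x ≢ x → Unique (line x)
  line-unique {x} Tx≢x = map⁺ inj (allFin⁺ 7)
    where
    open +-*-Solver
    inj : ∀ {a b : Fin 7} → (T̂ ^^ toℕ a) x ≡ (T̂ ^^ toℕ b) x → a ≡ b
    inj {a} {b} eq with (toℕ a + 6 * toℕ b) % 7 ≟ℕ 0
      where open import Data.Nat using () renaming (_≟_ to _≟ℕ_)
    ... | no ≢0 = ⊥-elim (Tx≢x (T-power-fix (toℕ a + 6 * toℕ b) ≢0 (begin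
      (T̂ ^^ (toℕ a + 6 * toℕ b)) x      ≡⟨ cong (λ k → (T̂ ^^ k) x) (+-comm (toℕ a) _) ⟩
      (T̂ ^^ (6 * toℕ b + toℕ a)) x      ≡⟨ ^^-+ T̂ (6 * toℕ b) (toℕ a) x ⟩
      (T̂ ^^ (6 * toℕ b)) ((T̂ ^^ toℕ a) x) ≡⟨ cong (T̂ ^^ (6 * toℕ b)) eq ⟩
      (T̂ ^^ (6 * toℕ b)) ((T̂ ^^ toℕ b) x) ≡⟨ ^^-+ T̂ (6 * toℕ b) (toℕ b) x ⟨
      (T̂ ^^ (6 * toℕ b + toℕ b)) x      ≡⟨ cong (λ k → (T̂ ^^ k) x) (solve 1 (λ b → con 6 :* b :+ b := b :* con 7) refl (toℕ b)) ⟩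
      (T̂ ^^ (toℕ b * 7)) x              ≡⟨ T^7 (toℕ b) x ⟩
      x ∎)))
      where open ≡-Reasoning
    ... | yes ≡0 = trans (sym (toℕ-mod7 a)) (trans (≈-mod7 (
      toℕ a                        ≡⟨ sym (+-identityʳ _) ⟩≈
      toℕ a + 0                    ≈⟨ +-congˡ (toℕ a) (≈-sym (multiple≈0 (toℕ b))) ⟩
      toℕ a + toℕ b * 7            ≡⟨ solve 2 (λ a b → a :+ b :* con 7 := a :+ con 6 :* b :+ b) refl (toℕ a) (toℕ b) ⟩≈
      toℕ a + 6 * toℕ b + toℕ b    ≈⟨ +-cong (%⇒≈ ≡0) (≈-refl {toℕ b}) ⟩
      toℕ b ∎≈)) (toℕ-mod7 b))
      where open Mod7

  -- If Z x = Tᵇ x, then T²ᵇ x = Z² x = x, as Z and T commute; and b ≡ 4 · 2 b modulo 7.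
  Z-line-fix : ∀ {x} → Ẑ x ∈ line x → Ẑ x ≡ x
  Z-line-fix {x} p with b , eq ← line-∋ p = trans (sym eq) (trans (T-cong x four) (^^-fix* T̂ {2 * toℕ b} twice 4))
    where
    open +-*-Solver
    twice : (T̂ ^^ (2 * toℕ b)) x ≡ x
    twice = begin
      (T̂ ^^ (toℕ b + (toℕ b + 0))) x       ≡⟨ cong (λ k → (T̂ ^^ (toℕ b + k)) x) (+-identityʳ (toℕ b)) ⟩
      (T̂ ^^ (toℕ b + toℕ b)) x             ≡⟨ ^^-+ T̂ (toℕ b) (toℕ b) x ⟩
      (T̂ ^^ toℕ b) ((T̂ ^^ toℕ b) x)        ≡⟨ cong (T̂ ^^ toℕ b) eq ⟩
      (T̂ ^^ toℕ b) (Ẑ x)                   ≡⟨ Z-T (toℕ b) x ⟨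
      Ẑ ((T̂ ^^ toℕ b) x)                   ≡⟨ cong Ẑ eq ⟩
      Ẑ (Ẑ x)                              ≡⟨ Z² x ⟩
      x ∎
      where open ≡-Reasoning
    four : toℕ b Mod7.≈ 4 * (2 * toℕ b)
    four = Mod7.congruent (toℕ b) 0 (solve 1 (λ b → b :+ b :* con 7 := con 4 :* (con 2 :* b) :+ con 0) refl (toℕ b))

  -- If S x = Tᵃ x, then T⁻ᵃ x is fixed: S T⁻ᵃ x = T⁻²ᵃ S x = T⁻ᵃ x. Here 6 a stands for -a.
  S-line-fix : ∀ {x} → Ŝ x ∈ line x → ∃ λ y → y ∈ line x × Ŝ y ≡ y
  S-line-fix {x} p with a , eq ← line-∋ p = (T̂ ^^ (6 * toℕ a)) x , line-∈ (6 * toℕ a) x , (begin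
    Ŝ ((T̂ ^^ (6 * toℕ a)) x)                  ≡⟨ S-T (6 * toℕ a) x ⟩
    (T̂ ^^ (2 * (6 * toℕ a))) (Ŝ x)            ≡⟨ cong (T̂ ^^ (2 * (6 * toℕ a))) eq ⟨
    (T̂ ^^ (2 * (6 * toℕ a))) ((T̂ ^^ toℕ a) x) ≡⟨ ^^-+ T̂ (2 * (6 * toℕ a)) (toℕ a) x ⟨
    (T̂ ^^ (2 * (6 * toℕ a) + toℕ a)) x        ≡⟨ T-cong x (Mod7.congruent 0 (toℕ a) (solve 1 (λ a → con 2 :* (con 6 :* a) :+ a :+ con 0 := con 6 :* a :+ a :* con 7) refl (toℕ a))) ⟩
    (T̂ ^^ (6 * toℕ a)) x                      ∎)
    where
    open ≡-Reasoning
    open +-*-Solver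

  -- T S = T⁸ S = S T⁴.
  T-S-fix : ∀ {x} → T̂ x ≡ x → T̂ (Ŝ x) ≡ Ŝ x
  T-S-fix {x} p = trans (T-cong {1} {8} (Ŝ x) (Mod7.congruent 1 0 refl)) (trans (sym (S-T 4 x)) (cong Ŝ (^^-fix T̂ p 4)))

  T-Z-fix : ∀ {x} → T̂ x ≡ x → T̂ (Ẑ x) ≡ Ẑ x
  T-Z-fix {x} p = trans (sym (ZT x)) (cong Ẑ p)

  ^^-preserves : ∀ (P : Fin 70 → Set) (f : Fin 70 → Fin 70) → (∀ {x} → P x → P (f x)) → ∀ m {x} → P x → P ((f ^^ m) x)
  ^^-preserves P f k zero    p = p
  ^^-preserves P f k (suc m) p = k (^^-preserves P f k m p)

  base : (Fin 4 → Fin 70) → Fin 10 → Fin 70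
  base x i = (Ŝ ^^ toℕ (proj₁ (exponents i))) ((Ẑ ^^ toℕ (proj₂ (exponents i))) (x (orbitOf i)))

  -- Base points with these stabilisers let S and Z permute the ten `base` points, without
  -- additional translations. `cover` makes the ten lines disjoint, since they have at most 70
  -- points altogether.
  record Base : Set where
    field
      x     : Fin 4 → Fin 70
      Z₀    : Ẑ (x 0F) ≡ x 0F
      Z₁    : Ẑ (x 1F) ≡ x 1F
      S₀    : Ŝ (x 0F) ≡ x 0F
      S₁    : Ŝ (x 1F) ≡ x 1F
      S₂    : Ŝ (x 2F) ≡ x 2F
      cover : ∀ z → ∃ λ i → z ∈ line (base x i)

  word-line : ∀ {x} → Ẑ x ≡ x → Ŝ x ∈ line x → ∀ a e c → word a e c x ∈ line x
  word-line {x} Zx Sx∈ a e c = subst (λ u → (T̂ ^^ a) ((Ŝ ^^ e) u) ∈ line x) (sym (^^-fix Ẑ Zx c))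
    (line-trans (^^-preserves (_∈ line x) Ŝ (λ v∈ → line-trans Sx∈ (line-S v∈)) e (line-∈ 0 x)) (line-∈ a ((Ŝ ^^ e) x)))

  module _ (O : Fin 70 → Bool) (T-O : ∀ {y} → T (O y) → T (O (T̂ y))) (S-O : ∀ {y} → T (O y) → T (O (Ŝ y))) (Z-O : ∀ {y} → T (O y) → T (O (Ẑ y)))
           {x} (x∈O : T (O x)) (words : ∀ {y} → T (O y) → ∃₂ λ a e → ∃ λ c → word a e c x ≡ y) where

    line-O : ∀ {y z} → T (O y) → z ∈ line y → T (O z)
    line-O y∈ z∈ with a , refl ← line-∋ z∈ = ^^-preserves (λ y → T (O y)) T̂ T-O (toℕ a) y∈

    Z-pow : ∀ c → (Ẑ ^^ c) x ≡ x ⊎ (Ẑ ^^ c) x ≡ Ẑ x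
    Z-pow zero = inj₁ refl
    Z-pow (suc c) with Z-pow c
    ... | inj₁ p = inj₂ (cong Ẑ p)
    ... | inj₂ p = inj₁ (trans (cong Ẑ p) (Z² x))

    S-pow : ∀ e y → (Ŝ ^^ e) y ≡ y ⊎ (Ŝ ^^ e) y ≡ Ŝ y ⊎ (Ŝ ^^ e) y ≡ Ŝ (Ŝ y)
    S-pow zero y = inj₁ refl
    S-pow (suc e) y with S-pow e y
    ... | inj₁ p        = inj₂ (inj₁ (cong Ŝ p))
    ... | inj₂ (inj₁ p) = inj₂ (inj₂ (cong Ŝ p))
    ... | inj₂ (inj₂ p) = inj₁ (trans (cong Ŝ p) (S³ y))

    -- If T fixed x it would fix the whole orbit, and the words in S and Z alone reach at most six
    -- points.
    T-moves : 7 ≤ count O → T̂ x ≢ x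
    T-moves 7≤ Tx≡x = <⇒≱ 7≤ (count-≤ O six in-six)
      where
      six : List (Fin 70)
      six = x ∷ Ŝ x ∷ Ŝ (Ŝ x) ∷ Ẑ x ∷ Ŝ (Ẑ x) ∷ Ŝ (Ŝ (Ẑ x)) ∷ []
      in-six : ∀ y → T (O y) → y ∈ six
      in-six y y∈ with a , e , c , refl ← words y∈ =
        subst (_∈ six) (sym (^^-fix T̂ (^^-preserves (λ y → T̂ y ≡ y) Ŝ T-S-fix e (^^-preserves (λ y → T̂ y ≡ y) Ẑ T-Z-fix c Tx≡x)) a)) (go (Z-pow c))
        where
        go : (Ẑ ^^ c) x ≡ x ⊎ (Ẑ ^^ c) x ≡ Ẑ x → (Ŝ ^^ e) ((Ẑ ^^ c) x) ∈ six
        go (inj₁ p) rewrite p with S-pow e x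
        ... | inj₁ q        = here q
        ... | inj₂ (inj₁ q) = there (here q)
        ... | inj₂ (inj₂ q) = there (there (here q))
        go (inj₂ p) rewrite p with S-pow e (Ẑ x)
        ... | inj₁ q        = there (there (there (here q)))
        ... | inj₂ (inj₁ q) = there (there (there (there (here q))))
        ... | inj₂ (inj₂ q) = there (there (there (there (there (here q)))))

    -- A point of `O` outside L would give one more distinct point than `O` has.
    exhaust : ∀ {L} → Unique L → (∀ {y} → y ∈ L → T (O y)) → count O ≤ length L → ∀ {z} → T (O z) → z ∈ L
    exhaust {L} u h ≤L {z} z∈ with z ∈? L
    ... | yes z∈L = z∈L
    ... | no z∉L = ⊥-elim (<⇒≱ (count-≥ O (All.tabulate (λ {w} w∈ z≡w → z∉L (subst (_∈ L) (sym z≡w) w∈)) ∷ u) (λ { (here refl) → z∈ ; (there w∈) → h w∈ })) ≤L)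

    -- The orbit is a single line of T. The involution then fixes it pointwise, and S has a fixed
    -- point on it.
    orbit7 : count O ≡ 7 → ∃ λ y → Ŝ y ≡ y × Ẑ y ≡ y × (∀ {z} → T (O z) → z ∈ line y)
    orbit7 size = go (S-line-fix (all-in (S-O x∈O)))
      where
      Tx≢x = T-moves (≤-reflexive (sym size))
      all-in : ∀ {z} → T (O z) → z ∈ line x
      all-in = exhaust (line-unique Tx≢x) (line-O x∈O) (≤-reflexive (trans size (sym (length-line x))))
      Zx : Ẑ x ≡ x
      Zx = Z-line-fix (all-in (Z-O x∈O))
      go : (∃ λ y → y ∈ line x × Ŝ y ≡ y) → ∃ λ y → Ŝ y ≡ y × Ẑ y ≡ y × (∀ {z} → T (O z) → z ∈ line y)
      go (y , y∈ , Sy) = y , Sy , Zy (line-∋ y∈) , λ z∈ → line-trans (line-sym y∈) (all-in z∈)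
        where
        Zy : (∃ λ (a : Fin 7) → (T̂ ^^ toℕ a) x ≡ y) → Ẑ y ≡ y
        Zy (a , refl) = trans (Z-T (toℕ a) x) (cong (T̂ ^^ toℕ a) Zx)

    -- If Z x were on the line of x, then Z would fix x and the orbit would be a single line or
    -- would contain two lines and the further point S² x, so it would have 7 or at least 15 points.
    -- Hence the lines of x and Z x fill the orbit, and S cannot interchange them because its order
    -- is odd.
    orbit14 : count O ≡ 14 → ∃ λ y → Ŝ y ≡ y × (∀ {z} → T (O z) → z ∈ line y ⊎ z ∈ line (Ẑ y))
    orbit14 size = go (Ẑ x ∈? line x)
      where
      Tx≢x : T̂ x ≢ x
      Tx≢x = T-moves (≤-trans (m≤m+n 7 7) (≤-reflexive (sym size)))
      disjoint : ∀ {y} → y ∉ line x → ∀ {v} → v ∈ line x × v ∈ line y → ⊥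
      disjoint y∉ (v∈x , v∈y) = y∉ (line-trans v∈x (line-sym v∈y))
      go : Dec (Ẑ x ∈ line x) → ∃ λ y → Ŝ y ≡ y × (∀ {z} → T (O z) → z ∈ line y ⊎ z ∈ line (Ẑ y))
      go (yes Zx∈) = ⊥-elim (none (Ŝ x ∈? line x))
        where
        Zx : Ẑ x ≡ x
        Zx = Z-line-fix Zx∈
        none : Dec (Ŝ x ∈ line x) → ⊥
        none (yes Sx∈) = <⇒≱ (≤-trans (m≤m+n 8 6) (≤-reflexive (sym size))) (≤-trans (count-≤ O (line x) all-in) (≤-reflexive (length-line x)))
          where
          all-in : ∀ y → T (O y) → y ∈ line x
          all-in y y∈ = via (words y∈)
            where
            via : (∃₂ λ a e → ∃ λ c → word a e c x ≡ y) → y ∈ line x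
            via (a , e , c , eq) = subst (_∈ line x) eq (word-line Zx Sx∈ a e c)
        none (no Sx∉) = <⇒≱ (≤-trans (≤-reflexive (cong suc size)) (≤-reflexive (sym len))) (count-≥ O fifteen in-O)
          where
          L = Ŝ (Ŝ x) ∷ line x ++ line (Ŝ x)
          len : length L ≡ 15
          len = cong suc (length-lines x (Ŝ x))
          SSx∉x : Ŝ (Ŝ x) ∉ line x
          SSx∉x p = Sx∉ (line-sym (subst (_∈ line (Ŝ x)) (S³ x) (line-S p)))
          SSx∉Sx : Ŝ (Ŝ x) ∉ line (Ŝ x)
          SSx∉Sx p = Sx∉ (line-sym (line-trans p (subst (_∈ line (Ŝ (Ŝ x))) (S³ x) (line-S p))))
          TSx : T̂ (Ŝ x) ≢ Ŝ x
          TSx p = Tx≢x (subst (λ y → T̂ y ≡ y) (S³ x) (T-S-fix (T-S-fix p)))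
          fifteen : Unique L
          fifteen = All.tabulate (λ {w} w∈ e → absurd (∈-++⁻ (line x) (subst (_∈ line x ++ line (Ŝ x)) (sym e) w∈))) ∷
            ++⁺ (line-unique Tx≢x) (line-unique TSx) (disjoint Sx∉)
            where
            absurd : Ŝ (Ŝ x) ∈ line x ⊎ Ŝ (Ŝ x) ∈ line (Ŝ x) → ⊥
            absurd (inj₁ p) = SSx∉x p
            absurd (inj₂ p) = SSx∉Sx p
          in-O : ∀ {y} → y ∈ L → T (O y)
          in-O (here refl) = S-O (S-O x∈O)
          in-O (there y∈) with ∈-++⁻ (line x) y∈
          ... | inj₁ p = line-O x∈O p
          ... | inj₂ p = line-O (S-O x∈O) p
      go (no Zx∉) = S-case (∈-++⁻ (line x) (all-in (S-O x∈O)))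
        where
        TZx : T̂ (Ẑ x) ≢ Ẑ x
        TZx p = Tx≢x (subst (λ y → T̂ y ≡ y) (Z² x) (T-Z-fix p))
        in-O : ∀ {y} → y ∈ line x ++ line (Ẑ x) → T (O y)
        in-O y∈ with ∈-++⁻ (line x) y∈
        ... | inj₁ p = line-O x∈O p
        ... | inj₂ p = line-O (Z-O x∈O) p
        all-in : ∀ {z} → T (O z) → z ∈ line x ++ line (Ẑ x)
        all-in = exhaust (++⁺ (line-unique Tx≢x) (line-unique TZx) (disjoint Zx∉)) in-O
          (≤-reflexive (trans size (sym (length-lines x (Ẑ x)))))
        fixed : (∃ λ y → y ∈ line x × Ŝ y ≡ y) → ∃ λ y → Ŝ y ≡ y × (∀ {z} → T (O z) → z ∈ line y ⊎ z ∈ line (Ẑ y))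
        fixed (y , y∈ , Sy) = y , Sy , λ z∈ → place (∈-++⁻ (line x) (all-in z∈))
          where
          place : ∀ {z} → z ∈ line x ⊎ z ∈ line (Ẑ x) → z ∈ line y ⊎ z ∈ line (Ẑ y)
          place (inj₁ p) = inj₁ (line-trans (line-sym y∈) p)
          place (inj₂ p) = inj₂ (line-trans (line-Z (line-sym y∈)) p)
        S-case : Ŝ x ∈ line x ⊎ Ŝ x ∈ line (Ẑ x) → ∃ λ y → Ŝ y ≡ y × (∀ {z} → T (O z) → z ∈ line y ⊎ z ∈ line (Ẑ y))
        S-case (inj₁ p) = fixed (S-line-fix p)
        S-case (inj₂ p) = ⊥-elim (Zx∉ (line-trans Sx∈x (line-sym p)))
          where
          ZSx∈x : Ẑ (Ŝ x) ∈ line x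
          ZSx∈x = subst (λ y → Ẑ (Ŝ x) ∈ line y) (Z² x) (line-Z p)
          SSx∈x : Ŝ (Ŝ x) ∈ line x
          SSx∈x = line-trans ZSx∈x (subst (λ y → Ŝ (Ŝ x) ∈ line y) (sym (ZS x)) (line-S p))
          Sx∈x : Ŝ x ∈ line x
          Sx∈x = line-sym (subst (_∈ line (Ŝ x)) (S³ x) (line-S SSx∈x))

-- Isomorphisms and automorphisms of the nine designs.

perm-injective : ∀ {n} (σ : Permutation′ n) {x y} → σ ⟨$⟩ʳ x ≡ σ ⟨$⟩ʳ y → x ≡ y
perm-injective σ eq = trans (sym (inverseˡ σ)) (trans (cong (σ ⟨$⟩ˡ_) eq) (inverseˡ σ))

moves-regular : act (0F , 1F , 0F) ⟨$⟩ʳ rep 3F ≢ rep 3F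
moves-regular ()

stabilises : ∀ r → r ≢ 3F → act (0F , 1F , 0F) ⟨$⟩ʳ rep r ≡ rep r
stabilises 0F _ = refl
stabilises 1F _ = refl
stabilises 2F _ = refl
stabilises 3F r≢3 = ⊥-elim (r≢3 refl)

Invariant : Design → Set
Invariant D = ∀ g → IsAutomorphism D (act g) (act g)

-- A base point outside the regular orbit has a nontrivial stabiliser, so its values cannot be distinct.
module _ {D D′ : Design} (inv′ : Invariant D′)
         (injective : ∀ {y z} → value D (rep 3F) y ≡ value D (rep 3F) z → y ≡ z)
         (σ τ : Permutation′ 70) (iso : ∀ p b → D′ (σ ⟨$⟩ʳ p) (τ ⟨$⟩ʳ b) ≡ D p b) where

  image-injective : ∀ {y z} → value D′ (σ ⟨$⟩ʳ rep 3F) y ≡ value D′ (σ ⟨$⟩ʳ rep 3F) z → y ≡ z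
  image-injective {y} {z} eq = trans (sym (inverseʳ σ)) (trans (cong (σ ⟨$⟩ʳ_) (injective (begin
    value D (rep 3F) (σ ⟨$⟩ˡ y)                          ≡⟨ value-≅ {D = D} {D′} σ τ iso (rep 3F) (σ ⟨$⟩ˡ y) ⟨
    value D′ (σ ⟨$⟩ʳ rep 3F) (σ ⟨$⟩ʳ (σ ⟨$⟩ˡ y))         ≡⟨ cong (value D′ (σ ⟨$⟩ʳ rep 3F)) (inverseʳ σ) ⟩
    value D′ (σ ⟨$⟩ʳ rep 3F) y                           ≡⟨ eq ⟩
    value D′ (σ ⟨$⟩ʳ rep 3F) z                           ≡⟨ cong (value D′ (σ ⟨$⟩ʳ rep 3F)) (inverseʳ σ) ⟨
    value D′ (σ ⟨$⟩ʳ rep 3F) (σ ⟨$⟩ʳ (σ ⟨$⟩ˡ z))         ≡⟨ value-≅ {D = D} {D′} σ τ iso (rep 3F) (σ ⟨$⟩ˡ z) ⟩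
    value D (rep 3F) (σ ⟨$⟩ˡ z)                          ∎))) (inverseʳ σ))
    where open ≡-Reasoning

  image-regular : ∃ λ g → act g ⟨$⟩ʳ rep 3F ≡ σ ⟨$⟩ʳ rep 3F
  image-regular = go (reached (σ ⟨$⟩ʳ rep 3F))
    where
    s : G
    s = 0F , 1F , 0F
    go : (∃₂ λ g r → act g ⟨$⟩ʳ rep r ≡ σ ⟨$⟩ʳ rep 3F) → ∃ λ g → act g ⟨$⟩ʳ rep 3F ≡ σ ⟨$⟩ʳ rep 3F
    go (g , r , eq) with r ≟ 3F
    ... | yes refl = g , eq
    ... | no r≢3 = ⊥-elim (moves-regular (perm-injective (act g) (image-injective (begin
      value D′ (σ ⟨$⟩ʳ rep 3F) (act g ⟨$⟩ʳ (act s ⟨$⟩ʳ rep 3F))  ≡⟨ cong (λ x → value D′ x (act g ⟨$⟩ʳ (act s ⟨$⟩ʳ rep 3F))) eq ⟨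
      value D′ (act g ⟨$⟩ʳ rep r) (act g ⟨$⟩ʳ (act s ⟨$⟩ʳ rep 3F)) ≡⟨ value-≅ {D = D′} {D′} (act g) (act g) (inv′ g) (rep r) _ ⟩
      value D′ (rep r) (act s ⟨$⟩ʳ rep 3F)                       ≡⟨ cong (λ x → value D′ x (act s ⟨$⟩ʳ rep 3F)) (stabilises r r≢3) ⟨
      value D′ (act s ⟨$⟩ʳ rep r) (act s ⟨$⟩ʳ rep 3F)            ≡⟨ value-≅ {D = D′} {D′} (act s) (act s) (inv′ s) (rep r) (rep 3F) ⟩
      value D′ (rep r) (rep 3F)                                  ≡⟨ value-≅ {D = D′} {D′} (act g) (act g) (inv′ g) (rep r) (rep 3F) ⟨
      value D′ (act g ⟨$⟩ʳ rep r) (act g ⟨$⟩ʳ rep 3F)            ≡⟨ cong (λ x → value D′ x (act g ⟨$⟩ʳ rep 3F)) eq ⟩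
      value D′ (σ ⟨$⟩ʳ rep 3F) (act g ⟨$⟩ʳ rep 3F)               ∎))))
      where open ≡-Reasoning

  -- A group element brings the image of the base point back to `rep 3F`, so that the invariants of
  -- both designs are compared at the same base point.
  transfer : ∀ g → act g ⟨$⟩ʳ rep 3F ≡ σ ⟨$⟩ʳ rep 3F → ∀ y → value D (rep 3F) y ≡ value D′ (rep 3F) (act g ⟨$⟩ˡ (σ ⟨$⟩ʳ y))
  transfer g eq y = begin
    value D (rep 3F) y                                       ≡⟨ value-≅ {D = D} {D′} σ τ iso (rep 3F) y ⟨
    value D′ (σ ⟨$⟩ʳ rep 3F) (σ ⟨$⟩ʳ y)                      ≡⟨ cong₂ (value D′) eq (inverseʳ (act g)) ⟨
    value D′ (act g ⟨$⟩ʳ rep 3F) (act g ⟨$⟩ʳ (act g ⟨$⟩ˡ (σ ⟨$⟩ʳ y))) ≡⟨ value-≅ {D = D′} {D′} (act g) (act g) (inv′ g) (rep 3F) _ ⟩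
    value D′ (rep 3F) (act g ⟨$⟩ˡ (σ ⟨$⟩ʳ y))                ∎
    where open ≡-Reasoning

sum-transfer : ∀ {n} (f f′ : Fin n → ℕ) (σ τ : Permutation′ n) → (∀ y → f y ≡ f′ (τ ⟨$⟩ˡ (σ ⟨$⟩ʳ y))) → ΣF f ≡ ΣF f′
sum-transfer {n} f f′ σ τ h = trans (Σ-cong (allFin n) h) (trans (Σ-perm σ (λ y → f′ (τ ⟨$⟩ˡ y))) (Σ-perm (flip τ) f′))

module _ (k : Fin 9) where
  private
    c : Blocks
    c = table (toℕ k)
    checked = good-toD c (forall-Fin goodTable good-tables k)

  injective-Ds : ∀ {y z} → value (Ds k) (rep 3F) y ≡ value (Ds k) (rep 3F) z → y ≡ z
  injective-Ds = value-injective (toD c) (rep 3F) checked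

  total-Ds : ΣF (value (Ds k) (rep 3F)) ≡ total k
  total-Ds = value-total (toD c) (rep 3F) checked

  total-dual : ΣF (value (dual (Ds k)) (rep 3F)) ≡ total′ k
  total-dual = value-total-dual (toD c) (rep 3F) checked

≅-total : ∀ k {D′} → Invariant D′ → Ds k ≅ D′ → total k ≡ ΣF (value D′ (rep 3F))
≅-total k {D′} inv′ (σ , τ , iso) = go (image-regular {Ds k} {D′} inv′ (injective-Ds k) σ τ iso)
  where
  go : (∃ λ g → act g ⟨$⟩ʳ rep 3F ≡ σ ⟨$⟩ʳ rep 3F) → total k ≡ ΣF (value D′ (rep 3F))
  go (g , eq) = trans (sym (total-Ds k)) (sum-transfer (value (Ds k) (rep 3F)) (value D′ (rep 3F)) σ (act g)
    (transfer {Ds k} {D′} inv′ (injective-Ds k) σ τ iso g eq))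

invariant-dual : ∀ k → Invariant (dual (Ds k))
invariant-dual k g p b = byAutos-Ds k g b p

different : Fin 9 → Fin 9 → Bool
different i j = ((total i ≡ᵇ total j) ∨ (total i ≡ᵇ total′ j)) ⟹ ⌊ i ≟ j ⌋

distinct-Ds : ∀ i j → (Ds i ≅ Ds j) ⊎ (Ds i ≅ dual (Ds j)) → i ≡ j
distinct-Ds i j h = ≟-sound (⟹-elim {(total i ≡ᵇ total j) ∨ (total i ≡ᵇ total′ j)} (∀-Fin₂ different refl i j) (go h))
  where
  ∨-introʳ : ∀ a {b} → T b → T (a ∨ b)
  ∨-introʳ true  _ = _
  ∨-introʳ false h = h
  ∨-introˡ : ∀ {a b} → T a → T (a ∨ b)
  ∨-introˡ {true} _ = _
  go : (Ds i ≅ Ds j) ⊎ (Ds i ≅ dual (Ds j)) → T ((total i ≡ᵇ total j) ∨ (total i ≡ᵇ total′ j))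
  go (inj₁ iso) = ∨-introˡ (≡⇒T (trans (≅-total i (byAutos-Ds j) iso) (total-Ds j)))
  go (inj₂ iso) = ∨-introʳ (total i ≡ᵇ total j) (≡⇒T (trans (≅-total i (invariant-dual j) iso) (total-dual j)))

self-dual-only : ∀ k → SelfDual (Ds k) → k ≡ 0F ⊎ k ≡ 1F
self-dual-only k iso = go k (trans (≅-total k (invariant-dual k) iso) (total-dual k))
  where
  go : ∀ k → total k ≡ total′ k → k ≡ 0F ⊎ k ≡ 1F
  go 0F _ = inj₁ refl
  go 1F _ = inj₂ refl
  go 2F ()
  go 3F ()
  go 4F ()
  go 5F ()
  go 6F ()
  go 7F ()
  go 8F ()

-- Two distinct blocks share 8 points, whereas blocks with the same points share 24.
equal-blocks : ∀ D → IsSymmetric-70-24-8 D → ∀ {b c} → (∀ p → D p b ≡ D p c) → b ≡ c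
equal-blocks D sym-D {b} {c} same with b ≟ c
... | yes eq = eq
... | no b≢c = ⊥-elim (24≢8 (trans (sym (proj₁ sym-D c)) (trans (count-cong (λ p → sym (idem (D p b) (D p c) (same p)))) (proj₂ (dual-symmetric D sym-D) b c b≢c))))
  where
  24≢8 : 24 ≢ 8
  24≢8 ()
  idem : ∀ a b → a ≡ b → a ∧ b ≡ b
  idem true  true  _ = refl
  idem false false _ = refl

-- σ and a group element agree at `rep 3F`; injectivity of the invariant extends this to all points,
-- and a block is determined by its points.
fullAut-Ds : ∀ k → FullAutIsG (Ds k)
fullAut-Ds k = act , act , action-Ds k , λ σ τ aut → go σ τ aut (image-regular {Ds k} {Ds k} (byAutos-Ds k) (injective-Ds k) σ τ aut)
  where
  go : ∀ σ τ → IsAutomorphism (Ds k) σ τ → (∃ λ g → act g ⟨$⟩ʳ rep 3F ≡ σ ⟨$⟩ʳ rep 3F) →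
    ∃ λ g → (∀ x → σ ⟨$⟩ʳ x ≡ act g ⟨$⟩ʳ x) × (∀ b → τ ⟨$⟩ʳ b ≡ act g ⟨$⟩ʳ b)
  go σ τ aut (g , eq) = g , points , λ b → equal-blocks (Ds k) (symmetric-Ds k) (blocks b)
    where
    points : ∀ x → σ ⟨$⟩ʳ x ≡ act g ⟨$⟩ʳ x
    points x = trans (sym (inverseʳ (act g))) (cong (act g ⟨$⟩ʳ_) (sym (injective-Ds k (transfer {Ds k} {Ds k} (byAutos-Ds k) (injective-Ds k) σ τ aut g eq x))))
    blocks : ∀ b p → Ds k p (τ ⟨$⟩ʳ b) ≡ Ds k p (act g ⟨$⟩ʳ b)
    blocks b p = begin
      Ds k p (τ ⟨$⟩ʳ b)                                    ≡⟨ cong (λ p → Ds k p (τ ⟨$⟩ʳ b)) (inverseʳ σ) ⟨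
      Ds k (σ ⟨$⟩ʳ (σ ⟨$⟩ˡ p)) (τ ⟨$⟩ʳ b)                  ≡⟨ aut (σ ⟨$⟩ˡ p) b ⟩
      Ds k (σ ⟨$⟩ˡ p) b                                    ≡⟨ byAutos-Ds k g (σ ⟨$⟩ˡ p) b ⟨
      Ds k (act g ⟨$⟩ʳ (σ ⟨$⟩ˡ p)) (act g ⟨$⟩ʳ b)          ≡⟨ cong (λ p → Ds k p (act g ⟨$⟩ʳ b)) (trans (sym (points (σ ⟨$⟩ˡ p))) (inverseʳ σ)) ⟩
      Ds k p (act g ⟨$⟩ʳ b)                                ∎
      where open ≡-Reasoning

-- Base points from the orbit lengths.

elemsG-∈ : ∀ g → g ∈ elemsG
elemsG-∈ (a , e , c) =
  ∈-concat (λ a → concatMap (λ e → map (λ c → (a , e , c)) (allFin 2)) (allFin 3)) (∈-allFin a)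
    (∈-concat (λ e → map (λ c → (a , e , c)) (allFin 2)) (∈-allFin e) (∈-map⁺ (λ c → (a , e , c)) (∈-allFin c)))

_≟ᴳ_ : G → G → Bool
(a , e , c) ≟ᴳ (a′ , e′ , c′) = ⌊ a ≟ a′ ⌋ ∧ ⌊ e ≟ e′ ⌋ ∧ ⌊ c ≟ c′ ⌋

≟ᴳ-sound : ∀ g h → T (g ≟ᴳ h) → g ≡ h
≟ᴳ-sound (a , e , c) (a′ , e′ , c′) t with p , t′ ← ∧-elim {⌊ a ≟ a′ ⌋} t with q , r ← ∧-elim {⌊ e ≟ e′ ⌋} t′ =
  cong₂ _,_ (≟-sound p) (cong₂ _,_ (≟-sound q) (≟-sound r))

inverseᴳ : G → G
inverseᴳ (a , e , c) = (6 * toℕ a * 4 ^ toℕ e) mod 7 , (2 * toℕ e) mod 3 , c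

identityᴳ : G
identityᴳ = 0F , 0F , 0F

inverse-law : ∀ g → inverseᴳ g · g ≡ identityᴳ
inverse-law g@(a , e , c) = ≟ᴳ-sound (inverseᴳ g · g) identityᴳ
  (∀-Fin₃ (λ a e c → (inverseᴳ (a , e , c) · (a , e , c)) ≟ᴳ identityᴳ) refl a e c)

factor-law : ∀ a e c → (a , 0F , 0F) · ((0F , e , 0F) · (0F , 0F , c)) ≡ (a , e , c)
factor-law a e c = ≟ᴳ-sound _ _ (∀-Fin₃ (λ a e c → ((a , 0F , 0F) · ((0F , e , 0F) · (0F , 0F , c))) ≟ᴳ (a , e , c)) refl a e c)

all-fails : ∀ {A : Set} (p : A → Bool) xs → ¬ T (all p xs) → ∃ λ x → ¬ T (p x)
all-fails p []       h = ⊥-elim (h _)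
all-fails p (x ∷ xs) h with T? (p x)
... | yes px = all-fails p xs (λ t → h (∧-intro px t))
... | no ¬px = x , ¬px

four-orbits : ∀ {A : Set} (f : A → ℕ) {xs : List A} → map f xs ↭ 7 ∷ 7 ∷ 14 ∷ 42 ∷ [] →
  ∃ λ r₁ → ∃ λ r₂ → ∃ λ r₃ → ∃ λ r₄ → xs ↭ r₁ ∷ r₂ ∷ r₃ ∷ r₄ ∷ [] × f r₁ ≡ 7 × f r₂ ≡ 7 × f r₃ ≡ 14
four-orbits f {xs} lengths = go (↭-map-inv f {xs} lengths)
  where
  go : (∃ λ ys → 7 ∷ 7 ∷ 14 ∷ 42 ∷ [] ≡ map f ys × xs ↭ ys) →
    ∃ λ r₁ → ∃ λ r₂ → ∃ λ r₃ → ∃ λ r₄ → xs ↭ r₁ ∷ r₂ ∷ r₃ ∷ r₄ ∷ [] × f r₁ ≡ 7 × f r₂ ≡ 7 × f r₃ ≡ 14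
  go (r₁ ∷ r₂ ∷ r₃ ∷ r₄ ∷ [] , eq , p) = r₁ , r₂ , r₃ , r₄ , p , e₁ eq , e₂ eq , e₃ eq
    where
    e₁ : ∀ {a b c d a′ b′ c′ d′ : ℕ} → _≡_ {A = List ℕ} (a ∷ b ∷ c ∷ d ∷ []) (a′ ∷ b′ ∷ c′ ∷ d′ ∷ []) → a′ ≡ a
    e₁ refl = refl
    e₂ : ∀ {a b c d a′ b′ c′ d′ : ℕ} → _≡_ {A = List ℕ} (a ∷ b ∷ c ∷ d ∷ []) (a′ ∷ b′ ∷ c′ ∷ d′ ∷ []) → b′ ≡ b
    e₂ refl = refl
    e₃ : ∀ {a b c d a′ b′ c′ d′ : ℕ} → _≡_ {A = List ℕ} (a ∷ b ∷ c ∷ d ∷ []) (a′ ∷ b′ ∷ c′ ∷ d′ ∷ []) → c′ ≡ c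
    e₃ refl = refl
  go ([] , () , _)
  go (_ ∷ [] , () , _)
  go (_ ∷ _ ∷ [] , () , _)
  go (_ ∷ _ ∷ _ ∷ [] , () , _)
  go (_ ∷ _ ∷ _ ∷ _ ∷ _ ∷ _ , () , _)

collect≡map-filter : ∀ {A : Set} (p : A → Bool) (f : A → ℕ) xs →
  foldr (λ x acc → if p x then f x ∷ acc else acc) [] xs ≡ map f (filterᵇ p xs)
collect≡map-filter p f [] = refl
collect≡map-filter p f (x ∷ xs) with p x
... | true  = cong (f x ∷_) (collect≡map-filter p f xs)
... | false = collect≡map-filter p f xs

not-least : ∀ {n} (O : Fin n → Fin n → Bool) y → ¬ T (all (λ w → not (O y w) ∨ (toℕ y ≤ᵇ toℕ w)) (allFin n)) →
  ∃ λ w → T (O y w) × toℕ w < toℕ y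
not-least {n} O y h = analyse (all-fails (λ w → not (O y w) ∨ (toℕ y ≤ᵇ toℕ w)) (allFin n) h)
  where
  split-∨ : ∀ a b → ¬ T (not a ∨ b) → T a × ¬ T b
  split-∨ true  b h = _ , h
  split-∨ false b h = ⊥-elim (h _)
  analyse : (∃ λ w → ¬ T (not (O y w) ∨ (toℕ y ≤ᵇ toℕ w))) → ∃ λ w → T (O y w) × toℕ w < toℕ y
  analyse (w , h) = w , proj₁ both , ≰⇒> (λ y≤w → proj₂ both (≤⇒≤ᵇ y≤w))
    where both = split-∨ (O y w) (toℕ y ≤ᵇ toℕ w) h

module FromAction (ρ : G → Permutation′ 70) (hom : ∀ g h x → ρ (g · h) ⟨$⟩ʳ x ≡ ρ g ⟨$⟩ʳ (ρ h ⟨$⟩ʳ x)) where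

  _▸_ : G → Fin 70 → Fin 70
  g ▸ x = ρ g ⟨$⟩ʳ x

  ▸-injective : ∀ g {x y} → g ▸ x ≡ g ▸ y → x ≡ y
  ▸-injective g eq = trans (sym (inverseˡ (ρ g))) (trans (cong (ρ g ⟨$⟩ˡ_) eq) (inverseˡ (ρ g)))

  -- The identity is idempotent in the group, and an injective idempotent map is trivial.
  identity : ∀ x → identityᴳ ▸ x ≡ x
  identity x = ▸-injective identityᴳ (sym (hom identityᴳ identityᴳ x))

  t s z : G
  t = 1F , 0F , 0F
  s = 0F , 1F , 0F
  z = 0F , 0F , 1F

  t-power : ∀ (a : Fin 7) x → (a , 0F , 0F) ▸ x ≡ ((t ▸_) ^^ toℕ a) x
  t-power a x = go a
    where
    p₂ = hom t t x
    p₃ = trans (hom t (2F , 0F , 0F) x) (cong (t ▸_) p₂)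
    p₄ = trans (hom t (3F , 0F , 0F) x) (cong (t ▸_) p₃)
    p₅ = trans (hom t (4F , 0F , 0F) x) (cong (t ▸_) p₄)
    go : ∀ (a : Fin 7) → (a , 0F , 0F) ▸ x ≡ ((t ▸_) ^^ toℕ a) x
    go 0F = identity x
    go 1F = refl
    go 2F = p₂
    go 3F = p₃
    go 4F = p₄
    go 5F = p₅
    go 6F = trans (hom t (5F , 0F , 0F) x) (cong (t ▸_) p₅)

  s-power : ∀ (e : Fin 3) x → (0F , e , 0F) ▸ x ≡ ((s ▸_) ^^ toℕ e) x
  s-power 0F x = identity x
  s-power 1F x = refl
  s-power 2F x = hom s s x

  z-power : ∀ (c : Fin 2) x → (0F , 0F , c) ▸ x ≡ ((z ▸_) ^^ toℕ c) x
  z-power 0F x = identity x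
  z-power 1F x = refl

  generators : Generators
  generators = record
    { T̂ = t ▸_ ; Ŝ = s ▸_ ; Ẑ = z ▸_
    ; T⁷ = λ x → trans (cong (t ▸_) (sym (t-power 6F x))) (trans (sym (hom t (6F , 0F , 0F) x)) (identity x))
    ; S³ = λ x → trans (cong (s ▸_) (sym (s-power 2F x))) (trans (sym (hom s (0F , 2F , 0F) x)) (identity x))
    ; Z² = λ x → trans (sym (hom z z x)) (identity x)
    ; ST = λ x → trans (sym (hom s t x)) (trans (hom t (1F , 1F , 0F) x) (cong (t ▸_) (hom t s x)))
    ; ZT = λ x → trans (sym (hom z t x)) (hom t z x)
    ; ZS = λ x → trans (sym (hom z s x)) (hom s z x)
    }

  open Generators generators

  word≡ : ∀ a e c x → (a , e , c) ▸ x ≡ word (toℕ a) (toℕ e) (toℕ c) x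
  word≡ a e c x = begin
    (a , e , c) ▸ x                                          ≡⟨ cong (_▸ x) (factor-law a e c) ⟨
    ((a , 0F , 0F) · ((0F , e , 0F) · (0F , 0F , c))) ▸ x    ≡⟨ hom (a , 0F , 0F) ((0F , e , 0F) · (0F , 0F , c)) x ⟩
    (a , 0F , 0F) ▸ (((0F , e , 0F) · (0F , 0F , c)) ▸ x)    ≡⟨ t-power a _ ⟩
    (T̂ ^^ toℕ a) (((0F , e , 0F) · (0F , 0F , c)) ▸ x)       ≡⟨ cong (T̂ ^^ toℕ a) (hom (0F , e , 0F) (0F , 0F , c) x) ⟩
    (T̂ ^^ toℕ a) ((0F , e , 0F) ▸ ((0F , 0F , c) ▸ x))       ≡⟨ cong (T̂ ^^ toℕ a) (trans (s-power e _) (cong (Ŝ ^^ toℕ e) (z-power c x))) ⟩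
    word (toℕ a) (toℕ e) (toℕ c) x ∎
    where open ≡-Reasoning

  orbit-elim : ∀ {x y} → T (inOrbit ρ x y) → ∃ λ g → g ▸ x ≡ y
  orbit-elim {x} {y} h with g , _ , p ← find (any⁻ (λ g → ⌊ ρ g ⟨$⟩ʳ x ≟ y ⌋) elemsG h) = g , ≟-sound p

  orbit-intro : ∀ {x y} g → g ▸ x ≡ y → T (inOrbit ρ x y)
  orbit-intro {x} {y} g eq = any⁺ (λ g → ⌊ ρ g ⟨$⟩ʳ x ≟ y ⌋) (lose (elemsG-∈ g) (fromWitness eq))

  orbit-step : ∀ h {x y} → T (inOrbit ρ x y) → T (inOrbit ρ x (h ▸ y))
  orbit-step h {x} p with g , refl ← orbit-elim p = orbit-intro (h · g) (hom h g x)

  orbit-refl : ∀ x → T (inOrbit ρ x x)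
  orbit-refl x = orbit-intro identityᴳ (identity x)

  orbit-back : ∀ {x y} → T (inOrbit ρ x y) → ∃ λ h → h ▸ y ≡ x
  orbit-back {x} p with g , refl ← orbit-elim p =
    inverseᴳ g , trans (sym (hom (inverseᴳ g) g x)) (trans (cong (_▸ x) (inverse-law g)) (identity x))

  orbit-words : ∀ {x y} → T (inOrbit ρ x y) → ∃₂ λ a e → ∃ λ c → word a e c x ≡ y
  orbit-words {x} p with (a , e , c) , eq ← orbit-elim p = toℕ a , toℕ e , toℕ c , trans (sym (word≡ a e c x)) eq

  Represented : Fin 70 → Set
  Represented y = ∃ λ r → T (isRep ρ r) × T (inOrbit ρ r y)

  represented-back : ∀ {y w} → T (inOrbit ρ y w) → Represented w → Represented y
  represented-back p (r , rep , r∋w) = r , rep , back (orbit-back p)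
    where
    back : (∃ λ h → h ▸ _ ≡ _) → T (inOrbit ρ r _)
    back (h , refl) = orbit-step h r∋w

  -- `isRep` singles out the least point of an orbit; a point that is not least has a smaller one in
  -- its orbit, and the descent is well-founded.
  representative : ∀ y → Represented y
  representative y = go y (<-wellFounded (toℕ y))
    where
    go : ∀ y → Acc _<_ (toℕ y) → Represented y
    go y (acc rec) = decide (T? (isRep ρ y))
      where
      smaller : (∃ λ w → T (inOrbit ρ y w) × toℕ w < toℕ y) → Represented y
      smaller (w , p , w<y) = represented-back p (go w (rec w<y))
      decide : Dec (T (isRep ρ y)) → Represented y
      decide (yes r) = y , r , orbit-refl y
      decide (no ¬r) = smaller (not-least (inOrbit ρ) y ¬r)


  reps : List (Fin 70)
  reps = filterᵇ (isRep ρ) (allFin 70)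

  orbit-of-7 : ∀ {r} → orbitSize ρ r ≡ 7 → ∃ λ y → Ŝ y ≡ y × Ẑ y ≡ y × (∀ {z} → T (inOrbit ρ r z) → z ∈ line y)
  orbit-of-7 {r} = orbit7 (inOrbit ρ r) (orbit-step t) (orbit-step s) (orbit-step z) (orbit-refl r) orbit-words

  orbit-of-14 : ∀ {r} → orbitSize ρ r ≡ 14 → ∃ λ y → Ŝ y ≡ y × (∀ {z} → T (inOrbit ρ r z) → z ∈ line y ⊎ z ∈ line (Ẑ y))
  orbit-of-14 {r} = orbit14 (inOrbit ρ r) (orbit-step t) (orbit-step s) (orbit-step z) (orbit-refl r) orbit-words

  module Bases {r₁ r₂ r₃ r₄ y₁ y₂ y₃ : Fin 70} {Rep : Fin 70 → Set} (rep∈ : ∀ {r} → Rep r → r ∈ r₁ ∷ r₂ ∷ r₃ ∷ r₄ ∷ [])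
           (in₁ : ∀ {w} → T (inOrbit ρ r₁ w) → w ∈ line y₁) (in₂ : ∀ {w} → T (inOrbit ρ r₂ w) → w ∈ line y₂)
           (in₃ : ∀ {w} → T (inOrbit ρ r₃ w) → w ∈ line y₃ ⊎ w ∈ line (Ẑ y₃)) where

    x : Fin 4 → Fin 70
    x 0F = y₁
    x 1F = y₂
    x 2F = y₃
    x 3F = r₄

    regular : ∀ a e c → ∃ λ i → word (toℕ {7} a) (toℕ {3} e) (toℕ {2} c) r₄ ∈ line (base x i)
    regular a 0F 0F = 4F , line-∈ (toℕ a) (base x 4F)
    regular a 0F 1F = 5F , line-∈ (toℕ a) (base x 5F)
    regular a 1F 0F = 6F , line-∈ (toℕ a) (base x 6F)
    regular a 1F 1F = 7F , line-∈ (toℕ a) (base x 7F)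
    regular a 2F 0F = 8F , line-∈ (toℕ a) (base x 8F)
    regular a 2F 1F = 9F , line-∈ (toℕ a) (base x 9F)

    fromRegular : ∀ {w} → (∃ λ g → g ▸ r₄ ≡ w) → ∃ λ i → w ∈ line (base x i)
    fromRegular ((a , e , c) , eq) = proj₁ (regular a e c) ,
      subst (_∈ line (base x (proj₁ (regular a e c)))) (trans (sym (word≡ a e c r₄)) eq) (proj₂ (regular a e c))

    from14 : ∀ {w} → w ∈ line y₃ ⊎ w ∈ line (Ẑ y₃) → ∃ λ i → w ∈ line (base x i)
    from14 (inj₁ q) = 2F , q
    from14 (inj₂ q) = 3F , q

    covered : ∀ {w r} → r ∈ r₁ ∷ r₂ ∷ r₃ ∷ r₄ ∷ [] → T (inOrbit ρ r w) → ∃ λ i → w ∈ line (base x i)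
    covered (here refl) r∋w = 0F , in₁ r∋w
    covered (there (here refl)) r∋w = 1F , in₂ r∋w
    covered (there (there (here refl))) r∋w = from14 (in₃ r∋w)
    covered (there (there (there (here refl)))) r∋w = fromRegular (orbit-elim r∋w)

    cover : ∀ w → (∃ λ r → Rep r × T (inOrbit ρ r w)) → ∃ λ i → w ∈ line (base x i)
    cover w (r , isr , r∋w) = covered (rep∈ isr) r∋w

  fromOrbits : ∀ {Rep : Fin 70 → Set} {r₁ r₂ r₃ r₄ : Fin 70} → (∀ {r} → Rep r → r ∈ r₁ ∷ r₂ ∷ r₃ ∷ r₄ ∷ []) → (∀ w → ∃ λ r → Rep r × T (inOrbit ρ r w)) →
    (∃ λ y → Ŝ y ≡ y × Ẑ y ≡ y × (∀ {z} → T (inOrbit ρ r₁ z) → z ∈ line y)) →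
    (∃ λ y → Ŝ y ≡ y × Ẑ y ≡ y × (∀ {z} → T (inOrbit ρ r₂ z) → z ∈ line y)) →
    (∃ λ y → Ŝ y ≡ y × (∀ {z} → T (inOrbit ρ r₃ z) → z ∈ line y ⊎ z ∈ line (Ẑ y))) → Base
  fromOrbits {Rep} rep∈ represented (y₁ , S₁ , Z₁ , in₁) (y₂ , S₂ , Z₂ , in₂) (y₃ , S₃ , in₃) =
    record { x = Bx.x ; Z₀ = Z₁ ; Z₁ = Z₂ ; S₀ = S₁ ; S₁ = S₂ ; S₂ = S₃ ; cover = λ w → Bx.cover w (represented w) }
    where module Bx = Bases {Rep = Rep} rep∈ in₁ in₂ in₃

  fromFour : (∃ λ r₁ → ∃ λ r₂ → ∃ λ r₃ → ∃ λ r₄ → reps ↭ r₁ ∷ r₂ ∷ r₃ ∷ r₄ ∷ [] × orbitSize ρ r₁ ≡ 7 × orbitSize ρ r₂ ≡ 7 × orbitSize ρ r₃ ≡ 14) → Base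
  fromFour (r₁ , r₂ , r₃ , r₄ , p , e₁ , e₂ , e₃) = fromOrbits {Rep = λ r → T (isRep ρ r)}
    (λ {r} isr → ∈-resp-↭ p (∈-filter (isRep ρ) (∈-allFin r) isr)) representative (orbit-of-7 e₁) (orbit-of-7 e₂) (orbit-of-14 e₃)

  bases : orbitLengths ρ ↭ 7 ∷ 7 ∷ 14 ∷ 42 ∷ [] → Base
  bases lengths = fromFour (four-orbits (orbitSize ρ) {reps}
    (↭-trans (↭-reflexive (sym (collect≡map-filter (isRep ρ) (orbitSize ρ) (allFin 70)))) lengths))

-- Coordinates and the circulant form of the incidence matrix.

-- g is injective because f undoes it; on a finite set it is therefore onto, and f is a two-sided
-- inverse.
section-inverse : ∀ {n} (f g : Fin n → Fin n) → (∀ z → f (g z) ≡ z) → ∀ y → g (f y) ≡ y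
section-inverse {n} f g fg y = go (unique-⊆ (map⁺ g-injective (allFin⁺ n)) (λ {x} _ → ∈-allFin x))
  where
  g-injective : ∀ {x z} → g x ≡ g z → x ≡ z
  g-injective {x} {z} eq = trans (sym (fg x)) (trans (cong f eq) (fg z))
  go : (∃ λ zs → _) → g (f y) ≡ y
  go ([] , p) = preimage (∈-map⁻ g (subst (y ∈_) (++-identityʳ (map g (allFin n))) (∈-resp-↭ p (∈-allFin y))))
    where
    open import Data.List.Properties using (++-identityʳ)
    preimage : (∃ λ x → x ∈ allFin n × y ≡ g x) → g (f y) ≡ y
    preimage (x , _ , refl) = cong g (fg x)
  go (z ∷ zs , p) = ⊥-elim (m+1+n≢m (length (allFin n)) (sym (trans (↭-length p) (trans (length-++ (map g (allFin n))) (cong (_+ suc (length zs)) (length-map g (allFin n)))))))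

Σ-grid : ∀ {A X : Set} (xs : List A) (ys : List X) (f : A × X → ℕ) →
  Σ⟨ concatMap (λ i → map (i ,_) ys) xs ⟩ f ≡ Σ⟨ xs ⟩ (λ i → Σ⟨ ys ⟩ (λ b → f (i , b)))
Σ-grid []       ys f = refl
Σ-grid (x ∷ xs) ys f = trans (cong sum (map-++ f (map (x ,_) ys) _)) (trans (sum-++ (map f (map (x ,_) ys)) _)
  (cong₂ _+_ (Σ-map (x ,_) ys f) (Σ-grid xs ys f)))

Σ-join : ∀ (ls : List Point) → allFin 70 ≡ map join ls → (f : Point → ℕ) → ΣF (λ x → f (split x)) ≡ Σ⟨ ls ⟩ f
Σ-join ls eq f = trans (cong (λ l → Σ⟨ l ⟩ (λ x → f (split x))) eq) (trans (Σ-map join ls _) (Σ-cong ls (λ p → cong f (split-join p))))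

-- The summation order is the one in which corr unfolds.
sum7 : (ℕ → ℕ) → ℕ
sum7 k = k 0 + (k 6 + (k 5 + (k 4 + (k 3 + (k 2 + k 1)))))

Σ-allFin7 : ∀ (k : ℕ → ℕ) → Σ⟨ allFin 7 ⟩ (λ b → k (toℕ b)) ≡ sum7 k
Σ-allFin7 k = solve 7 (λ a b c d e f g → a :+ (b :+ (c :+ (d :+ (e :+ (f :+ (g :+ con 0)))))) := a :+ (g :+ (f :+ (e :+ (d :+ (c :+ b))))))
  refl (k 0) (k 1) (k 2) (k 3) (k 4) (k 5) (k 6)
  where open +-*-Solver

Σ-allFin10 : ∀ (k : Fin 10 → ℕ) → Σ⟨ allFin 10 ⟩ k ≡ sum10 k
Σ-allFin10 k = solve 10 (λ a b c d e f g h i j → a :+ (b :+ (c :+ (d :+ (e :+ (f :+ (g :+ (h :+ (i :+ (j :+ con 0))))))))) := a :+ (b :+ (c :+ (d :+ (e :+ (f :+ (g :+ (h :+ (i :+ j)))))))))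
  refl (k 0F) (k 1F) (k 2F) (k 3F) (k 4F) (k 5F) (k 6F) (k 7F) (k 8F) (k 9F)
  where open +-*-Solver

Σ-points : ∀ (h : Fin 10 → ℕ → ℕ) → ΣF (λ x → h (proj₁ (split x)) (toℕ (proj₂ (split x)))) ≡ sum10 (λ j → sum7 (h j))
Σ-points h = trans (Σ-join pairs70 allFin70≡ (λ { (i , b) → h i (toℕ b) })) (trans (Σ-grid (allFin 10) (allFin 7) (λ { (i , b) → h i (toℕ b) }))
  (trans (Σ-cong (allFin 10) (λ j → Σ-allFin7 (h j))) (Σ-allFin10 (λ j → sum7 (h j)))))

vec : (ℕ → ℕ) → V7
vec f = v7 (f 0) (f 1) (f 2) (f 3) (f 4) (f 5) (f 6)

vec-cong : ∀ {f g : ℕ → ℕ} → (∀ n → f n ≡ g n) → vec f ≡ vec g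
vec-cong h = v7-≡ (h 0) (h 1) (h 2) (h 3) (h 4) (h 5) (h 6)

corr-sum : (f g : Fin 10 → ℕ → ℕ) → fold10 _⊕_ (λ j → corr (vec (f j)) (vec (g j))) ≡ vec (λ d → sum10 (λ j → sum7 (λ b → g j b * f j ((d + b) % 7))))
corr-sum f g = refl

module Frame (P : Generators) (X : Generators.Base P) where
  open Generators P
  open Base X

  φ : Fin 10 → ℕ → Fin 70
  φ i a = (T̂ ^^ a) (base x i)

  S-base : ∀ i → Ŝ (base x i) ≡ base x (σ i)
  S-base 0F = S₀
  S-base 1F = S₁
  S-base 2F = S₂
  S-base 3F = trans (sym (ZS (x 2F))) (cong Ẑ S₂)
  S-base 4F = refl
  S-base 5F = refl
  S-base 6F = refl
  S-base 7F = refl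
  S-base 8F = S³ (x 3F)
  S-base 9F = S³ (Ẑ (x 3F))

  Z-base : ∀ i → Ẑ (base x i) ≡ base x (ζ i)
  Z-base 0F = Z₀
  Z-base 1F = Z₁
  Z-base 2F = refl
  Z-base 3F = Z² (x 2F)
  Z-base 4F = refl
  Z-base 5F = Z² (x 3F)
  Z-base 6F = ZS (x 3F)
  Z-base 7F = trans (ZS _) (cong Ŝ (Z² (x 3F)))
  Z-base 8F = Z-S 2 (x 3F)
  Z-base 9F = trans (Z-S 2 (Ẑ (x 3F))) (cong (Ŝ ∘ Ŝ) (Z² (x 3F)))

  locate : ∀ z → ∃ λ p → φ (proj₁ p) (toℕ (proj₂ {B = λ _ → Fin 7} p)) ≡ z
  locate z = go (cover z)
    where
    go : (∃ λ i → z ∈ line (base x i)) → ∃ λ p → φ (proj₁ p) (toℕ (proj₂ {B = λ _ → Fin 7} p)) ≡ z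
    go (i , z∈) = (i , proj₁ (line-∋ z∈)) , proj₂ (line-∋ z∈)

  place : Fin 70 → Fin 70
  place y = φ (proj₁ (split y)) (toℕ (proj₂ (split y)))

  place⁻ : Fin 70 → Fin 70
  place⁻ z = join (proj₁ (locate z))

  place-place⁻ : ∀ z → place (place⁻ z) ≡ z
  place-place⁻ z = trans (cong (λ p → φ (proj₁ p) (toℕ (proj₂ p))) (split-join (proj₁ (locate z)))) (proj₂ (locate z))

  -- The ten lines cover the 70 points, so `place` is onto and hence bijective. Disjointness of the
  -- lines and regularity of the fourth orbit both come from this count.
  Φ : Permutation′ 70
  Φ = permutation place place⁻ place-place⁻ (section-inverse place place⁻ place-place⁻)

  φ-injective : ∀ {i k} (a b : Fin 7) → φ i (toℕ a) ≡ φ k (toℕ b) → (i , a) ≡ (k , b)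
  φ-injective {i} {k} a b eq = join-injective (perm-injective Φ (trans (at-join (i , a)) (trans eq (sym (at-join (k , b))))))
    where
    at-join : ∀ p → place (join p) ≡ φ (proj₁ p) (toℕ (proj₂ p))
    at-join p = cong (λ p → φ (proj₁ p) (toℕ (proj₂ p))) (split-join p)

module Structured (D : Design) (P Q : Generators)
  (inv-T : ∀ p b → D (Generators.T̂ P p) (Generators.T̂ Q b) ≡ D p b) (inv-S : ∀ p b → D (Generators.Ŝ P p) (Generators.Ŝ Q b) ≡ D p b) (inv-Z : ∀ p b → D (Generators.Ẑ P p) (Generators.Ẑ Q b) ≡ D p b)
  where
  private
    module P = Generators P
    module Q = Generators Q

  inv-T^ : ∀ k p b → D ((P.T̂ ^^ k) p) ((Q.T̂ ^^ k) b) ≡ D p b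
  inv-T^ zero    p b = refl
  inv-T^ (suc k) p b = trans (inv-T _ _) (inv-T^ k p b)

  entry : Fin 70 → Fin 70 → ℕ → ℕ
  entry p q n = 𝟙 (D p ((Q.T̂ ^^ n) q))

  entry-mod : ∀ p q {m n} → m Mod7.≈ n → entry p q m ≡ entry p q n
  entry-mod p q h = cong (λ b → 𝟙 (D p b)) (Q.T-cong q h)

  at-entry : ∀ p q n → at (vec (entry p q)) n ≡ entry p q n
  at-entry p q n = trans (go (n % 7) (m%n<n n 7)) (entry-mod p q (Mod7.%≈ n))
    where
    go : ∀ r → r < 7 → digit (vec (entry p q)) r ≡ entry p q r
    go 0 _ = refl
    go 1 _ = refl
    go 2 _ = refl
    go 3 _ = refl
    go 4 _ = refl
    go 5 _ = refl
    go 6 _ = refl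
    go (suc (suc (suc (suc (suc (suc (suc _))))))) (s≤s (s≤s (s≤s (s≤s (s≤s (s≤s (s≤s ())))))))

  D-shift : ∀ k p b q → D ((P.T̂ ^^ (k * 6)) p) ((Q.T̂ ^^ b) q) ≡ D p ((Q.T̂ ^^ (k + b)) q)
  D-shift k p b q = trans (sym (inv-T^ k _ _)) (cong₂ D
    (trans (sym (^^-+ P.T̂ k (k * 6) p)) (trans (cong (λ n → (P.T̂ ^^ n) p) (solve 1 (λ k → k :+ k :* con 6 := k :* con 7) refl k)) (P.T^7 k p)))
    (sym (^^-+ Q.T̂ k b q)))
    where open +-*-Solver

  -- Invariance under T makes incidence depend on b - a only; 6 a stands for -a.
  D-unshift : ∀ a p b q → D ((P.T̂ ^^ a) p) ((Q.T̂ ^^ b) q) ≡ D p ((Q.T̂ ^^ (b + 6 * a)) q)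
  D-unshift a p b q = trans (cong (λ x → D x _) (P.T-cong p (Mod7.congruent (5 * a) 0 (solve 1 (λ a → a :+ con 5 :* a :* con 7 := con 6 :* a :* con 6 :+ con 0) refl a))))
    (trans (D-shift (6 * a) p b q) (cong (λ n → D p ((Q.T̂ ^^ n) q)) (+-comm (6 * a) b)))
    where open +-*-Solver

  entry-S : ∀ p q {m n} → n Mod7.≈ 2 * m → entry (P.Ŝ p) (Q.Ŝ q) n ≡ entry p q m
  entry-S p q {m} {n} h = trans (entry-mod (P.Ŝ p) (Q.Ŝ q) h) (cong 𝟙 (trans (cong (D (P.Ŝ p)) (sym (Q.S-T m q))) (inv-S p _)))

  -- S Tᵐ = T²ᵐ S moves position m to 2 m, which is the effect of `θ`.
  vec-entry-S : ∀ p q → vec (entry (P.Ŝ p) (Q.Ŝ q)) ≡ θ (vec (entry p q))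
  vec-entry-S p q = v7-≡ (e 0 0 (Mod7.congruent 0 0 refl)) (e 4 1 (Mod7.congruent 1 0 refl)) (e 1 2 (Mod7.congruent 0 0 refl)) (e 5 3 (Mod7.congruent 1 0 refl))
                         (e 2 4 (Mod7.congruent 0 0 refl)) (e 6 5 (Mod7.congruent 1 0 refl)) (e 3 6 (Mod7.congruent 0 0 refl))
    where
    e : ∀ m n → n Mod7.≈ 2 * m → entry (P.Ŝ p) (Q.Ŝ q) n ≡ entry p q m
    e m n = entry-S p q {m} {n}

  entry-Z : ∀ p q n → entry (P.Ẑ p) (Q.Ẑ q) n ≡ entry p q n
  entry-Z p q n = cong 𝟙 (trans (cong (D (P.Ẑ p)) (sym (Q.Z-T n q))) (inv-Z p _))

  module Blocked (X : P.Base) (Y : Q.Base) where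
    module FX = Frame P X
    module FY = Frame Q Y
    private
      x = P.Base.x X
      y = Q.Base.x Y

    c : Blocks
    c i j = vec (entry (P.base x i) (Q.base y j))

    D-E : ∀ i a j b → D (FX.φ i a) (FY.φ j b) ≡ (at (c i j) (b + 6 * a) ≡ᵇ 1)
    D-E i a j b = trans (D-unshift a (P.base x i) b (Q.base y j)) (sym (trans (cong (_≡ᵇ 1) (at-entry (P.base x i) (Q.base y j) (b + 6 * a))) (𝟙-≡ᵇ _)))
      where
      𝟙-≡ᵇ : ∀ v → (𝟙 v ≡ᵇ 1) ≡ v
      𝟙-≡ᵇ true  = refl
      𝟙-≡ᵇ false = refl

    D≅toD : D ≅ toD c
    D≅toD = flip FX.Φ , flip FY.Φ , λ p b → trans (sym (through (FX.Φ ⟨$⟩ˡ p) (FY.Φ ⟨$⟩ˡ b))) (cong₂ D (inverseʳ FX.Φ) (inverseʳ FY.Φ))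
      where
      through : ∀ p b → D (FX.place p) (FY.place b) ≡ toD c p b
      through p b = D-E (proj₁ (split p)) (toℕ (proj₂ (split p))) (proj₁ (split b)) (toℕ (proj₂ (split b)))

    module _ (rowSums : ∀ p → ΣF (λ q → 𝟙 (D p q)) ≡ 24) (pairs : ∀ p q → p ≢ q → ΣF (λ b → 𝟙 (D p b) * 𝟙 (D q b)) ≡ 8) where

      Σ-blocks : ∀ (h : Fin 70 → ℕ) → ΣF h ≡ sum10 (λ j → sum7 (λ b → h (FY.φ j b)))
      Σ-blocks h = trans (sym (Σ-perm FY.Φ h)) (Σ-points (λ j b → h (FY.φ j b)))

      -- 6 d stands for -d: the coefficient at d counts the blocks through the base point of class k
      -- and the base point of class i moved by T⁻ᵈ.
      meeting : ℕ → Fin 10 → Fin 10 → ℕ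
      meeting d i k = ΣF (λ q → 𝟙 (D (FX.φ k 0) q) * 𝟙 (D (FX.φ i (d * 6)) q))

      corrs-meeting : ∀ i k → corrs c i k ≡ vec (λ d → meeting d i k)
      corrs-meeting i k = trans (corr-sum (λ j → entry (P.base x i) (Q.base y j)) (λ j → entry (P.base x k) (Q.base y j))) (vec-cong λ d →
        trans (fold10-cong _+_ (λ j → sum7-cong (λ b → cong (entry (P.base x k) (Q.base y j) b *_)
          (trans (entry-mod (P.base x i) (Q.base y j) (Mod7.%≈ (d + b))) (cong 𝟙 (sym (D-shift d (P.base x i) b (Q.base y j))))))))
        (sym (Σ-blocks (λ q → 𝟙 (D (FX.φ k 0) q) * 𝟙 (D (FX.φ i (d * 6)) q)))))
        where
        sum7-cong : ∀ {f g : ℕ → ℕ} → (∀ b → f b ≡ g b) → sum7 f ≡ sum7 g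
        sum7-cong h = cong₂ _+_ (h 0) (cong₂ _+_ (h 6) (cong₂ _+_ (h 5) (cong₂ _+_ (h 4) (cong₂ _+_ (h 3) (cong₂ _+_ (h 2) (h 1))))))

      φ-mod : ∀ i n → FX.φ i n ≡ FX.φ i (toℕ (n mod 7))
      φ-mod i n = P.T-cong (P.base x i) (Mod7.≈-sym (mod7≈ n))

      meeting-8 : ∀ d i k → (k , 0F) ≢ (i , (d * 6) mod 7) → meeting d i k ≡ 8
      meeting-8 d i k ≢ = pairs (FX.φ k 0) (FX.φ i (d * 6)) (λ eq → ≢ (FX.φ-injective 0F ((d * 6) mod 7) (trans eq (φ-mod i (d * 6)))))

      meeting-24 : ∀ i → meeting 0 i i ≡ 24
      meeting-24 i = trans (Σ-cong (allFin 70) (λ q → 𝟙-idem (D (FX.φ i 0) q))) (rowSums (FX.φ i 0))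

      half : Half c
      half = record
        { isBit  = λ i j → each (b i j 0) (b i j 1) (b i j 2) (b i j 3) (b i j 4) (b i j 5) (b i j 6)
        ; σ-inv  = λ i j → trans (sym (cong₂ (λ p q → vec (entry p q)) (FX.S-base i) (FY.S-base j))) (vec-entry-S _ _)
        ; ζ-inv  = λ i j → trans (sym (cong₂ (λ p q → vec (entry p q)) (FX.Z-base i) (FY.Z-base j))) (vec-cong (entry-Z (P.base x i) (Q.base y j)))
        ; same   = λ i → trans (corrs-meeting i i) (v7-≡ (meeting-24 i) (meeting-8 1 i i λ ()) (meeting-8 2 i i λ ()) (meeting-8 3 i i λ ())
                                                      (meeting-8 4 i i λ ()) (meeting-8 5 i i λ ()) (meeting-8 6 i i λ ()))
        ; diff   = λ i k i≢k → trans (corrs-meeting i k) (vec-cong {g = λ _ → 8} λ d → meeting-8 d i k λ eq → i≢k (sym (cong proj₁ eq)))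
        ; weight = λ i → trans (fold10-cong _+_ (λ j → reorder (entry (P.base x i) (Q.base y j))))
                           (trans (sym (Σ-blocks (λ q → 𝟙 (D (FX.φ i 0) q)))) (rowSums (FX.φ i 0)))
        }
        where
        b : ∀ i j n → entry (P.base x i) (Q.base y j) n ≤ 1
        b i j n with D (P.base x i) ((Q.T̂ ^^ n) (Q.base y j))
        ... | true  = s≤s z≤n
        ... | false = z≤n
        reorder : ∀ (k : ℕ → ℕ) → tot (vec k) ≡ sum7 k
        reorder k = solve 7 (λ a b c d e f g → a :+ (b :+ (c :+ (d :+ (e :+ (f :+ g))))) := a :+ (g :+ (f :+ (e :+ (d :+ (c :+ b))))))
          refl (k 0) (k 1) (k 2) (k 3) (k 4) (k 5) (k 6)
          where open +-*-Solver

-- Normalising the choice of base points.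

pts : (a b c d : Fin 70) → Fin 4 → Fin 70
pts a b c d 0F = a
pts a b c d 1F = b
pts a b c d 2F = c
pts a b c d 3F = d

module Change (P : Generators) where
  open Generators P

  module _ (X : Base) where
    open Base X

    private
      recover : ∀ (x′ : Fin 4 → Fin 70) (κ : Fin 10 → Fin 10) → (∀ i → base x i ∈ line (base x′ (κ i))) → ∀ z → ∃ λ i → z ∈ line (base x′ i)
      recover x′ κ h z = go (cover z)
        where
        go : (∃ λ i → z ∈ line (base x i)) → ∃ λ i → z ∈ line (base x′ i)
        go (i , z∈) = κ i , line-trans (h i) z∈

      self : ∀ y → y ∈ line y
      self y = line-∈ 0 y

      self≡ : ∀ {y w} → w ≡ y → y ∈ line w
      self≡ refl = self _

    -- Here, as in the other changes of base, κ names the new line that contains each old base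
    -- point, and `cover` is carried over line by line.
    swap01 : Base
    swap01 = record { x = x′ ; Z₀ = Z₁ ; Z₁ = Z₀ ; S₀ = S₁ ; S₁ = S₀ ; S₂ = S₂ ; cover = recover x′ κ k }
      where
      x′ = pts (x 1F) (x 0F) (x 2F) (x 3F)
      κ : Fin 10 → Fin 10
      κ 0F = 1F
      κ 1F = 0F
      κ i  = i
      k : ∀ i → base x i ∈ line (base x′ (κ i))
      k 0F = self _
      k 1F = self _
      k 2F = self _
      k 3F = self _
      k 4F = self _
      k 5F = self _
      k 6F = self _
      k 7F = self _
      k 8F = self _
      k 9F = self _

    flip2 : Base
    flip2 = record { x = x′ ; Z₀ = Z₀ ; Z₁ = Z₁ ; S₀ = S₀ ; S₁ = S₁ ; S₂ = trans (sym (ZS (x 2F))) (cong Ẑ S₂) ; cover = recover x′ κ k }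
      where
      x′ = pts (x 0F) (x 1F) (Ẑ (x 2F)) (x 3F)
      κ : Fin 10 → Fin 10
      κ 2F = 3F
      κ 3F = 2F
      κ i  = i
      k : ∀ i → base x i ∈ line (base x′ (κ i))
      k 0F = self _
      k 1F = self _
      k 2F = self≡ (Z² (x 2F))
      k 3F = self _
      k 4F = self _
      k 5F = self _
      k 6F = self _
      k 7F = self _
      k 8F = self _
      k 9F = self _

    move3 : (f : Fin 70 → Fin 70) (κ : Fin 10 → Fin 10) → (∀ i → base x i ∈ line (base (pts (x 0F) (x 1F) (x 2F) (f (x 3F))) (κ i))) → Base
    move3 f κ k = record { x = x′ ; Z₀ = Z₀ ; Z₁ = Z₁ ; S₀ = S₀ ; S₁ = S₁ ; S₂ = S₂ ; cover = recover x′ κ k }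
      where x′ = pts (x 0F) (x 1F) (x 2F) (f (x 3F))

    flip3 : Base
    flip3 = move3 Ẑ κ k
      where
      κ : Fin 10 → Fin 10
      κ 4F = 5F
      κ 5F = 4F
      κ 6F = 7F
      κ 7F = 6F
      κ 8F = 9F
      κ 9F = 8F
      κ i  = i
      k : ∀ i → base x i ∈ line (base (pts (x 0F) (x 1F) (x 2F) (Ẑ (x 3F))) (κ i))
      k 0F = self _
      k 1F = self _
      k 2F = self _
      k 3F = self _
      k 4F = self≡ (Z² (x 3F))
      k 5F = self _
      k 6F = self≡ (cong Ŝ (Z² (x 3F)))
      k 7F = self _
      k 8F = self≡ (cong (Ŝ ∘ Ŝ) (Z² (x 3F)))
      k 9F = self _

    turn3 : Base
    turn3 = move3 Ŝ κ k
      where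
      κ : Fin 10 → Fin 10
      κ 4F = 8F
      κ 5F = 9F
      κ 6F = 4F
      κ 7F = 5F
      κ 8F = 6F
      κ 9F = 7F
      κ i  = i
      k : ∀ i → base x i ∈ line (base (pts (x 0F) (x 1F) (x 2F) (Ŝ (x 3F))) (κ i))
      k 0F = self _
      k 1F = self _
      k 2F = self _
      k 3F = self _
      k 4F = self≡ (S³ (x 3F))
      k 5F = self≡ (trans (cong (Ŝ ∘ Ŝ) (ZS (x 3F))) (S³ (Ẑ (x 3F))))
      k 6F = self _
      k 7F = self≡ (ZS (x 3F))
      k 8F = self _
      k 9F = self≡ (cong Ŝ (ZS (x 3F)))

    shift3 : Base
    shift3 = move3 T̂ (λ i → i) k
      where
      step : ∀ e {w} → (Ŝ ^^ e) (T̂ w) ∈ line ((Ŝ ^^ e) w)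
      step e {w} = go e (line-∈ 1 w)
        where
        go : ∀ e {v} → v ∈ line w → (Ŝ ^^ e) v ∈ line ((Ŝ ^^ e) w)
        go zero    v∈ = v∈
        go (suc e) v∈ = line-S (go e v∈)
      z : (Ẑ (T̂ (x 3F))) ∈ line (Ẑ (x 3F))
      z = line-Z (line-∈ 1 (x 3F))
      k : ∀ i → base x i ∈ line (base (pts (x 0F) (x 1F) (x 2F) (T̂ (x 3F))) i)
      k 0F = self _
      k 1F = self _
      k 2F = self _
      k 3F = self _
      k 4F = line-sym (line-∈ 1 (x 3F))
      k 5F = line-sym z
      k 6F = line-sym (step 1)
      k 7F = line-sym (line-S z)
      k 8F = line-sym (step 2)
      k 9F = line-sym (line-S (line-S z))

-- While the two summands agree the decision passes to the next entry; the first position where they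
-- differ prefers one of the two orders.
lead-step : ∀ {a b r r′} → a ≤ 1 → b ≤ 1 → T r ⊎ T r′ → T (lead (a + b) a r) ⊎ T (lead (b + a) b r′)
lead-step z≤n       z≤n       h = h
lead-step z≤n       (s≤s z≤n) h = inj₂ _
lead-step (s≤s z≤n) z≤n       h = inj₁ _
lead-step (s≤s z≤n) (s≤s z≤n) h = h

lead3-choice : ∀ {u v} → Bits u → Bits v → T (lead3 (tr3 (u ⊕ v)) (tr3 u)) ⊎ T (lead3 (tr3 (v ⊕ u)) (tr3 v))
lead3-choice (each a b _ c _ _ _) (each a′ b′ _ c′ _ _ _) = lead-step a a′ (lead-step b b′ (lead-step c c′ (inj₁ _)))

lead7-choice : ∀ {u v} → Bits u → Bits v → T (lead7 (u ⊕ v) u) ⊎ T (lead7 (v ⊕ u) v)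
lead7-choice (each a b c d e f g) (each a′ b′ c′ d′ e′ f′ g′) =
  lead-step a a′ (lead-step b b′ (lead-step c c′ (lead-step d d′ (lead-step e e′ (lead-step f f′ (lead-step g g′ (inj₁ _)))))))

rotate : V7 → V7
rotate (v7 a b c d e f g) = v7 b c d e f g a

_≟⁷_ : V7 → V7 → Bool
v7 a b c d e f g ≟⁷ v7 a′ b′ c′ d′ e′ f′ g′ = (a ≡ᵇ a′) ∧ (b ≡ᵇ b′) ∧ (c ≡ᵇ c′) ∧ (d ≡ᵇ d′) ∧ (e ≡ᵇ e′) ∧ (f ≡ᵇ f′) ∧ (g ≡ᵇ g′)

≟⁷-sound : ∀ u v → T (u ≟⁷ v) → u ≡ v
≟⁷-sound (v7 a b c d e f g) (v7 a′ b′ c′ d′ e′ f′ g′) h =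
  v7-≡ (≡ᵇ-sound (proj₁ h₁)) (≡ᵇ-sound (proj₁ h₂)) (≡ᵇ-sound (proj₁ h₃)) (≡ᵇ-sound (proj₁ h₄)) (≡ᵇ-sound (proj₁ h₅)) (≡ᵇ-sound (proj₁ h₆)) (≡ᵇ-sound (proj₂ h₆))
  where
  h₁ = ∧-elim {a ≡ᵇ a′} h
  h₂ = ∧-elim {b ≡ᵇ b′} (proj₂ h₁)
  h₃ = ∧-elim {c ≡ᵇ c′} (proj₂ h₂)
  h₄ = ∧-elim {d ≡ᵇ d′} (proj₂ h₃)
  h₅ = ∧-elim {e ≡ᵇ e′} (proj₂ h₄)
  h₆ = ∧-elim {f ≡ᵇ f′} (proj₂ h₅)

canonical⟨_⟩ : V7 → Bool
canonical⟨ v ⟩ = any ((v ⊕ v) ≟⁷_) canonical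

canonical-sound : ∀ v → T canonical⟨ v ⟩ → v ⊕ v ∈ canonical
canonical-sound v h with w , w∈ , eq ← find (any⁻ ((v ⊕ v) ≟⁷_) canonical h) = subst (_∈ canonical) (sym (≟⁷-sound (v ⊕ v) w eq)) w∈

canonisable : V7 → Bool
canonisable v = any (λ a → any (λ e → canonical⟨ (rotate ^^ toℕ a) ((θ ^^ toℕ e) v) ⟩) (allFin 3)) (allFin 7)

all-canonisable : all canonisable (all7 (0 ∷ 1 ∷ [])) ≡ true
all-canonisable = refl

bit-∈01 : ∀ {x} → x ≤ 1 → x ∈ 0 ∷ 1 ∷ []
bit-∈01 z≤n       = here refl
bit-∈01 (s≤s z≤n) = there (here refl)

-- All 128 subsets are inspected. `rotate` and `θ` are the effects of moving the base block by `T̂`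
-- and `Ŝ`.
canonise : ∀ v → Bits v → ∃₂ λ (a : Fin 7) (e : Fin 3) → (let w = (rotate ^^ toℕ a) ((θ ^^ toℕ e) v) in w ⊕ w ∈ canonical)
canonise v b = go (find (any⁻ (λ a → any (λ e → canonical⟨ (rotate ^^ toℕ a) ((θ ^^ toℕ e) v) ⟩) (allFin 3)) (allFin 7)
    (all-∈ {p = canonisable} (≡true⇒T all-canonisable) (all7-∈ (Each-map bit-∈01 b)))))
  where
  inner : ∀ a → T (any (λ e → canonical⟨ (rotate ^^ toℕ {7} a) ((θ ^^ toℕ {3} e) v) ⟩) (allFin 3)) → _
  inner a h with e , _ , h′ ← find (any⁻ (λ e → canonical⟨ (rotate ^^ toℕ a) ((θ ^^ toℕ {3} e) v) ⟩) (allFin 3) h) =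
    a , e , canonical-sound ((rotate ^^ toℕ a) ((θ ^^ toℕ e) v)) h′
  go : (∃ λ a → a ∈ allFin 7 × T (any (λ e → canonical⟨ (rotate ^^ toℕ a) ((θ ^^ toℕ {3} e) v) ⟩) (allFin 3))) → _
  go (a , _ , h) = inner a h

module Choose (D : Design) (P Q : Generators)
  (inv-T : ∀ p b → D (Generators.T̂ P p) (Generators.T̂ Q b) ≡ D p b) (inv-S : ∀ p b → D (Generators.Ŝ P p) (Generators.Ŝ Q b) ≡ D p b) (inv-Z : ∀ p b → D (Generators.Ẑ P p) (Generators.Ẑ Q b) ≡ D p b) where
  private
    module P = Generators P
    module Q = Generators Q

  open Structured D P Q inv-T inv-S inv-Z
  open Change Q

  e : Fin 70 → Fin 70 → V7
  e p q = vec (entry p q)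

  e-bits : ∀ p q → Bits (e p q)
  e-bits p q = each (b 0) (b 1) (b 2) (b 3) (b 4) (b 5) (b 6)
    where
    𝟙≤1 : ∀ v → 𝟙 v ≤ 1
    𝟙≤1 true  = s≤s z≤n
    𝟙≤1 false = z≤n
    b : ∀ n → entry p q n ≤ 1
    b n = 𝟙≤1 (D p ((Q.T̂ ^^ n) q))

  e-T : ∀ p q → e p (Q.T̂ q) ≡ rotate (e p q)
  e-T p q = v7-≡ (k 0 1 ≈-refl) (k 1 2 ≈-refl) (k 2 3 ≈-refl) (k 3 4 ≈-refl) (k 4 5 ≈-refl) (k 5 6 ≈-refl) (k 6 0 (congruent 0 1 refl))
    where
    open Mod7
    k : ∀ n m → n + 1 ≈ m → entry p (Q.T̂ q) n ≡ entry p q m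
    k n m h = trans (cong (λ b → 𝟙 (D p b)) (sym (^^-+ Q.T̂ n 1 q))) (entry-mod p q h)

  e-T^ : ∀ a p q → e p ((Q.T̂ ^^ a) q) ≡ (rotate ^^ a) (e p q)
  e-T^ zero    p q = refl
  e-T^ (suc a) p q = trans (e-T p _) (cong rotate (e-T^ a p q))

  e-S^ : ∀ {p} → P.Ŝ p ≡ p → ∀ k q → e p ((Q.Ŝ ^^ k) q) ≡ (θ ^^ k) (e p q)
  e-S^ fix zero    q = refl
  e-S^ {p} fix (suc k) q = trans (cong (λ p → e p (Q.Ŝ ((Q.Ŝ ^^ k) q))) (sym fix)) (trans (vec-entry-S p _) (cong θ (e-S^ fix k q)))

  e-Z : ∀ {p} → P.Ẑ p ≡ p → ∀ q → e p (Q.Ẑ q) ≡ e p q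
  e-Z {p} fix q = trans (cong (λ p → e p (Q.Ẑ q)) (sym fix)) (vec-cong (entry-Z p q))

  weightOf : V7 → ℕ
  weightOf v = tot (cell (tr3 (v ⊕ v)))

  open Q.Base using (x)

  choose01 : ∀ p (Y : Q.Base) → ∃ λ (Y′ : Q.Base) → T (weightOf (e p (x Y′ 0F)) ≤ᵇ weightOf (e p (x Y′ 1F)))
  choose01 p Y = go (≤-total (weightOf (e p (x Y 0F))) (weightOf (e p (x Y 1F))))
    where
    go : _ ⊎ _ → _
    go (inj₁ le) = Y , ≤⇒≤ᵇ le
    go (inj₂ le) = swap01 Y , ≤⇒≤ᵇ le

  choose2 : ∀ p (Y : Q.Base) → ∃ λ (Y′ : Q.Base) → x Y′ 0F ≡ x Y 0F × x Y′ 1F ≡ x Y 1F ×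
    T (lead3 (tr3 (e p (x Y′ 2F) ⊕ e p (Q.Ẑ (x Y′ 2F)))) (tr3 (e p (x Y′ 2F))))
  choose2 p Y = go (lead3-choice (e-bits p y) (e-bits p (Q.Ẑ y)))
    where
    y = x Y 2F
    go : T (lead3 (tr3 (e p y ⊕ e p (Q.Ẑ y))) (tr3 (e p y))) ⊎ T (lead3 (tr3 (e p (Q.Ẑ y) ⊕ e p y)) (tr3 (e p (Q.Ẑ y)))) → _
    go (inj₁ h) = Y , refl , refl , h
    go (inj₂ h) = flip2 Y , refl , refl ,
      subst (λ w → T (lead3 (tr3 (e p (Q.Ẑ y) ⊕ e p w)) (tr3 (e p (Q.Ẑ y))))) (sym (Q.Z² y)) h

  Same012 : Q.Base → Q.Base → Set
  Same012 Y Y′ = x Y′ 0F ≡ x Y 0F × x Y′ 1F ≡ x Y 1F × x Y′ 2F ≡ x Y 2F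

  turns : ℕ → Q.Base → Q.Base
  turns zero    Y = Y
  turns (suc k) Y = turn3 (turns k Y)

  shifts : ℕ → Q.Base → Q.Base
  shifts zero    Y = Y
  shifts (suc k) Y = shift3 (shifts k Y)

  turns-same : ∀ k Y → Same012 Y (turns k Y) × x (turns k Y) 3F ≡ (Q.Ŝ ^^ k) (x Y 3F)
  turns-same zero    Y = (refl , refl , refl) , refl
  turns-same (suc k) Y with s , eq ← turns-same k Y = s , cong Q.Ŝ eq

  shifts-same : ∀ k Y → Same012 Y (shifts k Y) × x (shifts k Y) 3F ≡ (Q.T̂ ^^ k) (x Y 3F)
  shifts-same zero    Y = (refl , refl , refl) , refl
  shifts-same (suc k) Y with s , eq ← shifts-same k Y = s , cong Q.T̂ eq

  same-trans : ∀ {Y₁ Y₂ Y₃} → Same012 Y₁ Y₂ → Same012 Y₂ Y₃ → Same012 Y₁ Y₃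
  same-trans (a , b , c) (a′ , b′ , c′) = trans a′ a , trans b′ b , trans c′ c

  -- `Ŝ` and `T̂` move the last base point until the entry at p is canonical; then `Ẑ` adjusts the
  -- sign condition at r. The second adjustment preserves the first, because p is fixed by `P.Ẑ`.
  choose3 : ∀ p {r} → P.Ŝ p ≡ p → P.Ẑ p ≡ p → ∀ (Y : Q.Base) → ∃ λ (Y′ : Q.Base) → Same012 Y Y′ ×
    e p (x Y′ 3F) ⊕ e p (Q.Ẑ (x Y′ 3F)) ∈ canonical ×
    T (lead7 (e r (x Y′ 3F) ⊕ e r (Q.Ẑ (x Y′ 3F))) (e r (x Y′ 3F)))
  choose3 p {r} fixS fixZ Y = go (canonise (e p (x Y 3F)) (e-bits p (x Y 3F)))
    where
    twice : ∀ y → e p y ⊕ e p y ∈ canonical → e p y ⊕ e p (Q.Ẑ y) ∈ canonical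
    twice y h = subst (λ w → e p y ⊕ w ∈ canonical) (sym (e-Z fixZ y)) h
    go : (∃₂ λ (a : Fin 7) (k : Fin 3) → (let w = (rotate ^^ toℕ a) ((θ ^^ toℕ k) (e p (x Y 3F))) in w ⊕ w ∈ canonical)) → _
    go (a , k , h) = settle (lead7-choice (e-bits r y) (e-bits r (Q.Ẑ y)))
      where
      Y₁ = turns (toℕ k) Y
      Y₂ = shifts (toℕ a) Y₁
      y = x Y₂ 3F
      y≡ : e p y ≡ (rotate ^^ toℕ a) ((θ ^^ toℕ k) (e p (x Y 3F)))
      y≡ = trans (cong (e p) (trans (proj₂ (shifts-same (toℕ a) Y₁)) (cong (Q.T̂ ^^ toℕ a) (proj₂ (turns-same (toℕ k) Y)))))
        (trans (e-T^ (toℕ a) p _) (cong (rotate ^^ toℕ a) (e-S^ fixS (toℕ k) (x Y 3F))))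
      same : Same012 Y Y₂
      same = same-trans {Y} {Y₁} {Y₂} (proj₁ (turns-same (toℕ k) Y)) (proj₁ (shifts-same (toℕ a) Y₁))
      h′ : e p y ⊕ e p y ∈ canonical
      h′ = subst (λ w → w ⊕ w ∈ canonical) (sym y≡) h
      settle : T (lead7 (e r y ⊕ e r (Q.Ẑ y)) (e r y)) ⊎ T (lead7 (e r (Q.Ẑ y) ⊕ e r y) (e r (Q.Ẑ y))) → _
      settle (inj₁ l) = Y₂ , same , twice y h′ , l
      settle (inj₂ l) = flip3 Y₂ , same , twice (Q.Ẑ y) (subst (λ w → w ⊕ w ∈ canonical) (sym (e-Z fixZ y)) h′) ,
        subst (λ w → T (lead7 (e r (Q.Ẑ y) ⊕ e r w) (e r (Q.Ẑ y)))) (sym (Q.Z² y)) l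

-- The classification.

opaque
  unfolding B J M ν invJ

  -- Evaluates the whole search. The moduli and `invJ` are unfolded for this purpose, while the
  -- completeness proofs keep them symbolic.
  classified : allPairs (lift leafOK) (triples rows₀ rows₁ rows₂) ≡ true
  classified = refl

Half-resp : ∀ {c d : Blocks} → (∀ i j → c i j ≡ d i j) → Half c → Half d
Half-resp {c} {d} eq h = record
  { isBit  = λ i j → subst Bits (eq i j) (isBit i j)
  ; σ-inv  = λ i j → trans (sym (eq _ _)) (trans (σ-inv i j) (cong θ (eq i j)))
  ; ζ-inv  = λ i j → trans (sym (eq _ _)) (trans (ζ-inv i j) (eq i j))
  ; same   = λ i → trans (sym (corrs-eq i i)) (same i)
  ; diff   = λ i k p → trans (sym (corrs-eq i k)) (diff i k p)
  ; weight = λ i → trans (sym (fold10-cong _+_ (λ j → cong tot (eq i j)))) (weight i) }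
  where
  open Half h
  corrs-eq : ∀ i k → corrs c i k ≡ corrs d i k
  corrs-eq i k = fold10-cong _⊕_ (λ j → cong₂ corr (eq i j) (eq k j))

record Normal (c : Blocks) : Set where
  field
    half      : Half c
    half′     : Half (transp c)
  open Sound c half
  module C = Sound (transp c) half′
  field
    isOrdered : T (ordered triple)
    canon     : m 0F 4F ∈ canonical
    canon′    : C.m 0F 4F ∈ canonical
    leads₃    : T (lead3 (t 2F 2F) (tr3 (c 2F 2F)))
    leads₇    : T (lead7 (m 2F 4F) (c 2F 4F))
    leads₇′   : T (lead7 (C.m 2F 4F) (transp c 2F 4F))

normal-known : ∀ {c} → Normal c → ∃ λ k → ∃ λ dual → toD c ≅ toD (variant dual (toℕ {9} k))
normal-known {c} nf = known-≅ L L-!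
  (lift-sound leafOK leads₃ leads₇ leads₇′
    (Pr.allPairs-sound (lift leafOK) (triples rows₀ rows₁ rows₂) (≡true⇒T classified)
      (Pr.R.triple-∈ canon) (Pr.C.triple-∈ canon′) isOrdered))
  where
  open Normal nf
  module Pr = Pair c half half′
  open Lifted c half half′

known-variant : ∀ D c → D ≅ toD c → (∃ λ k → ∃ λ dual → toD c ≅ toD (variant dual (toℕ {9} k))) →
  ∃ λ i → (D ≅ Ds i) ⊎ (D ≅ dual (Ds i))
known-variant D c iso (k , false , iso′) = k , inj₁ (≅-trans {D} {toD c} {Ds k} iso iso′)
known-variant D c iso (k , true  , iso′) = k , inj₂ (≅-pointwise {D} {toD (transp (table (toℕ k)))} {dual (Ds k)} (toD-transp (table (toℕ k)))
  (≅-trans {D} {toD c} {toD (transp (table (toℕ k)))} iso iso′))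

module Normalise (D : Design) (rowSums : ∀ p → ΣF (λ q → 𝟙 (D p q)) ≡ 24) (columnSums : ∀ b → ΣF (λ p → 𝟙 (D p b)) ≡ 24)
  (points : ∀ p q → p ≢ q → ΣF (λ b → 𝟙 (D p b) * 𝟙 (D q b)) ≡ 8) (blocks : ∀ b c → b ≢ c → ΣF (λ p → 𝟙 (D p b) * 𝟙 (D p c)) ≡ 8)
  (P Q : Generators)
  (inv-T : ∀ p b → D (Generators.T̂ P p) (Generators.T̂ Q b) ≡ D p b) (inv-S : ∀ p b → D (Generators.Ŝ P p) (Generators.Ŝ Q b) ≡ D p b) (inv-Z : ∀ p b → D (Generators.Ẑ P p) (Generators.Ẑ Q b) ≡ D p b)
  (X₀ : Generators.Base P) (Y₀ : Generators.Base Q) where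
  private
    module P = Generators P
    module Q = Generators Q

  D′ : Design
  D′ p b = D b p

  module S  = Structured D P Q inv-T inv-S inv-Z
  module S′ = Structured D′ Q P (λ p b → inv-T b p) (λ p b → inv-S b p) (λ p b → inv-Z b p)
  module Ch  = Choose D P Q inv-T inv-S inv-Z
  module Ch′ = Choose D′ Q P (λ p b → inv-T b p) (λ p b → inv-S b p) (λ p b → inv-Z b p)
  open Q.Base using () renaming (x to y)
  open P.Base using (x)

  p₀ p₂ : Fin 70
  p₀ = x X₀ 0F
  p₂ = x X₀ 2F

  -- The order of the choices matters: the blocks are normalised against the points `p₀` and `p₂`,
  -- after which only the regular base point changes, and that change is made against the final `Y`.
  first  = Ch.choose01 p₀ Y₀
  second = Ch.choose2 p₂ (proj₁ first)
  third  = Ch.choose3 p₀ {p₂} (P.Base.S₀ X₀) (P.Base.Z₀ X₀) (proj₁ second)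

  Y : Q.Base
  Y = proj₁ third

  fourth = Ch′.choose3 (y Y 0F) {y Y 2F} (Q.Base.S₀ Y) (Q.Base.Z₀ Y) X₀

  X : P.Base
  X = proj₁ fourth

  x₀≡ : x X 0F ≡ p₀
  x₀≡ = proj₁ (proj₁ (proj₂ fourth))
  x₂≡ : x X 2F ≡ p₂
  x₂≡ = proj₂ (proj₂ (proj₁ (proj₂ fourth)))
  y₀≡ : y Y 0F ≡ y (proj₁ first) 0F
  y₀≡ = trans (proj₁ (proj₁ (proj₂ third))) (proj₁ (proj₂ second))
  y₁≡ : y Y 1F ≡ y (proj₁ first) 1F
  y₁≡ = trans (proj₁ (proj₂ (proj₁ (proj₂ third)))) (proj₁ (proj₂ (proj₂ second)))
  y₂≡ : y Y 2F ≡ y (proj₁ second) 2F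
  y₂≡ = proj₂ (proj₂ (proj₁ (proj₂ third)))

  c : Blocks
  c = S.Blocked.c X Y

  c′ : Blocks
  c′ = S′.Blocked.c Y X

  c′≡ : ∀ i j → c′ i j ≡ transp c i j
  c′≡ i j = v7-≡ (k 0 0 (congruent 0 0 refl)) (k 1 6 (congruent 0 0 refl)) (k 2 5 (congruent 0 1 refl)) (k 3 4 (congruent 0 2 refl))
                 (k 4 3 (congruent 0 3 refl)) (k 5 2 (congruent 0 4 refl)) (k 6 1 (congruent 0 5 refl))
    where
    open Mod7
    k : ∀ n m → 6 * n ≈ m → S′.entry (Q.base (y Y) i) (P.base (x X) j) n ≡ S.entry (P.base (x X) j) (Q.base (y Y) i) m
    k n m h = trans (cong 𝟙 (S.D-unshift n (P.base (x X) j) 0 (Q.base (y Y) i))) (S.entry-mod (P.base (x X) j) (Q.base (y Y) i) h)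

  normal : Normal c
  normal = record
    { half      = S.Blocked.half X Y rowSums points
    ; half′     = Half-resp c′≡ (S′.Blocked.half Y X columnSums blocks)
    ; isOrdered = order x₀≡ y₀≡ y₁≡ (proj₂ first)
    ; canon     = subst (λ p → Ch.e p (y Y 3F) ⊕ Ch.e p (Q.Ẑ (y Y 3F)) ∈ canonical) (sym x₀≡) (proj₁ (proj₂ (proj₂ third)))
    ; canon′    = subst₂ (λ u v → u ⊕ v ∈ canonical) (c′≡ 0F 4F) (c′≡ 0F 5F) (proj₁ (proj₂ (proj₂ fourth)))
    ; leads₃    = lead₃ x₂≡ y₂≡ (proj₂ (proj₂ (proj₂ second)))
    ; leads₇    = subst (λ p → T (lead7 (Ch.e p (y Y 3F) ⊕ Ch.e p (Q.Ẑ (y Y 3F))) (Ch.e p (y Y 3F)))) (sym x₂≡) (proj₂ (proj₂ (proj₂ third)))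
    ; leads₇′   = subst₂ (λ u v → T (lead7 (u ⊕ v) u)) (c′≡ 2F 4F) (c′≡ 2F 5F) (proj₂ (proj₂ (proj₂ fourth)))
    }
    where
    order : ∀ {p p′ q q′ r r′} → p ≡ p′ → q ≡ q′ → r ≡ r′ → T (Ch.weightOf (Ch.e p′ q′) ≤ᵇ Ch.weightOf (Ch.e p′ r′)) →
      T (Ch.weightOf (Ch.e p q) ≤ᵇ Ch.weightOf (Ch.e p r))
    order refl refl refl h = h
    lead₃ : ∀ {p p′ q q′} → p ≡ p′ → q ≡ q′ → T (lead3 (tr3 (Ch.e p′ q′ ⊕ Ch.e p′ (Q.Ẑ q′))) (tr3 (Ch.e p′ q′))) →
      T (lead3 (tr3 (Ch.e p q ⊕ Ch.e p (Q.Ẑ q))) (tr3 (Ch.e p q)))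
    lead₃ refl refl h = h

  result : ∃ λ i → (D ≅ Ds i) ⊎ (D ≅ dual (Ds i))
  result = known-variant D c (S.Blocked.D≅toD X Y) (normal-known normal)

meets-sum : ∀ {n} {D : Fin n → Fin n → Bool} {k} → (∀ p q → p ≢ q → count (λ b → D p b ∧ D q b) ≡ k) →
  ∀ p q → p ≢ q → ΣF (λ b → 𝟙 (D p b) * 𝟙 (D q b)) ≡ k
meets-sum {D = D} h p q p≢q = trans (sym (count-∧ (D p) (D q))) (h p q p≢q)

complete : ∀ D → Admits D → ∃ λ i → (D ≅ Ds i) ⊎ (D ≅ dual (Ds i))
complete D (sym-D , ρ , β , action , lengthsP , lengthsB) = Normalise.result D
    (proj₁ (dual-symmetric D sym-D)) (proj₁ sym-D) (meets-sum {D = D} (proj₂ sym-D)) (meets-sum {D = dual D} (proj₂ (dual-symmetric D sym-D)))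
    Pts.generators Bls.generators (byAutos Pts.t) (byAutos Pts.s) (byAutos Pts.z) (Pts.bases lengthsP) (Bls.bases lengthsB)
  where
  open IsFaithfulAutAction action
  module Pts = FromAction ρ homP
  module Bls = FromAction β homB

certificate-≅ : ∀ u π o π′ o′ c d → validAff u π ≡ true → validAff u π′ ≡ true →
  all (λ i → all (λ j → affine-at u (d (index (π ! i)) (index (π′ ! j))) (c i j) (o′ ! j + 6 * (o ! i))) (allFin 10)) (allFin 10) ≡ true →
  toD c ≅ toD d
certificate-≅ u π o π′ o′ c d v v′ h = perm α vα , perm β vβ , toD-affine α β c d vα vβ refl
    (∀-Fin₂ (λ i j → affine-at u (d (index (π ! i)) (index (π′ ! j))) (c i j) (o′ ! j + 6 * (o ! i))) h)
  where
  open Affine using (perm)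
  α = affineOf u π o
  β = affineOf u π′ o′
  vα = validAff-sound u π o (≡true⇒T v)
  vβ = validAff-sound u π′ o′ (≡true⇒T v′)

-- They satisfy o (σ i) - 2 o i ≡ 4 modulo 7 and o (ζ i) = o i for every class i, so that with the
-- multiplier 6 = -1 the map x ↦ o i - x normalises the group.
offsets : X10 ℕ
offsets = x10 3 3 3 3 0 0 4 4 5 5

selfDual₀ : SelfDual (Ds 0F)
selfDual₀ = ≅-pointwise {Ds 0F} {toD (transp (table 0))} {dual (Ds 0F)} (toD-transp (table 0)) (certificate-≅ 6 π offsets π offsets (table 0) (transp (table 0)) refl refl refl)
  where π = x10 0 1 3 2 4 5 6 7 8 9

selfDual₁ : SelfDual (Ds 1F)
selfDual₁ = ≅-pointwise {Ds 1F} {toD (transp (table 1))} {dual (Ds 1F)} (toD-transp (table 1)) (certificate-≅ 6 π offsets π offsets (table 1) (transp (table 1)) refl refl refl)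
  where π = x10 0 1 2 3 4 5 6 7 8 9

theorem3 : Σ (Fin 9 → Design) λ Ds →
    (∀ i → Admits (Ds i)) ×
    (∀ D → Admits D → ∃ λ i → (D ≅ Ds i) ⊎ (D ≅ dual (Ds i))) ×
    (∀ i j → (Ds i ≅ Ds j) ⊎ (Ds i ≅ dual (Ds j)) → i ≡ j) ×
    (∃₂ λ i j → i ≢ j × SelfDual (Ds i) × SelfDual (Ds j) ×
    (∀ k → SelfDual (Ds k) → k ≡ i ⊎ k ≡ j)) ×
    (∀ i → FullAutIsG (Ds i))
theorem3 = Ds , admits-Ds , complete , distinct-Ds ,
  (0F , 1F , (λ ()) , selfDual₀ , selfDual₁ , self-dual-only) , fullAut-Ds
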